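{- There exists an absolute constant $c>0$ such that for every integer $n\ge 2$ and every $\varepsilon\in(0,1/3)$, $$\operatorname{hcP-deg}_\varepsilon(\mathrm{OR}_n)\;\ge\; c\cdot\frac{\log\binom{n}{\le \log(1/\varepsilon)}}{\log^2\!\left(\log\binom{n}{\le\log(1/\varepsilon)}\right)} .$$
   Context: All logarithms are to base 2, and $\log^2(y)$ means $(\log y)^2$. For a positive integer $N$ and real $\alpha\ge 0$, $\binom{N}{\le\alpha}:=\sum_{i\in\mathbb{Z},\,0\le i\le\alpha}\binom{N}{i}$, with $\binom{N}{i}=0$ if $i>N$. $\mathrm{OR}_n:\{0,1\}^n\to\{0,1\}$ is the function with $\mathrm{OR}_n(x)=0$ iff $x=0^n$. A linear form is a homogeneous degree-one polynomial $L(x)=a_1x_1+\dots+a_nx_n$ with $a_i\in\mathbb{R}$ (the zero form is allowed). A polynomial $P\in\mathbb{R}[x_1,\dots,x_n]$ is a hyperplane covering polynomial of degree $t$ if there exist $t$ linear forms $L_1,\dots,L_t$ over $\mathbb{R}$ such that $P(x)=1-\prod_{i=1}^t(1-L_i(x))$. For $f:\{0,1\}^n\to\{0,1\}$, an $\varepsilon$-error probabilistic polynomial for $f$ is a probability distribution $\mathbf{P}$ on polynomials in $\mathbb{R}[x_1,\dots,x_n]$ such that for every $x\in\{0,1\}^n$, $\Pr_{P\sim\mathbf{P}}[P(x)\ne f(x)]\le\varepsilon$. The $\varepsilon$-error hyperplane covering probabilistic degree $\operatorname{hcP-deg}_\varepsilon(f)$ is the smallest non-negative integer $d$ such that there is an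 $\varepsilon$-error probabilistic polynomial for $f$ supported entirely on hyperplane covering polynomials of degree at most $d$. -}

module Defs where

open import Algebra.Bundles using (CommutativeRing; Semiring)
import Algebra.Definitions.RawSemiring as RawSemiringDefs
open import Axiom.ExcludedMiddle using (ExcludedMiddle)
open import Data.Bool.Base using (Bool; false; if_then_else_; not)
import Data.Bool.Properties as Bool
open import Data.Fin.Base using (Fin; zero; suc; toℕ)
open import Data.Nat.Base as ℕ using (ℕ; zero; suc)
open import Data.Nat.Combinatorics using (_C_)
open import Data.Product.Base using (∃; ∃-syntax; Σ-syntax; _×_; _,_; proj₁)
open import Data.Unit.Base using (⊤)
open import Data.Vec.Base as Vec using (Vec)
open import Data.Vec.Functional as Vector using (Vector)
open import Data.Vec.Properties using (≡-dec)
open import Function.Base using (case_of_)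
open import Function.Bundles using (_⇔_)
open import Level using (0ℓ) renaming (suc to lsuc)
open import Relation.Binary.Bundles using (Setoid)
open import Relation.Binary.Core using (Rel)
open import Relation.Binary.PropositionalEquality.Core using (_≢_)
open import Relation.Binary.Structures using (IsTotalOrder)
open import Relation.Nullary using (¬_; yes; no; does)
open import Relation.Unary using (Pred; _∈_)

-- The real numbers, axiomatised as a complete ordered field (unique up to
-- isomorphism).  The value of 0# ⁻¹ is left unspecified.

record CompleteOrderedField : Set (lsuc 0ℓ) where
  field
    commutativeRing : CommutativeRing 0ℓ 0ℓ

  open CommutativeRing commutativeRing public hiding (zero)

  infix 4 _≤_
  infix 8 _⁻¹

  field
    0≉1       : ¬ (0# ≈ 1#)
    _⁻¹       : Carrier → Carrier
    ⁻¹-cong   : ∀ {x y} → x ≈ y → x ⁻¹ ≈ y ⁻¹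
    *-inverse : ∀ x → ¬ (x ≈ 0#) → x * x ⁻¹ ≈ 1#

    _≤_          : Rel Carrier 0ℓ
    isTotalOrder : IsTotalOrder _≈_ _≤_
    +-monoʳ-≤    : ∀ x {y z} → y ≤ z → x + y ≤ x + z
    *-nonNeg     : ∀ {x y} → 0# ≤ x → 0# ≤ y → 0# ≤ x * y

  UpperBound : Pred Carrier 0ℓ → Carrier → Set
  UpperBound S u = ∀ {x} → x ∈ S → x ≤ u

  IsSup : Pred Carrier 0ℓ → Carrier → Set
  IsSup S s = UpperBound S s × (∀ {u} → UpperBound S u → s ≤ u)

  field
    complete : (S : Pred Carrier 0ℓ) → ∃ S → ∃ (UpperBound S) → ∃ (IsSup S)

  open RawSemiringDefs (Semiring.rawSemiring semiring) public using (sum; _^_) renaming (_×_ to _·_)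

  infix 4 _<_
  _<_ : Rel Carrier 0ℓ
  x < y = x ≤ y × ¬ (x ≈ y)

  infixl 7 _/_
  _/_ : Carrier → Carrier → Carrier
  x / y = x * y ⁻¹

  fromℕ : ℕ → Carrier
  fromℕ k = k · 1#

module Polynomials (ℝ : CompleteOrderedField) where
  open CompleteOrderedField ℝ

  -- ℝ[x₀,…,xₙ] is represented as ℝ[x₁,…,xₙ][x₀]: p ∷ P stands for p + x₀ P.

  infixr 5 _∷_
  data Poly : ℕ → Set where
    [_] : Carrier → Poly zero
    []  : ∀ {n} → Poly (suc n)
    _∷_ : ∀ {n} → Poly n → Poly (suc n) → Poly (suc n)

  const : ∀ {n} → Carrier → Poly n
  const {zero}  a = [ a ]
  const {suc n} a = const a ∷ []

  var : ∀ {n} → Fin n → Poly n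
  var zero    = const 0# ∷ const 1# ∷ []
  var (suc i) = var i ∷ []

  infixl 6 _+ᴾ_
  _+ᴾ_ : ∀ {n} → Poly n → Poly n → Poly n
  [ a ]   +ᴾ [ b ]   = [ a + b ]
  []      +ᴾ Q       = Q
  (p ∷ P) +ᴾ []      = p ∷ P
  (p ∷ P) +ᴾ (q ∷ Q) = (p +ᴾ q) ∷ (P +ᴾ Q)

  mutual
    infixl 7 _*ᴾ_
    _*ᴾ_ : ∀ {n} → Poly n → Poly n → Poly n
    [ a ]   *ᴾ [ b ] = [ a * b ]
    []      *ᴾ Q     = []
    (p ∷ P) *ᴾ Q     = scale p Q +ᴾ (const 0# ∷ (P *ᴾ Q))

    scale : ∀ {n} → Poly n → Poly (suc n) → Poly (suc n)
    scale p []      = []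
    scale p (q ∷ Q) = (p *ᴾ q) ∷ scale p Q

  infixl 6 _-ᴾ_
  _-ᴾ_ : ∀ {n} → Poly n → Poly n → Poly n
  P -ᴾ Q = P +ᴾ const (- 1#) *ᴾ Q

  -- coeff P m is the coefficient of x₀^m₀ x₁^m₁ ⋯.

  coeff : ∀ {n} → Poly n → Vec ℕ n → Carrier
  coeff [ a ]   _               = a
  coeff []      _               = 0#
  coeff (p ∷ P) (zero  Vec.∷ m) = coeff p m
  coeff (p ∷ P) (suc k Vec.∷ m) = coeff P (k Vec.∷ m)

  infix 4 _≈ᴾ_
  _≈ᴾ_ : ∀ {n} → Rel (Poly n) 0ℓ
  P ≈ᴾ Q = ∀ m → coeff P m ≈ coeff Q m

  polySetoid : ℕ → Setoid 0ℓ 0ℓ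
  polySetoid n = record
    { Carrier       = Poly n
    ; _≈_           = _≈ᴾ_
    ; isEquivalence = record
      { refl  = λ _ → refl
      ; sym   = λ P≈Q m → sym (P≈Q m)
      ; trans = λ P≈Q Q≈R m → trans (P≈Q m) (Q≈R m)
      }
    }

  eval : ∀ {n} → Poly n → Vector Carrier n → Carrier
  eval [ a ]   x = a
  eval []      x = 0#
  eval (p ∷ P) x = eval p (Vector.tail x) + Vector.head x * eval P x

  eval-zero : ∀ {n} (P : Poly n) → (∀ m → coeff P m ≈ 0#) → ∀ x → eval P x ≈ 0#
  eval-zero [ a ]   a≈0 x = a≈0 Vec.[]
  eval-zero []      _   x = refl
  eval-zero (p ∷ P) P≈0 x = trans
    (+-cong
      (eval-zero p (λ m → P≈0 (0 Vec.∷ m)) _)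
      (trans (*-congˡ (eval-zero P (λ { (k Vec.∷ m) → P≈0 (suc k Vec.∷ m) }) x))
             (zeroʳ _)))
    (+-identityʳ 0#)

  eval-cong : ∀ {n} (P Q : Poly n) → P ≈ᴾ Q → ∀ x → eval P x ≈ eval Q x
  eval-cong [ a ]   [ b ]   a≈b x = a≈b Vec.[]
  eval-cong []      Q       0≈Q x = sym (eval-zero Q (λ m → sym (0≈Q m)) x)
  eval-cong (p ∷ P) []      P≈0 x = eval-zero (p ∷ P) P≈0 x
  eval-cong (p ∷ P) (q ∷ Q) P≈Q x = +-cong
    (eval-cong p q (λ m → P≈Q (0 Vec.∷ m)) _)
    (*-congˡ (eval-cong P Q (λ { (k Vec.∷ m) → P≈Q (suc k Vec.∷ m) }) x))

  LinearForm : ℕ → Set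
  LinearForm n = Vector Carrier n

  linear : ∀ {n} → LinearForm n → Poly n
  linear a = Vector.foldr _+ᴾ_ (const 0#) (λ i → const (a i) *ᴾ var i)

  IsHyperplaneCovering : ∀ {n} → ℕ → Poly n → Set
  IsHyperplaneCovering {n} t P = Σ[ L ∈ Vector (LinearForm n) t ]
    P ≈ᴾ const 1# -ᴾ Vector.foldr _*ᴾ_ (const 1#) (λ i → const 1# -ᴾ linear (L i))

module Probability (ℝ : CompleteOrderedField) where
  open CompleteOrderedField ℝ

  -- Subsets of the quotient of a setoid.

  record Event (Ω : Setoid 0ℓ 0ℓ) : Set (lsuc 0ℓ) where
    private module Ω = Setoid Ω
    field
      holds    : Pred Ω.Carrier 0ℓ
      respects : ∀ {x y} → x Ω.≈ y → holds x → holds y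

  open Event public

  module _ {Ω : Setoid 0ℓ 0ℓ} where
    private module Ω = Setoid Ω

    infix 4 _≐_
    _≐_ : Event Ω → Event Ω → Set
    E ≐ F = ∀ x → holds E x ⇔ holds F x

    whole : Event Ω
    whole = record { holds = λ _ → ⊤ ; respects = λ _ _ → _ }

    ∁ : Event Ω → Event Ω
    ∁ E = record
      { holds    = λ x → ¬ holds E x
      ; respects = λ x≈y ¬Ex Ey → ¬Ex (respects E (Ω.sym x≈y) Ey)
      }

    ⋃ : (ℕ → Event Ω) → Event Ω
    ⋃ E = record
      { holds    = λ x → ∃[ k ] holds (E k) x
      ; respects = λ { x≈y (k , Ekx) → k , respects (E k) x≈y Ekx }
      }

    Disjoint : (ℕ → Event Ω) → Set
    Disjoint E = ∀ {i j} → i ≢ j → ∀ x → holds (E i) x → ¬ holds (E j) x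

  HasSum : (ℕ → Carrier) → Carrier → Set
  HasSum a s = ∀ δ → 0# < δ → ∃[ N ] ∀ m → N ℕ.≤ m →
    s - δ < partialSum m × partialSum m < s + δ
    where
    partialSum : ℕ → Carrier
    partialSum m = sum {m} (λ i → a (toℕ i))

  -- A σ-algebra with a countably additive probability measure on it; Pr is
  -- only meaningful on measurable events.

  record Distribution (Ω : Setoid 0ℓ 0ℓ) : Set (lsuc 0ℓ) where
    field
      Measurable       : Event Ω → Set
      measurable-resp  : ∀ {E F} → E ≐ F → Measurable E → Measurable F
      measurable-whole : Measurable whole
      measurable-∁     : ∀ {E} → Measurable E → Measurable (∁ E)
      measurable-⋃     : ∀ {E} → (∀ k → Measurable (E k)) → Measurable (⋃ E)

      Pr          : Event Ω → Carrier
      Pr-resp     : ∀ {E F} → Measurable E → E ≐ F → Pr E ≈ Pr F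
      Pr-nonNeg   : ∀ {E} → Measurable E → 0# ≤ Pr E
      Pr-whole    : Pr whole ≈ 1#
      Pr-additive : ∀ {E} → (∀ k → Measurable (E k)) → Disjoint E →
                    HasSum (λ k → Pr (E k)) (Pr (⋃ E))

  SupportedOn : {Ω : Setoid 0ℓ 0ℓ} → Distribution Ω → Pred (Setoid.Carrier Ω) 0ℓ → Set (lsuc 0ℓ)
  SupportedOn D Q = ∃[ E ] Measurable E × Pr E ≈ 1# × (∀ x → holds E x → Q x)
    where open Distribution D

OR : ∀ n → Vec Bool n → Bool
OR n x = not (does (≡-dec Bool._≟_ x (Vec.replicate n false)))

module ProbabilisticDegree (ℝ : CompleteOrderedField) where
  open CompleteOrderedField ℝ
  open Polynomials ℝ
  open Probability ℝ

  fromBool : Bool → Carrier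
  fromBool b = if b then 1# else 0#

  errorAt : ∀ {n} → (Vec Bool n → Bool) → Vec Bool n → Event (polySetoid n)
  errorAt {n} f x = record
    { holds    = λ P → ¬ (eval P point ≈ fromBool (f x))
    ; respects = λ {P} {Q} P≈Q P≉f Q≈f → P≉f (trans (eval-cong P Q P≈Q point) Q≈f)
    }
    where
    point : Vector Carrier n
    point i = fromBool (Vec.lookup x i)

  IsProbabilisticPolynomial : ∀ {n} → Carrier → (Vec Bool n → Bool) →
                              Distribution (polySetoid n) → Set
  IsProbabilisticPolynomial ε f D =
    ∀ x → Measurable (errorAt f x) × Pr (errorAt f x) ≤ ε
    where open Distribution D

  HasHcPDegreeAtMost : ∀ {n} → Carrier → (Vec Bool n → Bool) → ℕ → Set (lsuc 0ℓ)
  HasHcPDegreeAtMost {n} ε f d = Σ[ D ∈ Distribution (polySetoid n) ]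
    IsProbabilisticPolynomial ε f D ×
    SupportedOn D (λ P → ∃[ t ] t ℕ.≤ d × IsHyperplaneCovering t P)

-- Excluded middle makes sup, log₂, binom≤ and hcP-deg total functions.

module Classical (lem : ∀ {ℓ} → ExcludedMiddle ℓ) (ℝ : CompleteOrderedField) where
  open CompleteOrderedField ℝ
  open ProbabilisticDegree ℝ

  -- 0# when S has no supremum.

  sup : Pred Carrier 0ℓ → Carrier
  sup S = case lem {P = ∃ (IsSup S)} of λ
    { (yes (s , _)) → s
    ; (no _)        → 0#
    }

  -- For y > 0, the supremum of the rationals r = (a - b) / q with 2^r ≤ y,
  -- that is, with 2^a ≤ y^q 2^b.

  log₂ : Carrier → Carrier
  log₂ y = sup λ r → ∃[ a ] ∃[ b ] ∃[ q ]
    (0 ℕ.< q ×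
     r ≈ (fromℕ a - fromℕ b) / fromℕ q ×
     fromℕ 2 ^ a ≤ y ^ q * fromℕ 2 ^ b)

  -- Terms with i > N vanish, so the sum stops at N even when α > N.

  binom≤ : ℕ → Carrier → ℕ
  binom≤ N α = Vector.foldr ℕ._+_ 0 {suc N} λ i →
    if does (lem {P = fromℕ (toℕ i) ≤ α}) then N C (toℕ i) else 0

  -- 0 when no number satisfies Q.

  least : (ℕ → Set (lsuc 0ℓ)) → ℕ
  least Q = case lem {P = ∃[ d ] Q d × (∀ e → Q e → d ℕ.≤ e)} of λ
    { (yes (d , _)) → d
    ; (no _)        → 0
    }

  hcP-deg : ∀ {n} → Carrier → (Vec Bool n → Bool) → ℕ
  hcP-deg ε f = least (HasHcPDegreeAtMost ε f)

-- By Yao's principle it suffices to find a distribution on nonzero points of the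
-- cube that few hyperplanes cannot cover up to a measure 2⁻ᵏ, where 2ᵏ ≤ 1/ε.
-- Take a random scale j and a point whose bits are true with probability about
-- R⁻ʲ / d, with R polynomial in the number d of hyperplanes.  A linear form with
-- support much larger than Rʲ is anti-concentrated (Kleitman's form of the
-- Littlewood-Offord bound), one with support much smaller most likely has no
-- variable in play, and m forms are missed simultaneously with probability at
-- least 2⁻ᵐ because their product has degree m.  The windows in between are
-- disjoint, so over J scales, where Rᴶ ≤ n, the average of m is at most d / J, and
-- by convexity of 2⁻ᵐ this gives d ≥ 2 J k / 3.  The uniform distribution gives
-- d ≥ k - 1, and together (n + 1)ᵏ ≤ 2^(64 d ℓ) whenever d < 2^ℓ.

module Submission where

-- The obstacle is to treat all forms at one point although each tool suits only some of them.
-- Greedy absorption yields a set `U` of variables such that every form either lies inside `U` or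
-- keeps `κ` variables outside it. Whatever the bits in `U` are, a form of the second kind takes the
-- value 1 with probability at most 1 / 8(d + 1), so a union bound over these forms, and over the
-- event that the point is zero, loses at most an eighth. A form of the first kind has support at
-- most R s, where R is the ratio of consecutive scales and s the current one. A bit of probability
-- 1 / 2N is a fair bit under a mask of density 1 / N: the mask avoids all supports of size at most
-- s up to another eighth, and the degree argument is applied only to the fair bits that it leaves,
-- for the forms in the window alone. The factor in front of 2⁻ᵐ is thus (7/8)² ≥ 3/4. The uniform
-- bound pays for the incomplete last scale when `n` is not a power of R. Measures are weighted
-- counts in ℕ with denominators cleared; real numbers enter through the coefficients, Yao's
-- principle and the logarithms.

open import Defs
open import Axiom.ExcludedMiddle using (ExcludedMiddle)
open import Data.Nat.Base as ℕ using (ℕ)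
open import Data.Product.Base using (∃-syntax; _×_; _,_)

-- Weighted counting on the cube, random masks, greedy absorption

module Cube (lem : ∀ {ℓ} → ExcludedMiddle ℓ) where

  open import Data.Bool.Base using (Bool; true; false; if_then_else_)
  open import Data.Fin.Base using (zero; suc)
  open import Data.Fin.Subset using (Subset; ∣_∣; _∩_; _∪_; _─_; _∈_; _⊆_)
  open import Data.Fin.Subset.Properties using (p⊆p∪q; q⊆p∪q)
  open import Data.List.Base as List using (List; []; _∷_; length; _++_)
  open import Data.List.Membership.Propositional as List using ()
  open import Data.List.Membership.Propositional.Properties using (∈-∃++; ∈-++⁻; ∈-++⁺ˡ; ∈-++⁺ʳ)
  open import Data.List.Properties using (length-++)
  open import Data.List.Relation.Unary.Any using (here; there)
  open import Data.Nat.Base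
  open import Data.Nat.Properties
  open import Data.Nat.Tactic.RingSolver using (solve-∀)
  open import Data.Product.Base using (∃-syntax; _×_; _,_)
  open import Data.Sum.Base using (_⊎_; inj₁; inj₂)
  open import Data.Vec.Base using (Vec; []; _∷_; here; there)
  open import Function.Base using (_∘_)
  open import Level using (Level)
  open import Relation.Binary.PropositionalEquality
  open import Relation.Nullary using (¬_; yes; no; does; contradiction)

  private
    variable
      ℓ ℓ′ : Level
      n : ℕ

  -- Iverson bracket by excluded middle, so that the measure of any property is a natural number.
  ⟦_⟧ : Set ℓ → ℕ
  ⟦ P ⟧ = if does (lem {P = P}) then 1 else 0

  ⟦⟧-true : {P : Set ℓ} → P → ⟦ P ⟧ ≡ 1
  ⟦⟧-true {P = P} p with lem {P = P}
  ... | yes _ = refl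
  ... | no ¬p = contradiction p ¬p

  ⟦⟧-false : {P : Set ℓ} → ¬ P → ⟦ P ⟧ ≡ 0
  ⟦⟧-false {P = P} ¬p with lem {P = P}
  ... | yes p = contradiction p ¬p
  ... | no _  = refl

  ⟦⟧-≤1 : (P : Set ℓ) → ⟦ P ⟧ ≤ 1
  ⟦⟧-≤1 P with lem {P = P}
  ... | yes _ = ≤-refl
  ... | no _  = z≤n

  ⟦⟧-≤ : {P : Set ℓ} {m : ℕ} → (P → 1 ≤ m) → ⟦ P ⟧ ≤ m
  ⟦⟧-≤ {P = P} f with lem {P = P}
  ... | yes p = f p
  ... | no _  = z≤n

  ⟦⟧-mono : {P : Set ℓ} {Q : Set ℓ′} → (P → Q) → ⟦ P ⟧ ≤ ⟦ Q ⟧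
  ⟦⟧-mono f = ⟦⟧-≤ λ p → ≤-reflexive (sym (⟦⟧-true (f p)))

  -- (suc b) ^ n times the expectation of g under independent bits, each
  -- true with probability 1 / suc b.
  𝕎 : ℕ → (Vec Bool n → ℕ) → ℕ
  𝕎 {zero}  b g = g []
  𝕎 {suc n} b g = b * 𝕎 b (g ∘ (false ∷_)) + 𝕎 b (g ∘ (true ∷_))

  𝕎-mono : ∀ b {f g : Vec Bool n → ℕ} → (∀ x → f x ≤ g x) → 𝕎 b f ≤ 𝕎 b g
  𝕎-mono {zero}  b f≤g = f≤g []
  𝕎-mono {suc n} b f≤g = +-mono-≤
    (*-monoʳ-≤ b (𝕎-mono b (f≤g ∘ (false ∷_))))
    (𝕎-mono b (f≤g ∘ (true ∷_)))

  𝕎-cong : ∀ b {f g : Vec Bool n → ℕ} → (∀ x → f x ≡ g x) → 𝕎 b f ≡ 𝕎 b g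
  𝕎-cong b f≡g = ≤-antisym (𝕎-mono b (≤-reflexive ∘ f≡g)) (𝕎-mono b (≤-reflexive ∘ sym ∘ f≡g))

  𝕎-+ : ∀ b (f g : Vec Bool n → ℕ) → 𝕎 b (λ x → f x + g x) ≡ 𝕎 b f + 𝕎 b g
  𝕎-+ {zero}  b f g = refl
  𝕎-+ {suc n} b f g
    rewrite 𝕎-+ b (f ∘ (false ∷_)) (g ∘ (false ∷_)) | 𝕎-+ b (f ∘ (true ∷_)) (g ∘ (true ∷_))
    = regroup b _ _ _ _
    where
    regroup : ∀ b p q r s → b * (p + q) + (r + s) ≡ (b * p + r) + (b * q + s)
    regroup = solve-∀

  𝕎-* : ∀ b c (g : Vec Bool n → ℕ) → 𝕎 b (λ x → c * g x) ≡ c * 𝕎 b g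
  𝕎-* {zero}  b c g = refl
  𝕎-* {suc n} b c g
    rewrite 𝕎-* b c (g ∘ (false ∷_)) | 𝕎-* b c (g ∘ (true ∷_)) = regroup b c _ _
    where
    regroup : ∀ b c p q → b * (c * p) + c * q ≡ c * (b * p + q)
    regroup = solve-∀

  𝕎-const : ∀ n b c → 𝕎 {n} b (λ _ → c) ≡ suc b ^ n * c
  𝕎-const zero    b c = sym (+-identityʳ c)
  𝕎-const (suc n) b c rewrite 𝕎-const n b c = regroup b (suc b ^ n) c
    where
    regroup : ∀ b p c → b * (p * c) + p * c ≡ (p + b * p) * c
    regroup = solve-∀

  -- A bit that is true with probability 1 / 2N is a bit that is true with
  -- probability 1 / N, masked by a fair one.
  𝕎-masked : ∀ b (g : Vec Bool n → ℕ) →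
             𝕎 (suc (b + b)) g ≡ 𝕎 b (λ S → 𝕎 1 (λ y → g (S ∩ y)))
  𝕎-masked {zero}  b g = refl
  𝕎-masked {suc n} b g
    rewrite 𝕎-+ b (λ S → 1 * 𝕎 1 (λ y → g (false ∷ S ∩ y))) (λ S → 𝕎 1 (λ y → g (false ∷ S ∩ y)))
          | 𝕎-+ b (λ S → 1 * 𝕎 1 (λ y → g (false ∷ S ∩ y))) (λ S → 𝕎 1 (λ y → g (true ∷ S ∩ y)))
          | 𝕎-* b 1 (λ S → 𝕎 1 (λ y → g (false ∷ S ∩ y)))
          | sym (𝕎-masked b (g ∘ (false ∷_))) | sym (𝕎-masked b (g ∘ (true ∷_)))
    = regroup b (𝕎 (suc (b + b)) (g ∘ (false ∷_))) (𝕎 (suc (b + b)) (g ∘ (true ∷_)))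
    where
    regroup : ∀ b p q → suc (b + b) * p + q ≡ b * (1 * p + p) + (1 * p + q)
    regroup = solve-∀

  Disjoint : Subset n → Subset n → Set
  Disjoint S V = ∀ i → i ∈ S → ¬ i ∈ V

  private
    disjoint-outside : ∀ {v} (S V : Subset n) → Disjoint S V → Disjoint (false ∷ S) (v ∷ V)
    disjoint-outside S V d (suc i) (there p) (there q) = d i p q

    disjoint-inside : (S V : Subset n) → Disjoint S V → Disjoint (true ∷ S) (false ∷ V)
    disjoint-inside S V d (suc i) (there p) (there q) = d i p q

  -- Union bound over `V`: a mask of density 1 / suc b contains a given variable with that
  -- probability, hence meets `V` with probability at most ∣ V ∣ / suc b. Everything is multiplied
  -- by suc b ^ suc n, which avoids division and subtraction.
  𝕎-disjoint : ∀ b (V : Subset n) →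
    suc b ^ suc n ≤ suc b * 𝕎 b (λ S → ⟦ Disjoint S V ⟧) + ∣ V ∣ * suc b ^ n
  𝕎-disjoint b [] = ≤-reflexive (trans
    (cong (suc b *_) (sym (⟦⟧-true {P = Disjoint [] []} λ ())))
    (sym (+-identityʳ _)))
  𝕎-disjoint {suc n} b (false ∷ V) = begin
    suc b * suc b ^ suc n                          ≤⟨ *-monoʳ-≤ (suc b) (𝕎-disjoint b V) ⟩
    suc b * (suc b * Z + ∣ V ∣ * suc b ^ n)         ≡⟨ regroup b Z ∣ V ∣ (suc b ^ n) ⟩
    suc b * (b * Z + Z) + ∣ V ∣ * suc b ^ suc n     ≤⟨ +-monoˡ-≤ _ (*-monoʳ-≤ (suc b) (+-mono-≤
      (*-monoʳ-≤ b (𝕎-mono b λ S → ⟦⟧-mono (disjoint-outside S V)))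
      (𝕎-mono b λ S → ⟦⟧-mono (disjoint-inside S V)))) ⟩
    suc b * 𝕎 b (λ S → ⟦ Disjoint S (false ∷ V) ⟧) + ∣ V ∣ * suc b ^ suc n ∎
    where
    open ≤-Reasoning
    Z : ℕ
    Z = 𝕎 b (λ S → ⟦ Disjoint S V ⟧)
    regroup : ∀ b z v p → suc b * (suc b * z + v * p) ≡ suc b * (b * z + z) + v * (suc b * p)
    regroup = solve-∀
  𝕎-disjoint {suc n} b (true ∷ V) = begin
    suc b * (suc b * p)                                       ≡⟨ split b p ⟩
    b * (suc b * p) + suc b * p                               ≤⟨ +-monoˡ-≤ _ (*-monoʳ-≤ b (𝕎-disjoint b V)) ⟩
    -- The added ∣ V ∣ * p completes b to suc b in front of ∣ V ∣. The masks containing this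
    -- variable meet the set and are dropped below.
    b * (suc b * Z + ∣ V ∣ * p) + suc b * p                    ≤⟨ m≤m+n _ (∣ V ∣ * p) ⟩
    b * (suc b * Z + ∣ V ∣ * p) + suc b * p + ∣ V ∣ * p         ≡⟨ regroup b Z ∣ V ∣ p ⟩
    suc b * (b * Z) + suc ∣ V ∣ * suc b ^ suc n                ≤⟨ +-monoˡ-≤ _ (*-monoʳ-≤ (suc b)
      (≤-trans (*-monoʳ-≤ b (𝕎-mono b λ S → ⟦⟧-mono (disjoint-outside S V))) (m≤m+n _ _))) ⟩
    suc b * 𝕎 b (λ S → ⟦ Disjoint S (true ∷ V) ⟧) + suc ∣ V ∣ * suc b ^ suc n ∎
    where
    open ≤-Reasoning
    p Z : ℕ
    p = suc b ^ n
    Z = 𝕎 b (λ S → ⟦ Disjoint S V ⟧)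
    split : ∀ b p → suc b * (suc b * p) ≡ b * (suc b * p) + suc b * p
    split = solve-∀
    regroup : ∀ b z v p → b * (suc b * z + v * p) + suc b * p + v * p ≡
                          suc b * (b * z) + suc v * (suc b * p)
    regroup = solve-∀

  ∣∪∣ : (p q : Subset n) → ∣ p ∪ q ∣ ≡ ∣ p ∣ + ∣ q ─ p ∣
  ∣∪∣ []          []          = refl
  ∣∪∣ (true ∷ p)  (true ∷ q)  = cong suc (∣∪∣ p q)
  ∣∪∣ (true ∷ p)  (false ∷ q) = cong suc (∣∪∣ p q)
  ∣∪∣ (false ∷ p) (true ∷ q)  = trans (cong suc (∣∪∣ p q)) (sym (+-suc ∣ p ∣ _))
  ∣∪∣ (false ∷ p) (false ∷ q) = ∣∪∣ p q

  ∣─∣≤ : (p q : Subset n) → ∣ p ∣ ≤ ∣ p ─ q ∣ + ∣ q ∣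
  ∣─∣≤ []          []          = z≤n
  ∣─∣≤ (true ∷ p)  (true ∷ q)  = ≤-trans (s≤s (∣─∣≤ p q)) (≤-reflexive (sym (+-suc _ ∣ q ∣)))
  ∣─∣≤ (true ∷ p)  (false ∷ q) = s≤s (∣─∣≤ p q)
  ∣─∣≤ (false ∷ p) (true ∷ q)  = ≤-trans (∣─∣≤ p q) (+-monoʳ-≤ _ (n≤1+n _))
  ∣─∣≤ (false ∷ p) (false ∷ q) = ∣─∣≤ p q

  -- Greedily absorb any set of which fewer than κ elements are still outside U.
  absorb : ∀ κ m (ss : List (Subset n)) → length ss ≡ m → (U₀ : Subset n) →
    ∃[ U ] U₀ ⊆ U × ∣ U ∣ ≤ ∣ U₀ ∣ + m * κ ×
           (∀ {s} → s List.∈ ss → s ⊆ U ⊎ κ ≤ ∣ s ─ U ∣)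
  absorb κ m ss len U₀ with lem {P = ∃[ s ] s List.∈ ss × ∣ s ─ U₀ ∣ < κ}
  ... | no none = U₀ , (λ p → p) , m≤m+n _ _ , λ s∈ → inj₂ (≮⇒≥ λ lt → none (_ , s∈ , lt))
  absorb κ zero    [] len U₀ | yes (_ , () , _)
  -- The absorbed set leaves the list, so there are at most `m` rounds, each adding fewer than `κ`
  -- elements; it stays inside since `U` only grows.
  absorb κ (suc m) ss len U₀ | yes (s , s∈ , small)
    with ys , zs , refl ← ∈-∃++ s∈
    with U , ⊆U , size , ok ← absorb κ m (ys ++ zs)
           (suc-injective (trans (sym (trans (length-++ ys) (trans (+-suc _ _) (cong suc (sym (length-++ ys)))))) len))
           (U₀ ∪ s)
    = U , (λ p → ⊆U (p⊆p∪q s p)) , size′ , ok′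
    where
    open ≤-Reasoning
    size′ : ∣ U ∣ ≤ ∣ U₀ ∣ + suc m * κ
    size′ = begin
      ∣ U ∣                          ≤⟨ size ⟩
      ∣ U₀ ∪ s ∣ + m * κ             ≡⟨ cong (_+ m * κ) (∣∪∣ U₀ s) ⟩
      ∣ U₀ ∣ + ∣ s ─ U₀ ∣ + m * κ     ≤⟨ +-monoˡ-≤ _ (+-monoʳ-≤ ∣ U₀ ∣ (<⇒≤ small)) ⟩
      ∣ U₀ ∣ + κ + m * κ             ≡⟨ +-assoc ∣ U₀ ∣ κ _ ⟩
      ∣ U₀ ∣ + suc m * κ             ∎
    ok′ : ∀ {s′} → s′ List.∈ ys ++ s ∷ zs → s′ ⊆ U ⊎ κ ≤ ∣ s′ ─ U ∣
    ok′ s′∈ with ∈-++⁻ ys s′∈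
    ... | inj₁ p           = ok (∈-++⁺ˡ p)
    ... | inj₂ (here refl) = inj₁ (λ p → ⊆U (q⊆p∪q U₀ s p))
    ... | inj₂ (there p)   = ok (∈-++⁺ʳ ys p)

-- Ordered-field arithmetic and the Archimedean property

module Field (lem : ∀ {ℓ} → ExcludedMiddle ℓ) (ℝ : CompleteOrderedField) where

  open CompleteOrderedField ℝ
  open import Algebra.Properties.Ring ring public
    using (-0#≈0#; -‿+-comm; -‿involutive; -1*x≈-x; +-cancelʳ; +-cancelˡ)
  open import Algebra.Properties.Semiring.Mult semiring public using (×-homo-+; ×1-homo-*)
  open import Algebra.Properties.CommutativeSemiring.Exp commutativeSemiring public
    using (^-homo-*; ^-assocʳ; ^-congˡ; ^-congʳ; ^-distrib-*)
  open import Data.Nat.Base as ℕ using (ℕ; zero; suc)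
  import Data.Nat.Properties as ℕ
  open import Data.Product.Base using (∃-syntax; _,_; proj₁; proj₂)
  open import Data.Sum.Base using (inj₁; inj₂)
  open import Relation.Binary.Bundles using (TotalOrder)
  import Relation.Binary.Construct.NonStrictToStrict _≈_ _≤_ as Strict
  open import Relation.Binary.Structures using (IsTotalOrder)
  open import Relation.Nullary using (¬_; yes; no; contradiction)

  open IsTotalOrder isTotalOrder public
    using (antisym; total; ≤-respˡ-≈; ≤-respʳ-≈)
    renaming (refl to ≤-refl; reflexive to ≤-reflexive; trans to ≤-trans)

  totalOrder : TotalOrder _ _ _
  totalOrder = record { isTotalOrder = isTotalOrder }

  module ≤-Reasoning where
    open import Relation.Binary.Reasoning.PartialOrder (TotalOrder.poset totalOrder) public

  <⇒≱ : ∀ {x y} → x < y → ¬ y ≤ x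
  <⇒≱ = Strict.<⇒≱ antisym

  ≰⇒> : ∀ {x y} → ¬ x ≤ y → y < x
  ≰⇒> = Strict.≰⇒> sym ≤-reflexive total

  ≮⇒≥ : ∀ {x y} → ¬ x < y → y ≤ x
  ≮⇒≥ {x} {y} ¬x<y with lem {P = y ≤ x}
  ... | yes y≤x = y≤x
  ... | no y≰x  = contradiction (≰⇒> y≰x) ¬x<y

  <-≤-trans : ∀ {x y z} → x < y → y ≤ z → x < z
  <-≤-trans x<y y≤z = ≰⇒> λ z≤x → <⇒≱ x<y (≤-trans y≤z z≤x)

  ≤-<-trans : ∀ {x y z} → x ≤ y → y < z → x < z
  ≤-<-trans x≤y y<z = ≰⇒> λ z≤x → <⇒≱ y<z (≤-trans z≤x x≤y)

  +-monoˡ-≤ : ∀ z {x y} → x ≤ y → x + z ≤ y + z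
  +-monoˡ-≤ z x≤y = ≤-respˡ-≈ (+-comm z _) (≤-respʳ-≈ (+-comm z _) (+-monoʳ-≤ z x≤y))

  +-mono-≤ : ∀ {x y u v} → x ≤ y → u ≤ v → x + u ≤ y + v
  +-mono-≤ x≤y u≤v = ≤-trans (+-monoˡ-≤ _ x≤y) (+-monoʳ-≤ _ u≤v)

  +-cancelʳ-≤ : ∀ z {x y} → x + z ≤ y + z → x ≤ y
  +-cancelʳ-≤ z {x} {y} p = ≤-respˡ-≈ (undo x) (≤-respʳ-≈ (undo y) (+-monoˡ-≤ (- z) p))
    where
    undo : ∀ w → (w + z) + - z ≈ w
    undo w = trans (+-assoc w z _) (trans (+-congˡ (-‿inverseʳ z)) (+-identityʳ w))

  +-monoˡ-< : ∀ z {x y} → x < y → x + z < y + z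
  +-monoˡ-< z x<y = ≰⇒> λ p → <⇒≱ x<y (+-cancelʳ-≤ z p)

  +-monoʳ-< : ∀ z {x y} → x < y → z + x < z + y
  +-monoʳ-< z x<y = ≰⇒> λ p → <⇒≱ x<y (+-cancelʳ-≤ z (≤-respˡ-≈ (+-comm z _) (≤-respʳ-≈ (+-comm z _) p)))

  x≤x+y : ∀ x {y} → 0# ≤ y → x ≤ x + y
  x≤x+y x 0≤y = ≤-respˡ-≈ (+-identityʳ x) (+-monoʳ-≤ x 0≤y)

  x<x+y : ∀ x {y} → 0# < y → x < x + y
  x<x+y x 0<y = ≤-<-trans (≤-reflexive (sym (+-identityʳ x))) (+-monoʳ-< x 0<y)

  restore : ∀ x y → (x - y) + y ≈ x
  restore x y = trans (+-assoc x _ y) (trans (+-congˡ (-‿inverseˡ y)) (+-identityʳ x))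

  0≤y-x : ∀ {x y} → x ≤ y → 0# ≤ y - x
  0≤y-x {x} x≤y = ≤-respˡ-≈ (-‿inverseʳ x) (+-monoˡ-≤ (- x) x≤y)

  *-monoʳ-≤ : ∀ {x} → 0# ≤ x → ∀ {y z} → y ≤ z → x * y ≤ x * z
  *-monoʳ-≤ {x} 0≤x {y} {z} y≤z = ≤-respʳ-≈ eq (x≤x+y (x * y) (*-nonNeg 0≤x (0≤y-x y≤z)))
    where
    eq : x * y + x * (z - y) ≈ x * z
    eq = trans (sym (distribˡ x y _)) (*-congˡ (trans (+-comm y _) (restore z y)))

  *-monoˡ-≤ : ∀ {x} → 0# ≤ x → ∀ {y z} → y ≤ z → y * x ≤ z * x
  *-monoˡ-≤ 0≤x y≤z = ≤-respˡ-≈ (*-comm _ _) (≤-respʳ-≈ (*-comm _ _) (*-monoʳ-≤ 0≤x y≤z))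

  *-mono-≤ : ∀ {x y u v} → 0# ≤ y → 0# ≤ u → x ≤ y → u ≤ v → x * u ≤ y * v
  *-mono-≤ 0≤y 0≤u x≤y u≤v = ≤-trans (*-monoˡ-≤ 0≤u x≤y) (*-monoʳ-≤ 0≤y u≤v)

  0≤1 : 0# ≤ 1#
  0≤1 with total 0# 1#
  ... | inj₁ p = p
  ... | inj₂ p = ≤-respʳ-≈ (trans (-1*x≈-x _) (-‿involutive 1#)) (*-nonNeg 0≤-1 0≤-1)
    where
    0≤-1 : 0# ≤ - 1#
    0≤-1 = ≤-respʳ-≈ (+-identityˡ _) (0≤y-x p)

  0<1 : 0# < 1#
  0<1 = 0≤1 , 0≉1

  fromℕ-+ : ∀ a b → fromℕ (a ℕ.+ b) ≈ fromℕ a + fromℕ b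
  fromℕ-+ = ×-homo-+ 1#

  fromℕ-* : ∀ a b → fromℕ (a ℕ.* b) ≈ fromℕ a * fromℕ b
  fromℕ-* = ×1-homo-*

  fromℕ-1 : fromℕ 1 ≈ 1#
  fromℕ-1 = +-identityʳ 1#

  fromℕ-^ : ∀ a k → fromℕ (a ℕ.^ k) ≈ fromℕ a ^ k
  fromℕ-^ a zero    = fromℕ-1
  fromℕ-^ a (suc k) = trans (fromℕ-* a (a ℕ.^ k)) (*-congˡ (fromℕ-^ a k))

  0≤fromℕ : ∀ k → 0# ≤ fromℕ k
  0≤fromℕ zero    = ≤-refl
  0≤fromℕ (suc k) = ≤-trans 0≤1 (x≤x+y 1# (0≤fromℕ k))

  fromℕ-mono-≤ : ∀ {a b} → a ℕ.≤ b → fromℕ a ≤ fromℕ b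
  fromℕ-mono-≤ {b = b} ℕ.z≤n = 0≤fromℕ b
  fromℕ-mono-≤ (ℕ.s≤s a≤b) = +-monoʳ-≤ 1# (fromℕ-mono-≤ a≤b)

  fromℕ-mono-< : ∀ {a b} → a ℕ.< b → fromℕ a < fromℕ b
  fromℕ-mono-< {a} a<b = <-≤-trans
    (<-≤-trans (x<x+y (fromℕ a) 0<1) (≤-reflexive (+-comm _ 1#)))
    (fromℕ-mono-≤ a<b)

  fromℕ-cancel-≤ : ∀ {a b} → fromℕ a ≤ fromℕ b → a ℕ.≤ b
  fromℕ-cancel-≤ p = ℕ.≮⇒≥ λ b<a → <⇒≱ (fromℕ-mono-< b<a) p

  0<fromℕ : ∀ {k} → 0 ℕ.< k → 0# < fromℕ k
  0<fromℕ = fromℕ-mono-<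

  <⇒≉0 : ∀ {x} → 0# < x → ¬ x ≈ 0#
  <⇒≉0 (_ , 0≉x) x≈0 = 0≉x (sym x≈0)

  0<x⁻¹ : ∀ {x} → 0# < x → 0# < x ⁻¹
  0<x⁻¹ {x} 0<x = ≰⇒> λ p → <⇒≱ 0<1
    (≤-respˡ-≈ (*-inverse x (<⇒≉0 0<x)) (≤-respʳ-≈ (zeroʳ x) (*-monoʳ-≤ (proj₁ 0<x) p)))

  x⁻¹*[x*y] : ∀ {x} → ¬ x ≈ 0# → ∀ y → x ⁻¹ * (x * y) ≈ y
  x⁻¹*[x*y] {x} x≉0 y = trans (sym (*-assoc _ x y))
    (trans (*-congʳ (trans (*-comm _ x) (*-inverse x x≉0))) (*-identityˡ y))

  *-cancelˡ-≤ : ∀ {x} → 0# < x → ∀ {y z} → x * y ≤ x * z → y ≤ z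
  *-cancelˡ-≤ 0<x p = ≤-respˡ-≈ (x⁻¹*[x*y] (<⇒≉0 0<x) _) (≤-respʳ-≈ (x⁻¹*[x*y] (<⇒≉0 0<x) _)
    (*-monoʳ-≤ (proj₁ (0<x⁻¹ 0<x)) p))

  x*y≉0 : ∀ {x y} → ¬ x ≈ 0# → ¬ y ≈ 0# → ¬ x * y ≈ 0#
  x*y≉0 x≉0 y≉0 xy≈0 = y≉0 (trans (sym (x⁻¹*[x*y] x≉0 _)) (trans (*-congˡ xy≈0) (zeroʳ _)))

  0<x*y : ∀ {x y} → 0# < x → 0# < y → 0# < x * y
  0<x*y 0<x 0<y = *-nonNeg (proj₁ 0<x) (proj₁ 0<y) ,
    λ e → x*y≉0 (<⇒≉0 0<x) (<⇒≉0 0<y) (sym e)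

  0<x^n : ∀ {x} → 0# < x → ∀ n → 0# < x ^ n
  0<x^n 0<x zero    = 0<1
  0<x^n 0<x (suc n) = 0<x*y 0<x (0<x^n 0<x n)

  ^-mono-≤ : ∀ {x y} → 0# ≤ x → x ≤ y → ∀ n → x ^ n ≤ y ^ n
  ^-mono-≤ 0≤x x≤y zero    = ≤-refl
  ^-mono-≤ 0≤x x≤y (suc n) =
    *-mono-≤ (≤-trans 0≤x x≤y) (0≤x^n n) x≤y (^-mono-≤ 0≤x x≤y n)
    where
    0≤x^n : ∀ n → 0# ≤ _ ^ n
    0≤x^n zero    = 0≤1
    0≤x^n (suc n) = *-nonNeg 0≤x (0≤x^n n)

  x/y*y : ∀ x {y} → ¬ y ≈ 0# → x / y * y ≈ x
  x/y*y x {y} y≉0 = trans (*-assoc x _ y)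
    (trans (*-congˡ (trans (*-comm _ y) (*-inverse y y≉0))) (*-identityʳ x))

  /-≤ : ∀ {x y z} → 0# < y → x ≤ z * y → x / y ≤ z
  /-≤ {x} {y} {z} 0<y p = *-cancelˡ-≤ 0<y (≤-respˡ-≈ (trans (sym (x/y*y x (<⇒≉0 0<y))) (*-comm _ y))
    (≤-respʳ-≈ (*-comm z y) p))

  ≤-/ : ∀ {x y z} → 0# < y → z * y ≤ x → z ≤ x / y
  ≤-/ {x} {y} {z} 0<y p = *-cancelˡ-≤ 0<y (≤-respʳ-≈ (trans (sym (x/y*y x (<⇒≉0 0<y))) (*-comm _ y))
    (≤-respˡ-≈ (*-comm z y) p))

  -- Otherwise the naturals have a supremum s; as k + 1 ≤ s for every k, already s - 1 is an upper
  -- bound.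
  archimedean : ∀ x → ∃[ k ] x < fromℕ k
  archimedean x with lem {P = ∃[ k ] x < fromℕ k}
  ... | yes found = found
  ... | no none   = contradiction (lub lower) (<⇒≱ (<-≤-trans (x<x+y _ 0<1) (≤-reflexive (restore s 1#))))
    where
    naturals : Carrier → Set
    naturals y = ∃[ k ] y ≈ fromℕ k
    supremum : ∃[ s ] IsSup naturals s
    supremum = complete naturals (_ , 0 , refl)
      (x , λ { (k , y≈k) → ≤-respˡ-≈ (sym y≈k) (≮⇒≥ λ x<k → none (k , x<k)) })
    s : Carrier
    s = supremum .proj₁
    lower : UpperBound naturals (s - 1#)
    lower (k , y≈k) = ≤-respˡ-≈ (sym y≈k) (+-cancelʳ-≤ 1#
      (≤-respʳ-≈ (sym (restore s 1#)) (supremum .proj₂ .proj₁ (suc k , +-comm _ 1#))))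
    lub : UpperBound naturals (s - 1#) → s ≤ s - 1#
    lub = supremum .proj₂ .proj₂

-- Anti-concentration of linear forms under biased bits

module Hits (lem : ∀ {ℓ} → ExcludedMiddle ℓ) (ℝ : CompleteOrderedField) where

  module ℝ = CompleteOrderedField ℝ
  open ℝ using (Carrier; 0#; 1#; _≈_)
  open Polynomials ℝ using (LinearForm)
  open Cube lem
  private module F = Field lem ℝ

  open import Data.Bool.Base using (Bool; true; false; _∧_)
  open import Data.Fin.Base using (zero; suc)
  open import Data.Fin.Subset using (Subset; ∣_∣; _∩_; _─_; _⊆_)
  open import Data.Fin.Subset.Properties using (drop-∷-⊆)
  open import Data.List.Base as List using (List; []; _∷_; [_]; length; map)
  open import Data.List.Properties using (length-map)
  open import Data.List.Relation.Unary.All as All using (All; []; _∷_)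
  import Data.List.Relation.Unary.All.Properties as All
  open import Data.List.Relation.Unary.AllPairs as AllPairs using (AllPairs; []; _∷_)
  import Data.List.Relation.Unary.AllPairs.Properties as AllPairs
  open import Data.Nat.Base
  open import Data.Nat.Properties
  open import Data.Nat.Tactic.RingSolver using (solve-∀)
  open import Data.Product.Base using (∃-syntax; _×_; _,_; proj₁)
  open import Data.Sum.Base using (inj₁; inj₂)
  open import Data.Vec.Base using (Vec; []; _∷_; replicate; here; there)
  open import Data.Vec.Functional using (head; tail)
  open import Function.Base using (_∘_)
  open import Relation.Binary.PropositionalEquality hiding ([_])
  open import Relation.Nullary using (¬_; yes; no; does; contradiction)

  private
    variable
      n : ℕ

  apply : LinearForm n → Vec Bool n → Carrier
  apply a []          = 0#
  apply a (false ∷ x) = apply (tail a) x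
  apply a (true ∷ x)  = head a ℝ.+ apply (tail a) x

  support : LinearForm n → Subset n
  support {zero}  a = []
  support {suc n} a = does (lem {P = ¬ head a ≈ 0#}) ∷ support (tail a)

  apply-∩ : (a : LinearForm n) (U : Subset n) → support a ⊆ U → ∀ x →
            apply a (x ∩ U) ≈ apply a x
  apply-∩ a []      ⊆U [] = ℝ.refl
  apply-∩ a (u ∷ U) ⊆U (false ∷ x) = apply-∩ (tail a) U (drop-∷-⊆ ⊆U) x
  apply-∩ a (true ∷ U)  ⊆U (true ∷ x) = ℝ.+-congˡ (apply-∩ (tail a) U (drop-∷-⊆ ⊆U) x)
  apply-∩ a (false ∷ U) ⊆U (true ∷ x) with lem {P = ¬ head a ≈ 0#}
  ... | yes _ with () ← ⊆U here
  ... | no ¬a≉0 with lem {P = head a ≈ 0#}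
  ...   | yes a≈0 = ℝ.trans (apply-∩ (tail a) U (drop-∷-⊆ ⊆U) x)
                      (ℝ.sym (ℝ.trans (ℝ.+-congʳ a≈0) (ℝ.+-identityˡ _)))
  ...   | no a≉0  = contradiction a≉0 ¬a≉0

  apply-disjoint : (a : LinearForm n) (S : Subset n) → Disjoint S (support a) → ∀ x →
                   apply a (S ∩ x) ≈ 0#
  apply-disjoint a [] d [] = ℝ.refl
  apply-disjoint a (false ∷ S) d (b ∷ x) =
    apply-disjoint (tail a) S (λ i p q → d (suc i) (there p) (there q)) x
  apply-disjoint a (true ∷ S) d (false ∷ x) =
    apply-disjoint (tail a) S (λ i p q → d (suc i) (there p) (there q)) x
  apply-disjoint a (true ∷ S) d (true ∷ x) with lem {P = ¬ head a ≈ 0#}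
  ... | yes _ = contradiction here (d zero here)
  ... | no ¬a≉0 with lem {P = head a ≈ 0#}
  ...   | yes a≈0 = ℝ.trans (ℝ.+-cong a≈0
                      (apply-disjoint (tail a) S (λ i p q → d (suc i) (there p) (there q)) x))
                      (ℝ.+-identityˡ _)
  ...   | no a≉0  = contradiction a≉0 ¬a≉0

  apply-zero : ∀ n (a : LinearForm n) → apply a (replicate n false) ≈ 0#
  apply-zero zero    a = ℝ.refl
  apply-zero (suc n) a = apply-zero n (tail a)

  shift : Carrier → List Carrier → List Carrier
  shift d = map (λ c → c ℝ.- d)

  zeros : List Carrier → ℕ
  zeros []      = 0
  zeros (c ∷ C) = ⟦ c ≈ 0# ⟧ + zeros C

  -- The number of c in C with apply a x ≈ c.
  hits : LinearForm n → List Carrier → Vec Bool n → ℕ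
  hits a C []          = zeros C
  hits a C (false ∷ x) = hits (tail a) C x
  hits a C (true ∷ x)  = hits (tail a) (shift (head a) C) x

  hits-[] : (a : LinearForm n) → ∀ x → hits a [] x ≡ 0
  hits-[] a []          = refl
  hits-[] a (false ∷ x) = hits-[] (tail a) x
  hits-[] a (true ∷ x)  = hits-[] (tail a) x

  hits-∷ : (a : LinearForm n) → ∀ c C x → hits a (c ∷ C) x ≡ hits a [ c ] x + hits a C x
  hits-∷ a c C []          = cong (_+ zeros C) (sym (+-identityʳ ⟦ c ≈ 0# ⟧))
  hits-∷ a c C (false ∷ x) = hits-∷ (tail a) c C x
  hits-∷ a c C (true ∷ x)  = hits-∷ (tail a) _ (shift (head a) C) x

  1≤hits : (a : LinearForm n) → ∀ c x → apply a x ≈ c → 1 ≤ hits a [ c ] x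
  1≤hits a c [] 0≈c = ≤-reflexive (sym (trans (+-identityʳ _) (⟦⟧-true (ℝ.sym 0≈c))))
  1≤hits a c (false ∷ x) e = 1≤hits (tail a) c x e
  1≤hits a c (true ∷ x)  e = 1≤hits (tail a) _ x (F.+-cancelʳ (head a) _ _
    (ℝ.trans (ℝ.+-comm _ _) (ℝ.trans e (ℝ.sym (F.restore c (head a))))))

  -- Sorted lists represent finite sets of reals: sortedness gives distinctness, and the least
  -- element is at hand for `rebalance`.
  Increasing : List Carrier → Set
  Increasing = AllPairs ℝ._<_

  shift-increasing : ∀ d {C} → Increasing C → Increasing (shift d C)
  shift-increasing d inc = AllPairs.map⁺ (AllPairs.map (F.+-monoˡ-< (ℝ.- d)) inc)

  zeros≤1 : ∀ C → Increasing C → zeros C ≤ 1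
  zeros≤1 []      []          = z≤n
  zeros≤1 (c ∷ C) (c<C ∷ inc) with lem {P = c ≈ 0#}
  ... | no _    = zeros≤1 C inc
  ... | yes c≈0 = s≤s (≤-reflexive (none C c<C))
    where
    none : ∀ C → All (c ℝ.<_) C → zeros C ≡ 0
    none []       []                   = refl
    none (c′ ∷ C) ((_ , c≉c′) ∷ c<C) =
      cong₂ _+_ (⟦⟧-false λ c′≈0 → c≉c′ (ℝ.trans c≈0 (ℝ.sym c′≈0))) (none C c<C)

  hits≤1 : (a : LinearForm n) → ∀ C → Increasing C → ∀ x → hits a C x ≤ 1
  hits≤1 a C inc []          = zeros≤1 C inc
  hits≤1 a C inc (false ∷ x) = hits≤1 (tail a) C inc x
  hits≤1 a C inc (true ∷ x)  = hits≤1 (tail a) _ (shift-increasing (head a) inc) x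

  -- Kleitman's step: a set of r reals and its translate by a nonzero amount have
  -- the same hits as sets of r + 1 and r - 1 reals.
  rebalance : ∀ (d : Carrier) → ¬ d ≈ 0# → ∀ c C → Increasing (c ∷ C) →
    ∃[ C⁺ ] ∃[ C⁻ ] length C⁺ ≡ 2 + length C × Increasing C⁺ ×
                    length C⁻ ≡ length C × Increasing C⁻ ×
    (∀ {n} (a : LinearForm n) x →
      hits a (c ∷ C) x + hits a (shift d (c ∷ C)) x ≡ hits a C⁺ x + hits a C⁻ x)
  rebalance d d≉0 c C inc@(c<C ∷ incC) with F.total 0# d
  -- For positive `d` the least element c - d of the translate lies below all of c ∷ C, so it can
  -- move there.
  ... | inj₁ 0≤d =
    (c ℝ.- d) ∷ c ∷ C , shift d C , refl ,
    (c-d<c ∷ All.map (λ c<c′ → F.<-≤-trans c-d<c (proj₁ c<c′)) c<C) ∷ inc ,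
    length-map _ C , shift-increasing d incC ,
    λ a x → trans (cong (hits a (c ∷ C) x +_) (hits-∷ a _ (shift d C) x))
      (trans (regroup (hits a (c ∷ C) x) (hits a [ c ℝ.- d ] x) (hits a (shift d C) x)) (cong (_+ _) (sym (hits-∷ a _ (c ∷ C) x))))
    where
    c-d<c : c ℝ.- d ℝ.< c
    c-d<c = F.<-≤-trans (F.x<x+y _ (0≤d , d≉0 ∘ ℝ.sym)) (F.≤-reflexive (F.restore c d))
    regroup : ∀ p q r → p + (q + r) ≡ (q + p) + r
    regroup = solve-∀
  -- For negative `d` it is `c` that lies below the whole translate, so it moves in the opposite
  -- direction.
  ... | inj₂ d≤0 =
    c ∷ shift d (c ∷ C) , C , cong (2 +_) (length-map _ C) ,
    (c<c-d ∷ All.map⁺ (All.map (λ c<c′ → F.<-≤-trans c<c-d (proj₁ (F.+-monoˡ-< (ℝ.- d) c<c′))) c<C))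
      ∷ shift-increasing d inc ,
    refl , incC ,
    λ a x → trans (cong (_+ hits a (shift d (c ∷ C)) x) (hits-∷ a c C x))
      (trans (regroup (hits a [ c ] x) _ _) (cong (_+ _) (sym (hits-∷ a c (shift d (c ∷ C)) x))))
    where
    c<c-d : c ℝ.< c ℝ.- d
    c<c-d = F.≤-<-trans (F.≤-reflexive (ℝ.sym (F.restore c d)))
      (F.<-≤-trans (F.+-monoʳ-< (c ℝ.- d) (d≤0 , d≉0)) (F.≤-reflexive (ℝ.+-identityʳ _)))
    regroup : ∀ p q r → p + q + r ≡ p + r + q
    regroup = solve-∀

  -- `E` reads only the bits in `U`, so weighting by it leaves the bits outside `U` independent and
  -- biased as before.
  Invariant : Subset n → (Vec Bool n → ℕ) → Set
  Invariant U E = ∀ x y → x ∩ U ≡ y ∩ U → E x ≡ E y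

  invariant-tail : ∀ {u} {U : Subset n} {E} → Invariant (u ∷ U) E → ∀ b → Invariant U (E ∘ (b ∷_))
  invariant-tail {u = u} inv b x y e = inv (b ∷ x) (b ∷ y) (cong ((b ∧ u) ∷_) e)

  -- Each coordinate outside U with a nonzero coefficient turns C into C⁺ or C⁻:
  -- its length does a lazy random walk, absorbed at 0, with r * s as the potential.
  hits-bound : ∀ b M (a : LinearForm n) (U : Subset n) E → Invariant U E →
    ∀ C r s → length C ≡ r → Increasing C → r + s ≡ M →
    let κ = ∣ support a ─ U ∣ in
    2 * κ * M * 𝕎 (suc b) (λ x → E x * hits a C x) ≤
    (2 * κ * r + (2 + b) * M * (r * s)) * 𝕎 (suc b) E
  private
    avg : ∀ b k q x₀ x₁ y₀ y₁ → k * x₀ ≤ q * y₀ → k * x₁ ≤ q * y₁ →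
          k * (b * x₀ + x₁) ≤ q * (b * y₀ + y₁)
    avg b k q x₀ x₁ y₀ y₁ h₀ h₁ = begin
      k * (b * x₀ + x₁)         ≡⟨ regroup b k x₀ x₁ ⟩
      b * (k * x₀) + k * x₁     ≤⟨ +-mono-≤ (*-monoʳ-≤ b h₀) h₁ ⟩
      b * (q * y₀) + q * y₁     ≡⟨ regroup b q y₀ y₁ ⟨
      q * (b * y₀ + y₁)         ∎
      where
      open ≤-Reasoning
      regroup : ∀ b k p q → k * (b * p + q) ≡ b * (k * p) + k * q
      regroup = solve-∀

    -- For a coordinate that does not count in κ, being in `U` or having coefficient 0: the bound
    -- holds on both facets with the same constants and is averaged.
    hits-bound-fixed : ∀ b M {u} (a : LinearForm (suc n)) (U : Subset n) E → Invariant (u ∷ U) E →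
      ∀ C r s → length C ≡ r → Increasing C → r + s ≡ M →
      let κ = ∣ support (tail a) ─ U ∣ in
      2 * κ * M * 𝕎 (suc b) (λ x → E x * hits a C x) ≤
      (2 * κ * r + (2 + b) * M * (r * s)) * 𝕎 (suc b) E
    hits-bound-fixed b M a U E inv C r s len inc r+s = avg (suc b)
      (2 * ∣ support (tail a) ─ U ∣ * M) (2 * ∣ support (tail a) ─ U ∣ * r + (2 + b) * M * (r * s))
      (𝕎 (suc b) λ x → E (false ∷ x) * hits (tail a) C x)
      (𝕎 (suc b) λ x → E (true ∷ x) * hits (tail a) (shift (head a) C) x)
      (𝕎 (suc b) (E ∘ (false ∷_))) (𝕎 (suc b) (E ∘ (true ∷_)))
      (hits-bound b M (tail a) U _ (invariant-tail inv false) C r s len inc r+s)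
      (hits-bound b M (tail a) U _ (invariant-tail inv true) (shift (head a) C) r s
        (trans (length-map _ C) len) (shift-increasing (head a) inc) r+s)

    𝕎-hits≤ : ∀ b (a : LinearForm n) E C → Increasing C → 𝕎 b (λ x → E x * hits a C x) ≤ 𝕎 b E
    𝕎-hits≤ b a E C inc = 𝕎-mono b λ x →
      ≤-trans (*-monoʳ-≤ (E x) (hits≤1 a C inc x)) (≤-reflexive (*-identityʳ (E x)))

    -- One lazy step: weight b to stay, weight 1 each for up and down. The two neighbours of the
    -- potential sum to 2 less than twice its value, which times (2 + b) M Y is exactly what the
    -- additional free coordinate adds on the left once X, X⁺, X⁻ ≤ Y are used.
    walk : ∀ b k M r s X X⁺ X⁻ Y → X ≤ Y → X⁺ ≤ Y → X⁻ ≤ Y →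
      2 * k * M * X  ≤ (2 * k * suc r + (2 + b) * M * (suc r * suc s)) * Y →
      2 * k * M * X⁺ ≤ (2 * k * (2 + r) + (2 + b) * M * ((2 + r) * s)) * Y →
      2 * k * M * X⁻ ≤ (2 * k * r + (2 + b) * M * (r * (2 + s))) * Y →
      2 * suc k * M * (b * X + (X⁺ + X⁻)) ≤
      (2 * suc k * suc r + (2 + b) * M * (suc r * suc s)) * ((2 + b) * Y)
    walk b k M r s X X⁺ X⁻ Y h h⁺ h⁻ i i⁺ i⁻ = begin
      2 * suc k * M * (b * X + (X⁺ + X⁻))
        ≡⟨ split b k M X X⁺ X⁻ ⟩
      (b * (2 * k * M * X) + (2 * k * M * X⁺ + 2 * k * M * X⁻)) + 2 * M * (b * X + (X⁺ + X⁻))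
        ≤⟨ +-mono-≤ (+-mono-≤ (*-monoʳ-≤ b i) (+-mono-≤ i⁺ i⁻))
             (*-monoʳ-≤ (2 * M) (+-mono-≤ (*-monoʳ-≤ b h) (+-mono-≤ h⁺ h⁻))) ⟩
      _
        ≡⟨ collect b k M r s Y ⟩
      (2 * k * suc r + (2 + b) * M * (suc r * suc s)) * ((2 + b) * Y)
        ≤⟨ *-monoˡ-≤ ((2 + b) * Y) (+-monoˡ-≤ _ (*-monoˡ-≤ (suc r) (*-monoʳ-≤ 2 (n≤1+n k)))) ⟩
      (2 * suc k * suc r + (2 + b) * M * (suc r * suc s)) * ((2 + b) * Y) ∎
      where
      open ≤-Reasoning
      split : ∀ b k M X P Q → 2 * suc k * M * (b * X + (P + Q)) ≡
        (b * (2 * k * M * X) + (2 * k * M * P + 2 * k * M * Q)) + 2 * M * (b * X + (P + Q))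
      split = solve-∀
      collect : ∀ b k M r s Y →
        (b * ((2 * k * suc r + (2 + b) * M * (suc r * suc s)) * Y) +
          ((2 * k * (2 + r) + (2 + b) * M * ((2 + r) * s)) * Y +
           (2 * k * r + (2 + b) * M * (r * (2 + s))) * Y)) + 2 * M * (b * Y + (Y + Y)) ≡
        (2 * k * suc r + (2 + b) * M * (suc r * suc s)) * ((2 + b) * Y)
      collect = solve-∀

    hits-bound-free : ∀ b M (a : LinearForm (suc n)) (U : Subset n) E → Invariant (false ∷ U) E →
      ¬ head a ≈ 0# → ∀ C r s → length C ≡ r → Increasing C → r + s ≡ M →
      let κ = suc ∣ support (tail a) ─ U ∣ in
      2 * κ * M * 𝕎 (suc b) (λ x → E x * hits a C x) ≤
      (2 * κ * r + (2 + b) * M * (r * s)) * 𝕎 (suc b) E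
    hits-bound-free {n} b M a U E inv a≉0 [] zero s len inc r+s = begin
      k * 𝕎 (suc b) (λ x → E x * hits a [] x)
        ≡⟨ cong (k *_) (𝕎-cong (suc b) λ x → trans (cong (E x *_) (hits-[] a x)) (*-zeroʳ (E x))) ⟩
      k * 𝕎 {suc n} (suc b) (λ _ → 0)
        ≡⟨ cong (k *_) (trans (𝕎-const (suc n) (suc b) 0) (*-zeroʳ (suc (suc b) ^ suc n))) ⟩
      k * 0 ≡⟨ *-zeroʳ k ⟩
      0     ≤⟨ z≤n ⟩
      _     ∎
      where
      open ≤-Reasoning
      k : ℕ
      k = 2 * suc ∣ support (tail a) ─ U ∣ * M
    -- At r = M the first term alone is the trivial bound: the elements of `C` are distinct, so at
    -- most one is hit.
    hits-bound-free b M a U E inv a≉0 C (suc r) zero len inc refl = *-mono-≤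
      (≤-trans (≤-reflexive (cong (2 * suc ∣ support (tail a) ─ U ∣ *_) (+-identityʳ (suc r)))) (m≤m+n _ _))
      (𝕎-hits≤ (suc b) a E C inc)
    hits-bound-free b M a U E inv a≉0 (c ∷ C) (suc r) (suc s) len inc r+s
      with C⁺ , C⁻ , len⁺ , inc⁺ , len⁻ , inc⁻ , same ← rebalance (head a) a≉0 c C inc = begin
      2 * suc k * M * (suc b * X (c ∷ C) + 𝕎 (suc b) (λ x → E (true ∷ x) * hits a′ (shift (head a) (c ∷ C)) x))
        ≡⟨ cong (λ z → 2 * suc k * M * (suc b * X (c ∷ C) + z)) (𝕎-cong (suc b) λ x → cong (_* hits a′ (shift (head a) (c ∷ C)) x) (E-same x)) ⟩
      2 * suc k * M * (suc b * X (c ∷ C) + X (shift (head a) (c ∷ C)))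
        ≡⟨ cong (2 * suc k * M *_) (regroup b (X (c ∷ C)) _) ⟩
      -- One of the suc b units of the `false` facet is paired with the `true` facet, where `E` is
      -- the same because the coordinate is outside `U`. The pair is then rebalanced.
      2 * suc k * M * (b * X (c ∷ C) + (X (c ∷ C) + X (shift (head a) (c ∷ C))))
        ≡⟨ cong (λ z → 2 * suc k * M * (b * X (c ∷ C) + z)) X-same ⟩
      2 * suc k * M * (b * X (c ∷ C) + (X C⁺ + X C⁻))
        ≤⟨ walk b k M r s _ _ _ Y (𝕎-hits≤ (suc b) a′ E′ _ inc) (𝕎-hits≤ (suc b) a′ E′ _ inc⁺)
             (𝕎-hits≤ (suc b) a′ E′ _ inc⁻)
             (hits-bound b M a′ U E′ inv′ _ (suc r) (suc s) len inc r+s)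
             (hits-bound b M a′ U E′ inv′ _ (2 + r) s (trans len⁺ (cong suc len)) inc⁺
               (trans (cong suc (sym (+-suc r s))) r+s))
             (hits-bound b M a′ U E′ inv′ _ r (2 + s) (trans len⁻ (suc-injective len)) inc⁻
               (trans (+-suc r (suc s)) r+s)) ⟩
      Q * ((2 + b) * Y)
        ≡⟨ cong (Q *_) (trans (+-comm Y _) (cong (suc b * Y +_) (𝕎-cong (suc b) λ x → sym (E-same x)))) ⟩
      Q * 𝕎 (suc b) E ∎
      where
      open ≤-Reasoning
      a′ : LinearForm _
      a′ = tail a
      E′ : Vec Bool _ → ℕ
      E′ = E ∘ (false ∷_)
      inv′ : Invariant U E′
      inv′ = invariant-tail inv false
      E-same : ∀ x → E (true ∷ x) ≡ E (false ∷ x)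
      E-same x = inv (true ∷ x) (false ∷ x) refl
      k Y Q : ℕ
      k = ∣ support a′ ─ U ∣
      Y = 𝕎 (suc b) E′
      Q = 2 * suc k * suc r + (2 + b) * M * (suc r * suc s)
      X : List Carrier → ℕ
      X C = 𝕎 (suc b) (λ x → E′ x * hits a′ C x)
      X-same : X (c ∷ C) + X (shift (head a) (c ∷ C)) ≡ X C⁺ + X C⁻
      X-same = trans (sym (X-+ (c ∷ C) _)) (trans
        (𝕎-cong (suc b) λ x → cong (E′ x *_) (same a′ x)) (X-+ C⁺ C⁻))
        where
        X-+ : ∀ C D → 𝕎 (suc b) (λ x → E′ x * (hits a′ C x + hits a′ D x)) ≡ X C + X D
        X-+ C D = trans
          (𝕎-cong (suc b) λ x → *-distribˡ-+ (E′ x) (hits a′ C x) (hits a′ D x))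
          (𝕎-+ (suc b) (λ x → E′ x * hits a′ C x) (λ x → E′ x * hits a′ D x))
      regroup : ∀ b p q → suc b * p + q ≡ b * p + (p + q)
      regroup = solve-∀

  hits-bound b M a []          E inv C r s len inc r+s = z≤n
  hits-bound b M a (true ∷ U)  E inv C r s len inc r+s = hits-bound-fixed b M a U E inv C r s len inc r+s
  hits-bound b M a (false ∷ U) E inv C r s len inc r+s with lem {P = ¬ head a ≈ 0#}
  ... | yes a≉0 = hits-bound-free b M a U E inv a≉0 C r s len inc r+s
  ... | no _    = hits-bound-fixed b M a U E inv C r s len inc r+s

  -- A walk from 1 reaches M before 0 with probability 1 / M, and by its mean duration it is
  -- unabsorbed after κ steps with probability at most (2 + b)(M - 1) / 2κ. The size of κ makes the
  -- second term at most 1 / M too.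
  anti-concentration : ∀ b M (a : LinearForm n) (U : Subset n) E → Invariant U E →
    0 < ∣ support a ─ U ∣ → (2 + b) * (M * M) ≤ ∣ support a ─ U ∣ → ∀ c →
    M * 𝕎 (suc b) (λ x → E x * hits a [ c ] x) ≤ 2 * 𝕎 (suc b) E
  anti-concentration b zero    a U E inv 0<κ big c = z≤n
  anti-concentration b (suc M) a U E inv 0<κ big c = *-cancelˡ-≤ (2 * κ) {{m*n≢0 2 κ {{_}} {{>-nonZero 0<κ}}}} (begin
    2 * κ * (suc M * X)                            ≡⟨ *-assoc (2 * κ) (suc M) X ⟨
    2 * κ * suc M * X                              ≤⟨ hits-bound b (suc M) a U E inv [ c ] 1 M refl ([] ∷ []) refl ⟩
    (2 * κ * 1 + (2 + b) * suc M * (1 * M)) * Y    ≤⟨ *-monoˡ-≤ Y (+-monoʳ-≤ (2 * κ * 1) small) ⟩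
    (2 * κ * 1 + 2 * κ) * Y                        ≡⟨ regroup κ Y ⟩
    2 * κ * (2 * Y)                                ∎)
    where
    open ≤-Reasoning
    κ X Y : ℕ
    κ = ∣ support a ─ U ∣
    X = 𝕎 (suc b) (λ x → E x * hits a [ c ] x)
    Y = 𝕎 (suc b) E
    small : (2 + b) * suc M * (1 * M) ≤ 2 * κ
    small = begin
      (2 + b) * suc M * (1 * M)     ≤⟨ *-monoʳ-≤ ((2 + b) * suc M) (≤-trans (≤-reflexive (*-identityˡ M)) (n≤1+n M)) ⟩
      (2 + b) * suc M * suc M       ≡⟨ *-assoc (2 + b) (suc M) (suc M) ⟩
      (2 + b) * (suc M * suc M)     ≤⟨ big ⟩
      κ                             ≤⟨ m≤m+n κ _ ⟩
      2 * κ                         ∎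
    regroup : ∀ κ Y → (2 * κ * 1 + 2 * κ) * Y ≡ 2 * κ * (2 * Y)
    regroup = solve-∀

-- Functions of degree m are nonzero on at least a 2⁻ᵐ fraction of the cube

module Degree (lem : ∀ {ℓ} → ExcludedMiddle ℓ) (ℝ : CompleteOrderedField) where

  open CompleteOrderedField ℝ
  open Polynomials ℝ using (LinearForm)
  open Field lem ℝ
  open Cube lem using (⟦_⟧; ⟦⟧-true; ⟦⟧-mono; 𝕎; 𝕎-mono)
  open Hits lem ℝ using (apply)
  open import Algebra.Solver.Ring.NaturalCoefficients.Default commutativeSemiring
    using (solve; _:+_; _:*_; _:=_)
  open import Data.Bool.Base using (Bool; true; false)
  open import Data.Fin.Subset using (Subset; _∩_)
  open import Data.Nat.Base as ℕ using (ℕ; zero; suc)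
  import Data.Nat.Properties as ℕ
  open import Data.Nat.Tactic.RingSolver using (solve-∀)
  open import Data.Product.Base using (∃-syntax; _×_; _,_)
  open import Data.Unit.Base using (⊤)
  open import Data.Vec.Base using (Vec; []; _∷_)
  open import Data.Vec.Functional using (head; tail)
  open import Function.Base using (_∘_)
  open import Relation.Binary.PropositionalEquality as ≡ using (_≡_)
  open import Relation.Nullary using (¬_; yes; no; contradiction)

  private
    variable
      n : ℕ

  -- g agrees on the cube with a polynomial of degree at most m; the second
  -- component is the derivative in the first coordinate.
  Deg : ℕ → (Vec Bool n → Carrier) → Set
  Deg {zero}  _       g = ⊤
  Deg {suc n} zero    g = Deg zero (g ∘ (false ∷_)) ×
                          (∀ x → g (true ∷ x) ≈ g (false ∷ x))
  Deg {suc n} (suc m) g = Deg (suc m) (g ∘ (false ∷_)) ×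
                          (∃[ h ] Deg m h × (∀ x → g (true ∷ x) ≈ g (false ∷ x) + h x))

  deg-const : ∀ {n} m c → Deg {n} m (λ _ → c)
  deg-const {zero}  m       c = _
  deg-const {suc n} zero    c = deg-const zero c , λ _ → refl
  deg-const {suc n} (suc m) c = deg-const (suc m) c , _ , deg-const m 0# , λ _ → sym (+-identityʳ c)

  deg-suc : ∀ m {g : Vec Bool n → Carrier} → Deg m g → Deg (suc m) g
  deg-suc {zero}  m       _                  = _
  deg-suc {suc n} zero    (deg₀ , e)         = deg-suc zero deg₀ , _ , deg-const zero 0# ,
                                               λ x → trans (e x) (sym (+-identityʳ _))
  deg-suc {suc n} (suc m) (deg₀ , h , degₕ , e) = deg-suc (suc m) deg₀ , h , deg-suc m degₕ , e

  deg-+ : ∀ m {f g : Vec Bool n → Carrier} → Deg m f → Deg m g → Deg m (λ x → f x + g x)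
  deg-+ {zero}  m    _         _           = _
  deg-+ {suc n} zero (f₀ , ef) (g₀ , eg) = deg-+ zero f₀ g₀ , λ x → +-cong (ef x) (eg x)
  deg-+ {suc n} (suc m) (f₀ , h , degₕ , ef) (g₀ , k , degₖ , eg) =
    deg-+ (suc m) f₀ g₀ , _ , deg-+ m degₕ degₖ , λ x → trans (+-cong (ef x) (eg x))
      (solve 4 (λ p q r s → (p :+ q) :+ (r :+ s) := (p :+ r) :+ (q :+ s)) refl _ _ _ _)

  deg-scale : ∀ m c {g : Vec Bool n → Carrier} → Deg m g → Deg m (λ x → g x * c)
  deg-scale {zero}  m       c _                   = _
  deg-scale {suc n} zero    c (g₀ , e)            = deg-scale zero c g₀ , λ x → *-congʳ (e x)
  deg-scale {suc n} (suc m) c (g₀ , h , degₕ , e) =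
    deg-scale (suc m) c g₀ , _ , deg-scale m c degₕ , λ x → trans (*-congʳ (e x)) (distribʳ c _ _)

  -- Discrete product rule: if h is the derivative of g, the derivative of the product is h times
  -- the affine form on the `true` facet, minus `head a` times g.
  deg-affine : ∀ m c (a : LinearForm n) {g} → Deg m g → Deg (suc m) (λ x → g x * (c - apply a x))
  deg-affine {zero}  m    c a _        = _
  deg-affine {suc n} zero c a {g} (g₀ , e) =
    deg-affine zero c (tail a) g₀ , _ , deg-scale zero (- head a) g₀ , λ x →
      trans (*-cong (e x) (+-congˡ (sym (-‿+-comm _ _))))
        (solve 4 (λ p c d A → p :* (c :+ (d :+ A)) := p :* (c :+ A) :+ p :* d) refl
           (g (false ∷ x)) c (- head a) (- apply (tail a) x))
  deg-affine {suc n} (suc m) c a {g} (g₀ , h , degₕ , e) =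
    deg-affine (suc m) c (tail a) g₀ , _ ,
    deg-+ (suc m) (deg-affine m (c - head a) (tail a) degₕ) (deg-scale (suc m) (- head a) g₀) , λ x →
      trans (*-cong (e x) (+-congˡ (sym (-‿+-comm _ _))))
        (solve 5 (λ p q c d A → (p :+ q) :* (c :+ (d :+ A)) :=
                                p :* (c :+ A) :+ (q :* ((c :+ d) :+ A) :+ p :* d)) refl
           (g (false ∷ x)) (h x) c (- head a) (- apply (tail a) x))

  deg-mask : ∀ m {g : Vec Bool n → Carrier} (S : Subset n) → Deg m g → Deg m (λ y → g (S ∩ y))
  deg-mask m       []          _                   = _
  deg-mask zero    (false ∷ S) (g₀ , e)            = deg-mask zero S g₀ , λ _ → refl
  deg-mask (suc m) (false ∷ S) (g₀ , h , degₕ , e) =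
    deg-mask (suc m) S g₀ , _ , deg-const m 0# , λ _ → sym (+-identityʳ _)
  deg-mask zero    (true ∷ S)  (g₀ , e)            = deg-mask zero S g₀ , λ y → e (S ∩ y)
  deg-mask (suc m) (true ∷ S)  (g₀ , h , degₕ , e) =
    deg-mask (suc m) S g₀ , _ , deg-mask m S degₕ , λ y → e (S ∩ y)

  private
    count : (Vec Bool n → Carrier) → ℕ
    count g = 𝕎 1 (λ x → ⟦ ¬ g x ≈ 0# ⟧)

    count-mono : (f g : Vec Bool n → Carrier) → (∀ x → g x ≈ 0# → f x ≈ 0#) → count f ℕ.≤ count g
    count-mono f g imp = 𝕎-mono 1 {λ x → ⟦ ¬ f x ≈ 0# ⟧} {λ x → ⟦ ¬ g x ≈ 0# ⟧}
      λ x → ⟦⟧-mono λ f≉0 g≈0 → f≉0 (imp x g≈0)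

    vanishes : (g : Vec Bool n → Carrier) → ¬ (∃[ x ] ¬ g x ≈ 0#) → ∀ x → g x ≈ 0#
    vanishes g ∄ x with lem {P = g x ≈ 0#}
    ... | yes p = p
    ... | no ¬p = contradiction (x , ¬p) ∄

    halve : ∀ p q c c₀ c₁ → p ℕ.≤ q ℕ.* c → c ℕ.≤ c₀ ℕ.+ c₁ → 2 ℕ.* p ℕ.≤ 2 ℕ.* q ℕ.* (1 ℕ.* c₀ ℕ.+ c₁)
    halve p q c c₀ c₁ p≤ c≤ = ℕ.≤-trans (ℕ.*-monoʳ-≤ 2 (ℕ.≤-trans p≤ (ℕ.*-monoʳ-≤ q c≤)))
      (ℕ.≤-reflexive (regroup q c₀ c₁))
      where
      regroup : ∀ q c d → 2 ℕ.* (q ℕ.* (c ℕ.+ d)) ≡ 2 ℕ.* q ℕ.* (1 ℕ.* c ℕ.+ d)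
      regroup = solve-∀

    both : ∀ p q c₀ c₁ → p ℕ.≤ q ℕ.* c₀ → p ℕ.≤ q ℕ.* c₁ → 2 ℕ.* p ℕ.≤ q ℕ.* (1 ℕ.* c₀ ℕ.+ c₁)
    both p q c₀ c₁ i j = ℕ.≤-trans (ℕ.+-mono-≤ i (ℕ.≤-trans (ℕ.≤-reflexive (ℕ.+-identityʳ p)) j))
      (ℕ.≤-reflexive (regroup q c₀ c₁))
      where
      regroup : ∀ q c d → q ℕ.* c ℕ.+ q ℕ.* d ≡ q ℕ.* (1 ℕ.* c ℕ.+ d)
      regroup = solve-∀

  -- If g vanishes on one of the two facets, it equals its derivative there up to
  -- sign on the other one, where the degree is therefore at most m - 1.
  deg-count : ∀ m (g : Vec Bool n → Carrier) → Deg m g → ∃[ x ] ¬ g x ≈ 0# →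
              2 ℕ.^ n ℕ.≤ 2 ℕ.^ m ℕ.* 𝕎 1 (λ x → ⟦ ¬ g x ≈ 0# ⟧)
  deg-count {zero} m g _ ([] , g≉0) rewrite ⟦⟧-true g≉0 =
    ℕ.≤-trans (ℕ.m^n>0 2 m) (ℕ.≤-reflexive (≡.sym (ℕ.*-identityʳ _)))
  deg-count {suc n} m g deg (x , g≉0)
    with lem {P = ∃[ x ] ¬ g (false ∷ x) ≈ 0#} | lem {P = ∃[ x ] ¬ g (true ∷ x) ≈ 0#}
  deg-count {suc n} zero g (deg₀ , e) _ | yes ∃₀ | yes ∃₁ =
    both (2 ℕ.^ n) 1 (count g₀) (count g₁)
      (deg-count zero g₀ deg₀ ∃₀)
      (ℕ.≤-trans (deg-count zero g₀ deg₀ ∃₀)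
        (ℕ.*-monoʳ-≤ 1 (count-mono g₀ g₁ λ x g₁≈0 → trans (sym (e x)) g₁≈0)))
    where
    g₀ g₁ : Vec Bool n → Carrier
    g₀ = g ∘ (false ∷_)
    g₁ = g ∘ (true ∷_)
  deg-count {suc n} (suc m) g (deg₀ , h , degₕ , e) _ | yes ∃₀ | yes (x , g₁≉0) =
    both (2 ℕ.^ n) (2 ℕ.^ suc m) (count g₀) (count g₁)
      (deg-count (suc m) g₀ deg₀ ∃₀)
      (ℕ.≤-trans
        (deg-count (suc m) _ (deg-+ (suc m) deg₀ (deg-suc m degₕ)) (x , λ s≈0 → g₁≉0 (trans (e x) s≈0)))
        (ℕ.*-monoʳ-≤ (2 ℕ.^ suc m) (count-mono _ g₁ λ x g₁≈0 → trans (sym (e x)) g₁≈0)))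
    where
    g₀ g₁ : Vec Bool n → Carrier
    g₀ = g ∘ (false ∷_)
    g₁ = g ∘ (true ∷_)
  deg-count {suc n} zero g (deg₀ , e) _ | yes (x , g₀≉0) | no ∄₁ =
    contradiction (x , λ g₁≈0 → g₀≉0 (trans (sym (e x)) g₁≈0)) ∄₁
  deg-count {suc n} (suc m) g (deg₀ , h , degₕ , e) _ | yes (x , g₀≉0) | no ∄₁ =
    halve (2 ℕ.^ n) (2 ℕ.^ m) (count h) (count g₀) (count g₁)
      (deg-count m h degₕ (x , λ h≈0 → g₀≉0 (trans (sym (+-identityʳ _)) (trans (+-congˡ (sym h≈0))
        (trans (sym (e x)) (vanishes g₁ ∄₁ x))))))
      (ℕ.≤-trans (count-mono h g₀ λ x g₀≈0 → trans (sym (+-identityˡ _))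
        (trans (+-congʳ (sym g₀≈0)) (trans (sym (e x)) (vanishes g₁ ∄₁ x)))) (ℕ.m≤m+n _ _))
    where
    g₀ g₁ : Vec Bool n → Carrier
    g₀ = g ∘ (false ∷_)
    g₁ = g ∘ (true ∷_)
  deg-count {suc n} m g deg (false ∷ x , g≉0) | no ∄₀ | _ = contradiction (x , g≉0) ∄₀
  deg-count {suc n} zero g (deg₀ , e) (true ∷ x , g≉0) | no ∄₀ | _ =
    contradiction (x , λ g₀≈0 → g≉0 (trans (e x) g₀≈0)) ∄₀
  deg-count {suc n} (suc m) g (deg₀ , h , degₕ , e) (true ∷ x , g≉0) | no ∄₀ | _ =
    halve (2 ℕ.^ n) (2 ℕ.^ m) (count h) (count g₀) (count g₁)
      (deg-count m h degₕ (x , λ h≈0 → g≉0 (trans (g₁≈h x) h≈0)))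
      (ℕ.≤-trans (count-mono h g₁ λ x g₁≈0 → trans (sym (g₁≈h x)) g₁≈0) (ℕ.m≤n+m _ _))
    where
    g₀ g₁ : Vec Bool n → Carrier
    g₀ = g ∘ (false ∷_)
    g₁ = g ∘ (true ∷_)
    g₁≈h : ∀ x → g₁ x ≈ h x
    g₁≈h x = trans (e x) (trans (+-congʳ (vanishes g₀ ∄₀ x)) (+-identityˡ _))

-- Uncovered points at a single scale

module Scale (lem : ∀ {ℓ} → ExcludedMiddle ℓ) (ℝ : CompleteOrderedField) where

  open Polynomials ℝ using (LinearForm)
  open Cube lem
  open Hits lem ℝ
  open Degree lem ℝ
  open ℝ using (Carrier; 0#; 1#; _≈_)
  private module F = Field lem ℝ

  open import Data.Bool.Base using (Bool; false; true)
  open import Data.Fin.Subset using (Subset; ∣_∣; _∩_; _∪_; _─_; _⊆_; ⊥)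
  open import Data.Fin.Subset.Properties using (p⊆p∪q; q⊆p∪q; p⊆q⇒∣p∣≤∣q∣; ∣⊥∣≡0; ∣p─q∣≤∣p∣)
  open import Data.List.Base using (List; []; _∷_; [_]; length; map)
  open import Data.List.Membership.Propositional using (_∈_)
  open import Data.List.Membership.Propositional.Properties using (∈-map⁺)
  open import Data.List.Properties using (length-map)
  open import Data.List.Relation.Unary.Any using (here; there)
  open import Data.Nat.Base
  open import Data.Nat.Properties
  open import Data.Nat.Tactic.RingSolver using (solve-∀)
  open import Data.Product.Base using (∃-syntax; _×_; _,_; proj₂)
  open import Data.Sum.Base using (_⊎_; inj₁; inj₂)
  open import Data.Vec.Base using (Vec; []; _∷_; replicate)
  open import Function.Base using (_∘_)
  open import Relation.Binary.PropositionalEquality hiding ([_])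
  open import Relation.Nullary using (Dec; ¬_; yes; no; contradiction)

  private
    variable
      n : ℕ

  ^-distrib-* : ∀ n p q → (p * q) ^ n ≡ p ^ n * q ^ n
  ^-distrib-* zero    p q = refl
  ^-distrib-* (suc n) p q rewrite ^-distrib-* n p q = regroup p q (p ^ n) (q ^ n)
    where
    regroup : ∀ p q x y → p * q * (x * y) ≡ p * x * (q * y)
    regroup = solve-∀

  Misses : List (LinearForm n) → Vec Bool n → Set
  Misses l x = ∀ a → a ∈ l → ¬ apply a x ≈ 1#

  -- At such a point no factor 1 - L vanishes, so the covering polynomial differs from 1, the value
  -- of OR there.
  Uncovered : List (LinearForm n) → Vec Bool n → Set
  Uncovered {n} l x = Misses l x × x ≢ replicate n false

  howMany : (LinearForm n → Set) → List (LinearForm n) → ℕ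
  howMany P []      = 0
  howMany P (a ∷ l) = ⟦ P a ⟧ + howMany P l

  -- The product of 1 - L over the selected forms. Its value at the zero point is nonzero, and since
  -- every mask fixes that point, the product stays a nonzero function on each masked subcube.
  product-of : (P : LinearForm n → Set) → ∀ l →
    ∃[ g ] Deg (howMany P l) g × ¬ g (replicate n false) ≈ 0# ×
           (∀ x → ¬ g x ≈ 0# → ∀ {a} → a ∈ l → P a → ¬ apply a x ≈ 1#)
  product-of P [] = (λ _ → 1#) , deg-const 0 1# , ℝ.0≉1 ∘ ℝ.sym , λ _ _ ()
  product-of {n} P (a ∷ l) with product-of P l | lem {P = P a}
  ... | g , deg , g0≉0 , misses | no ¬Pa = g , deg , g0≉0 , λ where
    x gx≉0 (here refl) Pa → contradiction Pa ¬Pa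
    x gx≉0 (there a∈l)    → misses x gx≉0 a∈l
  ... | g , deg , g0≉0 , misses | yes Pa =
    (λ x → g x ℝ.* (1# ℝ.- apply a x)) , deg-affine (howMany P l) 1# a deg ,
    F.x*y≉0 g0≉0 (λ e → ℝ.0≉1 (ℝ.sym (ℝ.trans (ℝ.trans (ℝ.sym (ℝ.+-identityʳ 1#))
      (ℝ.+-congˡ (ℝ.sym (ℝ.trans (ℝ.-‿cong (apply-zero n a)) F.-0#≈0#)))) e))) ,
    λ where
      x e (here refl) _ ax≈1 → e (ℝ.trans (ℝ.*-congˡ (ℝ.trans (ℝ.+-congˡ (ℝ.-‿cong ax≈1))
                                  (ℝ.-‿inverseʳ 1#))) (ℝ.zeroʳ _))
      x e (there a∈l) → misses x (λ gx≈0 → e (ℝ.trans (ℝ.*-congʳ gx≈0) (ℝ.zeroˡ _))) a∈l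

  small-union : ∀ s (l : List (LinearForm n)) →
    ∃[ V ] ∣ V ∣ ≤ length l * s × (∀ {a} → a ∈ l → ∣ support a ∣ ≤ s → support a ⊆ V)
  small-union {n} s [] = ⊥ , ≤-reflexive (∣⊥∣≡0 n) , λ ()
  small-union s (a ∷ l) with small-union s l | ∣ support a ∣ ≤? s
  ... | V , size , ok | no big = V , ≤-trans size (m≤n+m _ s) , λ where
    (here refl) small → contradiction small big
    (there a∈l) → ok a∈l
  ... | V , size , ok | yes small = support a ∪ V ,
    ≤-trans (≤-reflexive (∣∪∣ (support a) V)) (+-mono-≤ small (≤-trans (∣p─q∣≤∣p∣ V (support a)) size)) ,
    λ where
      (here refl) _ → p⊆p∪q V
      (there a∈l) small′ p → q⊆p∪q (support a) V (ok a∈l small′ p)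

  -- The forms supported in U are missed together: the mask S avoids all the small
  -- ones, and on the subcube it leaves, only the remaining ones count.
  𝕎-supported : ∀ b s h (l : List (LinearForm n)) (U : Subset n) →
    8 * (length l * s) ≤ suc b → ∣ U ∣ ≤ h →
    7 * (2 + (b + b)) ^ n ≤
    8 * (2 ^ howMany (λ a → s < ∣ support a ∣ × ∣ support a ∣ ≤ h) l *
         𝕎 (suc (b + b)) (λ x → ⟦ (∀ {a} → a ∈ l → support a ⊆ U → ¬ apply a x ≈ 1#) ⟧))
  𝕎-supported {n} b s h l U few U≤h
    with V , V-size , small⊆V ← small-union s l
       | g , deg , g0≉0 , misses ← product-of (λ a → s < ∣ support a ∣ × ∣ support a ∣ ≤ h) l = begin
    7 * (2 + (b + b)) ^ n              ≡⟨ cong (λ z → 7 * z ^ n) (double b) ⟩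
    7 * (2 * suc b) ^ n                ≡⟨ cong (7 *_) (^-distrib-* n 2 (suc b)) ⟩
    7 * (2 ^ n * suc b ^ n)            ≡⟨ swap 7 (2 ^ n) (suc b ^ n) ⟩
    2 ^ n * (7 * suc b ^ n)            ≤⟨ *-monoʳ-≤ (2 ^ n) avoid ⟩
    2 ^ n * (8 * Z)                    ≡⟨ swap (2 ^ n) 8 Z ⟩
    8 * (2 ^ n * Z)                    ≤⟨ *-monoʳ-≤ 8 main ⟩
    8 * (2 ^ m * 𝕎 (suc (b + b)) (λ x → ⟦ E x ⟧)) ∎
    where
    open ≤-Reasoning
    m Z : ℕ
    m = howMany (λ a → s < ∣ support a ∣ × ∣ support a ∣ ≤ h) l
    Z = 𝕎 b (λ S → ⟦ Disjoint S V ⟧)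
    E : Vec Bool n → Set
    E x = ∀ {a} → a ∈ l → support a ⊆ U → ¬ apply a x ≈ 1#
    double : ∀ b → 2 + (b + b) ≡ 2 * suc b
    double = solve-∀
    swap : ∀ p q r → p * (q * r) ≡ q * (p * r)
    swap = solve-∀
    -- ∣ V ∣ is at most an eighth of suc b, so the mask avoids `V` with probability at least 7/8.
    avoid : 7 * suc b ^ n ≤ 8 * Z
    avoid = *-cancelˡ-≤ (suc b) (+-cancelʳ-≤ (suc b * suc b ^ n) _ _ (begin
      suc b * (7 * suc b ^ n) + suc b * suc b ^ n   ≡⟨ r₁ (suc b) (suc b ^ n) ⟩
      8 * suc b ^ suc n                             ≤⟨ *-monoʳ-≤ 8 (𝕎-disjoint b V) ⟩
      8 * (suc b * Z + ∣ V ∣ * suc b ^ n)            ≡⟨ r₂ (suc b) Z ∣ V ∣ (suc b ^ n) ⟩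
      suc b * (8 * Z) + 8 * ∣ V ∣ * suc b ^ n        ≤⟨ +-monoʳ-≤ _ (*-monoˡ-≤ (suc b ^ n)
                                                        (≤-trans (*-monoʳ-≤ 8 V-size) few)) ⟩
      suc b * (8 * Z) + suc b * suc b ^ n           ∎))
      where
      r₁ : ∀ c p → c * (7 * p) + c * p ≡ 8 * (c * p)
      r₁ = solve-∀
      r₂ : ∀ c z v p → 8 * (c * z + v * p) ≡ c * (8 * z) + 8 * v * p
      r₂ = solve-∀
    E-holds : ∀ S → Disjoint S V → ∀ y → ¬ g (S ∩ y) ≈ 0# → E (S ∩ y)
    E-holds S S∩V=∅ y g≉0 {a} a∈l a⊆U with ∣ support a ∣ ≤? s
    ... | yes small = λ e → ℝ.0≉1 (ℝ.trans
      (ℝ.sym (apply-disjoint a S (λ i i∈S i∈a → S∩V=∅ i i∈S (small⊆V a∈l small i∈a)) y)) e)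
    -- A larger form inside `U` has support at most `h`, so it is one of the factors of `g`.
    ... | no large  = misses (S ∩ y) g≉0 a∈l (≰⇒> large , ≤-trans (p⊆q⇒∣p∣≤∣q∣ a⊆U) U≤h)
    on-mask : ∀ S → 2 ^ n * ⟦ Disjoint S V ⟧ ≤ 2 ^ m * 𝕎 1 (λ y → ⟦ E (S ∩ y) ⟧)
    on-mask S with lem {P = Disjoint S V}
    ... | no _  = ≤-trans (≤-reflexive (*-zeroʳ (2 ^ n))) z≤n
    -- On the fair bits left by the mask, `deg-count` applies with the zero point as witness.
    ... | yes d = ≤-trans (≤-reflexive (*-identityʳ (2 ^ n))) (≤-trans
      (deg-count m (λ y → g (S ∩ y)) (deg-mask m S deg) (replicate n false , λ e → g0≉0
        (subst (λ z → g z ≈ 0#) (∩-zero S) e)))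
      (*-monoʳ-≤ (2 ^ m) (𝕎-mono 1 λ y → ⟦⟧-mono (E-holds S d y))))
      where
      ∩-zero : ∀ {n} (S : Subset n) → S ∩ replicate n false ≡ replicate n false
      ∩-zero []          = refl
      ∩-zero (true ∷ S)  = cong (false ∷_) (∩-zero S)
      ∩-zero (false ∷ S) = cong (false ∷_) (∩-zero S)
    main : 2 ^ n * Z ≤ 2 ^ m * 𝕎 (suc (b + b)) (λ x → ⟦ E x ⟧)
    main = begin
      2 ^ n * Z                                              ≡⟨ 𝕎-* b (2 ^ n) (λ S → ⟦ Disjoint S V ⟧) ⟨
      𝕎 b (λ S → 2 ^ n * ⟦ Disjoint S V ⟧)                   ≤⟨ 𝕎-mono b on-mask ⟩
      𝕎 b (λ S → 2 ^ m * 𝕎 1 (λ y → ⟦ E (S ∩ y) ⟧))         ≡⟨ 𝕎-* b (2 ^ m) (λ S → 𝕎 1 (λ y → ⟦ E (S ∩ y) ⟧)) ⟩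
      2 ^ m * 𝕎 b (λ S → 𝕎 1 (λ y → ⟦ E (S ∩ y) ⟧))         ≡⟨ cong (2 ^ m *_) (𝕎-masked b (λ x → ⟦ E x ⟧)) ⟨
      2 ^ m * 𝕎 (suc (b + b)) (λ x → ⟦ E x ⟧)               ∎

  supported-invariant : (l : List (LinearForm n)) (U : Subset n) →
    Invariant U (λ x → ⟦ (∀ {a} → a ∈ l → support a ⊆ U → ¬ apply a x ≈ 1#) ⟧)
  supported-invariant l U x y e = ≤-antisym (⟦⟧-mono (λ Ex → transport Ex e)) (⟦⟧-mono (λ Ey → transport Ey (sym e)))
    where
    transport : ∀ {x y} → (∀ {a} → a ∈ l → support a ⊆ U → ¬ apply a x ≈ 1#) → x ∩ U ≡ y ∩ U →
                ∀ {a} → a ∈ l → support a ⊆ U → ¬ apply a y ≈ 1#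
    transport {x} {y} Ex e {a} a∈l a⊆U ay≈1 = Ex a∈l a⊆U (ℝ.trans (ℝ.sym (apply-∩ a U a⊆U x))
      (ℝ.trans (ℝ.reflexive (cong (apply a) e)) (ℝ.trans (apply-∩ a U a⊆U y) ay≈1)))

  -- Excludes the zero point by the same tool as the forms: there the sum of the bits takes the
  -- value 0, which is rare by anti-concentration.
  ones : LinearForm n
  ones _ = 1#

  ∣support-ones∣ : ∀ n → ∣ support {n} ones ∣ ≡ n
  ∣support-ones∣ zero    = refl
  ∣support-ones∣ (suc n) with lem {P = ¬ 1# ≈ 0#}
  ... | yes _ = cong suc (∣support-ones∣ n)
  ... | no ¬p = contradiction (λ e → ℝ.0≉1 (ℝ.sym e)) ¬p

  -- Union bound within `E`. Forms inside `U` are missed by assumption; every other form, and the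
  -- zero point through `ones`, loses at most a fraction 2 / M of `E`. The hypothesis κ + ∣ U ∣ ≤ n
  -- leaves `ones` its κ free variables.
  𝕎-uncovered : ∀ b M κ (U : Subset n) (E : Vec Bool n → Set) → Invariant U (λ x → ⟦ E x ⟧) →
    0 < κ → (2 + b) * (M * M) ≤ κ → κ + ∣ U ∣ ≤ n → (l : List (LinearForm n)) →
    (∀ {a} → a ∈ l → support a ⊆ U ⊎ κ ≤ ∣ support a ─ U ∣) →
    (∀ x → E x → ∀ {a} → a ∈ l → support a ⊆ U → ¬ apply a x ≈ 1#) →
    let Y = 𝕎 (suc b) (λ x → ⟦ E x ⟧) in
    M * Y ≤ M * 𝕎 (suc b) (λ x → ⟦ E x × Uncovered l x ⟧) + 2 * suc (length l) * Y
  𝕎-uncovered {n} b M κ U E inv 0<κ big room [] _ _ = begin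
    M * Y                                         ≤⟨ *-monoʳ-≤ M (𝕎-mono (suc b) pointwise) ⟩
    M * 𝕎 (suc b) (λ x → G x + ⟦ E x ⟧ * H x)     ≡⟨ cong (M *_) (𝕎-+ (suc b) G (λ x → ⟦ E x ⟧ * H x)) ⟩
    M * (𝕎 (suc b) G + 𝕎 (suc b) (λ x → ⟦ E x ⟧ * H x))
                                                  ≡⟨ *-distribˡ-+ M (𝕎 (suc b) G) _ ⟩
    M * 𝕎 (suc b) G + M * 𝕎 (suc b) (λ x → ⟦ E x ⟧ * H x)
      ≤⟨ +-monoʳ-≤ (M * 𝕎 (suc b) G) (anti-concentration b M ones U (λ x → ⟦ E x ⟧) inv (≤-trans 0<κ free) (≤-trans big free) 0#) ⟩
    M * 𝕎 (suc b) G + 2 * 1 * Y                   ∎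
    where
    open ≤-Reasoning
    Y : ℕ
    Y = 𝕎 (suc b) (λ x → ⟦ E x ⟧)
    G H : Vec Bool n → ℕ
    G x = ⟦ E x × Uncovered [] x ⟧
    H x = hits ones [ 0# ] x
    free : κ ≤ ∣ support ones ─ U ∣
    free = +-cancelʳ-≤ ∣ U ∣ κ _ (≤-trans room
      (≤-trans (≤-reflexive (sym (∣support-ones∣ n))) (∣─∣≤ (support ones) U)))
    pointwise : ∀ x → ⟦ E x ⟧ ≤ G x + ⟦ E x ⟧ * H x
    pointwise x = ⟦⟧-≤ λ Ex → case Ex (lem {P = x ≡ replicate n false})
      where
      case : E x → Dec (x ≡ replicate n false) → 1 ≤ G x + ⟦ E x ⟧ * H x
      case Ex (no x≢0)   = ≤-trans (≤-reflexive (sym (⟦⟧-true (Ex , (λ _ ()) , x≢0)))) (m≤m+n _ _)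
      case Ex (yes refl) rewrite ⟦⟧-true Ex = ≤-trans (1≤hits ones 0# x (apply-zero n ones))
        (≤-trans (≤-reflexive (sym (*-identityˡ (H x)))) (m≤n+m (1 * H x) (G x)))
  𝕎-uncovered {n} b M κ U E inv 0<κ big room (a ∷ l) dichotomy ok = begin
    M * Y                                                 ≤⟨ 𝕎-uncovered b M κ U E inv 0<κ big room l
                                                              (dichotomy ∘ there) (λ x Ex a∈l → ok x Ex (there a∈l)) ⟩
    M * 𝕎 (suc b) (λ x → ⟦ E x × Uncovered l x ⟧) + 2 * suc (length l) * Y
                                                          ≤⟨ +-monoˡ-≤ _ step ⟩
    M * 𝕎 (suc b) G + 2 * Y + 2 * suc (length l) * Y      ≡⟨ regroup (M * 𝕎 (suc b) G) (length l) Y ⟩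
    M * 𝕎 (suc b) G + 2 * suc (suc (length l)) * Y        ∎
    where
    open ≤-Reasoning
    Y : ℕ
    Y = 𝕎 (suc b) (λ x → ⟦ E x ⟧)
    G H : Vec Bool n → ℕ
    G x = ⟦ E x × Uncovered (a ∷ l) x ⟧
    H x = hits a [ 1# ] x
    regroup : ∀ g k y → g + 2 * y + 2 * suc k * y ≡ g + 2 * suc (suc k) * y
    regroup = solve-∀
    misses-∷ : ∀ x → ¬ apply a x ≈ 1# → Misses l x → Misses (a ∷ l) x
    misses-∷ x ma ml _  (here refl) = ma
    misses-∷ x ma ml a′ (there a∈l) = ml a′ a∈l
    step : M * 𝕎 (suc b) (λ x → ⟦ E x × Uncovered l x ⟧) ≤ M * 𝕎 (suc b) G + 2 * Y
    step with dichotomy (here refl)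
    ... | inj₁ a⊆U = ≤-trans (*-monoʳ-≤ M (𝕎-mono (suc b)
      {λ x → ⟦ E x × Uncovered l x ⟧} {G} λ x → ⟦⟧-mono λ (Ex , ml , x≢0) →
      Ex , misses-∷ x (ok x Ex (here refl) a⊆U) ml , x≢0)) (m≤m+n _ _)
    ... | inj₂ free = begin
      M * 𝕎 (suc b) (λ x → ⟦ E x × Uncovered l x ⟧)       ≤⟨ *-monoʳ-≤ M (𝕎-mono (suc b) pointwise) ⟩
      M * 𝕎 (suc b) (λ x → G x + ⟦ E x ⟧ * H x)           ≡⟨ cong (M *_) (𝕎-+ (suc b) G (λ x → ⟦ E x ⟧ * H x)) ⟩
      M * (𝕎 (suc b) G + 𝕎 (suc b) (λ x → ⟦ E x ⟧ * H x)) ≡⟨ *-distribˡ-+ M (𝕎 (suc b) G) _ ⟩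
      M * 𝕎 (suc b) G + M * 𝕎 (suc b) (λ x → ⟦ E x ⟧ * H x)
        ≤⟨ +-monoʳ-≤ (M * 𝕎 (suc b) G) (anti-concentration b M a U (λ x → ⟦ E x ⟧) inv (≤-trans 0<κ free) (≤-trans big free) 1#) ⟩
      M * 𝕎 (suc b) G + 2 * Y                             ∎
      where
      pointwise : ∀ x → ⟦ E x × Uncovered l x ⟧ ≤ G x + ⟦ E x ⟧ * H x
      pointwise x = ⟦⟧-≤ λ (Ex , ml , x≢0) → case Ex ml x≢0 (lem {P = apply a x ≈ 1#})
        where
        case : E x → Misses l x → x ≢ replicate n false → Dec (apply a x ≈ 1#) → 1 ≤ G x + ⟦ E x ⟧ * H x
        case Ex ml x≢0 (no miss) = ≤-trans (≤-reflexive (sym (⟦⟧-true (Ex , misses-∷ x miss ml , x≢0)))) (m≤m+n _ _)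
        case Ex ml x≢0 (yes hit) rewrite ⟦⟧-true Ex = ≤-trans (1≤hits a 1# x hit)
          (≤-trans (≤-reflexive (sym (*-identityˡ (H x)))) (m≤n+m (1 * H x) (G x)))

  -- With u = d + 1, masks of density 1 / 8us and anti-concentration up to 1 / 16u,
  -- a form is free once κ = 2 (8us) (16u)² of its variables are outside U, and the
  -- forms absorbed into U have support at most u κ = ratio d * s.  Abstract because
  -- conversion checking would unfold the literal in unary.
  abstract
    ratio : ℕ → ℕ
    ratio d = 4096 * suc d ^ 4

    ratio-≡ : ∀ d → ratio d ≡ 4096 * suc d ^ 4
    ratio-≡ d = refl

    2≤ratio : ∀ d → 2 ≤ ratio d
    2≤ratio d = *-mono-≤ {2} {4096} (s≤s (s≤s z≤n)) (m^n>0 (suc d) 4)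

  private
    scale-≡ : ∀ u s A B → 2 * (A * (u * s)) * (u * (B * u * (B * u))) ≡ 2 * A * B * B * (u * (u * (u * (u * 1)))) * s
    scale-≡ = solve-∀

  Medium : ℕ → ℕ → LinearForm n → Set
  Medium d s a = s < ∣ support a ∣ × ∣ support a ∣ ≤ ratio d * s

  -- `𝕎-supported` gives `E` measure at least 7/8 · 2⁻ᵐ, and since 2 (d + 1) / M = 1/8, at least 7/8
  -- of it is uncovered; finally 49/64 ≥ 48/64 = 3/4.
  one-scale : ∀ d s b (l : List (LinearForm n)) → length l ≤ d → suc b ≡ 8 * (suc d * s) → ratio d * s ≤ n →
    3 * (2 + (b + b)) ^ n ≤
    4 * 2 ^ howMany (Medium d s) l * 𝕎 (suc (b + b)) (λ x → ⟦ Uncovered l x ⟧)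
  one-scale {n} d s b l l≤d N≡ room
    with U , _ , U-size , dichotomy ← absorb ((2 + (b + b)) * (16 * suc d * (16 * suc d))) (length l) (map support l) (length-map support l) ⊥
    = *-cancelˡ-≤ 16 (begin
      16 * (3 * T)          ≡⟨ r₀ T ⟩
      48 * T                ≤⟨ *-monoˡ-≤ T (n≤1+n 48) ⟩
      49 * T                ≡⟨ r₁ T ⟩
      7 * (7 * T)           ≤⟨ *-monoʳ-≤ 7 (𝕎-supported b s h l U few (U≤h U U-size)) ⟩
      7 * (8 * (P * Y U))   ≡⟨ r₂ P (Y U) ⟩
      8 * P * (7 * Y U)     ≤⟨ *-monoʳ-≤ (8 * P) (most U (U+κ≤n U U-size) (λ a∈l → dichotomy (∈-map⁺ support a∈l))) ⟩
      8 * P * (8 * G)       ≡⟨ r₃ P G ⟩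
      16 * (4 * P * G)      ∎)
    where
    open ≤-Reasoning
    u M κ h T P G : ℕ
    u = suc d
    M = 16 * u
    κ = (2 + (b + b)) * (M * M)
    h = ratio d * s
    T = (2 + (b + b)) ^ n
    P = 2 ^ howMany (Medium d s) l
    G = 𝕎 (suc (b + b)) (λ x → ⟦ Uncovered l x ⟧)
    E : Subset n → Vec Bool n → Set
    E U x = ∀ {a} → a ∈ l → support a ⊆ U → ¬ apply a x ≈ 1#
    Y : Subset n → ℕ
    Y U = 𝕎 (suc (b + b)) (λ x → ⟦ E U x ⟧)
    r₀ : ∀ t → 16 * (3 * t) ≡ 48 * t
    r₀ = solve-∀
    r₁ : ∀ t → 49 * t ≡ 7 * (7 * t)
    r₁ = solve-∀
    r₂ : ∀ p y → 7 * (8 * (p * y)) ≡ 8 * p * (7 * y)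
    r₂ = solve-∀
    r₃ : ∀ p g → 8 * p * (8 * g) ≡ 16 * (4 * p * g)
    r₃ = solve-∀
    uκ≡h : u * κ ≡ h
    uκ≡h = begin-equality
      u * ((2 + (b + b)) * (M * M))     ≡⟨ e₁ u b M ⟩
      2 * suc b * (u * (M * M))         ≡⟨ cong (λ z → 2 * z * (u * (M * M))) N≡ ⟩
      2 * (8 * (u * s)) * (u * (M * M)) ≡⟨ scale-≡ u s 8 16 ⟩
      4096 * u ^ 4 * s                  ≡⟨ cong (_* s) (ratio-≡ d) ⟨
      h                                 ∎
      where
      e₁ : ∀ u b M → u * ((2 + (b + b)) * (M * M)) ≡ 2 * suc b * (u * (M * M))
      e₁ = solve-∀
    few : 8 * (length l * s) ≤ suc b
    few = ≤-trans (*-monoʳ-≤ 8 (*-monoˡ-≤ s (≤-trans l≤d (n≤1+n d)))) (≤-reflexive (sym N≡))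
    -- At most d sets are absorbed while u = d + 1; the difference is the one κ that has to fit
    -- outside `U`.
    module _ (U : Subset n) (U-size : ∣ U ∣ ≤ ∣ ⊥ {n} ∣ + length l * κ) where
      U≤dκ : ∣ U ∣ ≤ d * κ
      U≤dκ = ≤-trans U-size (≤-trans (≤-reflexive (cong (_+ length l * κ) (∣⊥∣≡0 n))) (*-monoˡ-≤ κ l≤d))
      U+κ≤n : κ + ∣ U ∣ ≤ n
      U+κ≤n = ≤-trans (+-monoʳ-≤ κ U≤dκ) (≤-trans (≤-reflexive uκ≡h) room)
      U≤h : ∣ U ∣ ≤ h
      U≤h = ≤-trans (m≤n+m _ κ) (≤-trans (+-monoʳ-≤ κ U≤dκ) (≤-reflexive uκ≡h))
    most : ∀ U → κ + ∣ U ∣ ≤ n → (∀ {a} → a ∈ l → support a ⊆ U ⊎ κ ≤ ∣ support a ─ U ∣) → 7 * Y U ≤ 8 * G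
    most U room′ dichotomy = *-cancelˡ-≤ (2 * u) (+-cancelʳ-≤ (2 * u * Y U) _ _ (begin
      2 * u * (7 * Y U) + 2 * u * Y U                ≡⟨ m₁ u (Y U) ⟩
      M * Y U                                        ≤⟨ 𝕎-uncovered (b + b) M κ U (E U) (supported-invariant l U)
                                                          (s≤s z≤n) ≤-refl room′ l dichotomy (λ x Ex → Ex) ⟩
      M * 𝕎 (suc (b + b)) (λ x → ⟦ E U x × Uncovered l x ⟧) + 2 * suc (length l) * Y U
                                                     ≤⟨ +-mono-≤ (*-monoʳ-≤ M (𝕎-mono (suc (b + b))
                                                          {λ x → ⟦ E U x × Uncovered l x ⟧} {λ x → ⟦ Uncovered l x ⟧} λ x → ⟦⟧-mono proj₂))
                                                          (*-monoˡ-≤ (Y U) (*-monoʳ-≤ 2 (s≤s l≤d))) ⟩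
      M * G + 2 * u * Y U                            ≡⟨ cong (_+ 2 * u * Y U) (m₂ u G) ⟩
      2 * u * (8 * G) + 2 * u * Y U                  ∎))
      where
      m₁ : ∀ u y → 2 * u * (7 * y) + 2 * u * y ≡ 16 * u * y
      m₁ = solve-∀
      m₂ : ∀ u g → 16 * u * g ≡ 2 * u * (8 * g)
      m₂ = solve-∀

-- Covering polynomials evaluated on the cube

module Cover (lem : ∀ {ℓ} → ExcludedMiddle ℓ) (ℝ : CompleteOrderedField) where

  open CompleteOrderedField ℝ
  open Polynomials ℝ
  open Probability ℝ
  open ProbabilisticDegree ℝ
  open Field lem ℝ
  open Hits lem ℝ using (apply)
  open Scale lem ℝ using (Uncovered)
  open import Algebra.Solver.Ring.NaturalCoefficients.Default commutativeSemiring
    using (solve; _:+_; _:*_; _:=_)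
  open import Data.Bool.Base using (Bool; true; false)
  import Data.Bool.Properties as Bool
  open import Data.Fin.Base using (Fin; zero; suc)
  open import Data.List.Base as List using ()
  open import Data.List.Membership.Propositional.Properties using (∈-tabulate⁺)
  open import Data.Nat.Base using (ℕ; zero; suc)
  open import Data.Product.Base using (∃-syntax; _,_)
  open import Data.Vec.Base as Vec using (Vec; lookup; replicate)
  open import Data.Vec.Functional as Vector using (Vector)
  open import Data.Vec.Properties using (≡-dec; lookup-replicate)
  open import Function.Base using (_∘_; case_of_)
  open import Relation.Binary.PropositionalEquality as ≡ using (_≡_)
  open import Relation.Nullary using (Dec; ¬_; yes; no; contradiction)

  private
    variable
      n : ℕ

  eval-const : ∀ c (x : Vector Carrier n) → eval (const c) x ≈ c
  eval-const {zero}  c x = refl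
  eval-const {suc n} c x = trans (+-cong (eval-const c (Vector.tail x)) (zeroʳ _)) (+-identityʳ c)

  eval-var : ∀ (i : Fin n) x → eval (var i) x ≈ x i
  eval-var zero x = trans (+-cong (eval-const 0# (Vector.tail x)) (*-congˡ (trans (+-cong (eval-const 1# (Vector.tail x)) (zeroʳ _))
    (+-identityʳ 1#)))) (trans (+-identityˡ _) (*-identityʳ _))
  eval-var (suc i) x = trans (+-cong (eval-var i _) (zeroʳ _)) (+-identityʳ _)

  eval-+ : ∀ (P Q : Poly n) x → eval (P +ᴾ Q) x ≈ eval P x + eval Q x
  eval-+ [ a ]   [ b ]   x = refl
  eval-+ []      Q       x = sym (+-identityˡ _)
  eval-+ (p ∷ P) []      x = sym (+-identityʳ _)
  eval-+ (p ∷ P) (q ∷ Q) x = trans (+-cong (eval-+ p q _) (*-congˡ (eval-+ P Q x)))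
    (solve 5 (λ a b c d e → (a :+ b) :+ c :* (d :+ e) := (a :+ c :* d) :+ (b :+ c :* e)) refl _ _ _ _ _)

  eval-* : ∀ (P Q : Poly n) x → eval (P *ᴾ Q) x ≈ eval P x * eval Q x
  eval-scale : ∀ (p : Poly n) Q x → eval (scale p Q) x ≈ eval p (Vector.tail x) * eval Q x
  eval-* [ a ]   [ b ] x = refl
  eval-* []      Q     x = sym (zeroˡ _)
  eval-* (p ∷ P) Q     x = trans (eval-+ (scale p Q) (const 0# ∷ P *ᴾ Q) x)
    (trans (+-cong (eval-scale p Q x) (+-cong (eval-const 0# (Vector.tail x)) (*-congˡ (eval-* P Q x))))
      (trans (+-congˡ (+-identityˡ _))
        (solve 4 (λ a b c d → a :* b :+ c :* (d :* b) := (a :+ c :* d) :* b) refl _ _ _ _)))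
  eval-scale p []      x = sym (zeroʳ _)
  eval-scale p (q ∷ Q) x = trans (+-cong (eval-* p q _) (*-congˡ (eval-scale p Q x)))
    (solve 4 (λ a b c d → a :* b :+ c :* (a :* d) := a :* (b :+ c :* d)) refl _ _ _ _)

  eval-1- : ∀ (Q : Poly n) x → eval (const 1# -ᴾ Q) x ≈ 1# - eval Q x
  eval-1- Q x = trans (eval-+ (const 1#) (const (- 1#) *ᴾ Q) x) (+-cong (eval-const 1# x)
    (trans (eval-* (const (- 1#)) Q x) (trans (*-congʳ (eval-const (- 1#) x)) (-1*x≈-x _))))

  point : Vec Bool n → Vector Carrier n
  point x i = fromBool (lookup x i)

  eval-sum : ∀ {k} (v : Vector (Poly n) k) x → eval (Vector.foldr _+ᴾ_ (const 0#) v) x ≈ sum (λ i → eval (v i) x)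
  eval-sum {k = zero}  v x = eval-const 0# x
  eval-sum {k = suc k} v x = trans (eval-+ (v zero) _ x) (+-congˡ (eval-sum (Vector.tail v) x))

  sum-cong : ∀ {k} {u v : Vector Carrier k} → (∀ i → u i ≈ v i) → sum u ≈ sum v
  sum-cong {zero}  e = refl
  sum-cong {suc k} e = +-cong (e zero) (sum-cong (e ∘ suc))

  sum-apply : ∀ (a : LinearForm n) (x : Vec Bool n) → sum (λ i → a i * point x i) ≈ apply a x
  sum-apply a Vec.[]            = refl
  sum-apply a (false Vec.∷ x) = trans (+-cong (zeroʳ _) (sum-apply (Vector.tail a) x)) (+-identityˡ _)
  sum-apply a (true Vec.∷ x)  = +-cong (*-identityʳ _) (sum-apply (Vector.tail a) x)

  eval-linear : ∀ (a : LinearForm n) x → eval (linear a) (point x) ≈ apply a x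
  eval-linear a x = trans (eval-sum (λ i → const (a i) *ᴾ var i) (point x)) (trans
    (sum-cong λ i → trans (eval-* (const (a i)) (var i) (point x))
      (*-cong (eval-const (a i) (point x)) (eval-var i (point x))))
    (sum-apply a x))

  factors : ∀ {t} → Vector (LinearForm n) t → Vector (Poly n) t
  factors L i = const 1# -ᴾ linear (L i)

  eval-factor : ∀ (a : LinearForm n) x → eval (const 1# -ᴾ linear a) (point x) ≈ 1# - apply a x
  eval-factor a x = trans (eval-1- (linear a) (point x)) (+-congˡ (-‿cong (eval-linear a x)))

  product≉0 : ∀ {t} (L : Vector (LinearForm n) t) x → (∀ i → ¬ apply (L i) x ≈ 1#) →
              ¬ eval (Vector.foldr _*ᴾ_ (const 1#) (factors L)) (point x) ≈ 0#
  product≉0 {t = zero}  L x misses e = 0≉1 (sym (trans (sym (eval-const 1# (point x))) e))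
  product≉0 {t = suc t} L x misses e = x*y≉0
    (λ f≈0 → misses zero (trans (sym (+-identityˡ _)) (trans
      (+-congʳ (trans (sym f≈0) (eval-factor (L zero) x))) (restore 1# _))))
    (product≉0 (Vector.tail L) x (misses ∘ suc))
    (trans (sym (eval-* (factors L zero) _ (point x))) e)

  1-p≉1 : ∀ {p} → ¬ p ≈ 0# → ¬ 1# - p ≈ 1#
  1-p≉1 {p} p≉0 e = p≉0 (+-cancelˡ 1# _ _ (trans (trans (+-congʳ (sym e)) (restore 1# p)) (sym (+-identityʳ 1#))))

  OR-nonzero : ∀ (x : Vec Bool n) → ¬ x ≡ replicate n false → OR n x ≡ true
  OR-nonzero {n} x x≢0 with ≡-dec Bool._≟_ x (replicate n false)
  ... | yes x≡0 = contradiction x≡0 x≢0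
  ... | no _    = ≡.refl

  OR-zero : ∀ n → OR n (replicate n false) ≡ false
  OR-zero n with ≡-dec Bool._≟_ (replicate n false) (replicate n false)
  ... | yes _ = ≡.refl
  ... | no ¬p = contradiction ≡.refl ¬p

  uncovered-error : ∀ {t} (P : Poly n) ((L , _) : IsHyperplaneCovering t P) →
    ∀ x → Uncovered (List.tabulate L) x → holds (errorAt (OR n) x) P
  uncovered-error {n} P (L , P≈) x (misses , x≢0) rewrite OR-nonzero x x≢0 = λ P≈1 →
    1-p≉1 (product≉0 L x (λ i → misses (L i) (∈-tabulate⁺ i)))
      (trans (sym (eval-1- ∏ (point x))) (trans (sym (eval-cong P (const 1# -ᴾ ∏) P≈ (point x))) P≈1))
    where
    ∏ : Poly n
    ∏ = Vector.foldr _*ᴾ_ (const 1#) (factors L)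

  coordinates : ∀ n → Vector (LinearForm n) n
  coordinates (suc n) zero    zero    = 1#
  coordinates (suc n) zero    (suc j) = 0#
  coordinates (suc n) (suc i) zero    = 0#
  coordinates (suc n) (suc i) (suc j) = coordinates n i j

  -- The product of all 1 - xᵢ is 1 at the zero point and 0 at every other point of the cube, so `n`
  -- forms compute OR without error.
  all-coordinates : ∀ n → Poly n
  all-coordinates n = const 1# -ᴾ Vector.foldr _*ᴾ_ (const 1#) (factors (coordinates n))

  apply-null : ∀ (x : Vec Bool n) → apply (λ _ → 0#) x ≈ 0#
  apply-null Vec.[]          = refl
  apply-null (false Vec.∷ x) = apply-null x
  apply-null (true Vec.∷ x)  = trans (+-identityˡ _) (apply-null x)

  apply-coordinate : ∀ (i : Fin n) x → apply (coordinates n i) x ≈ fromBool (lookup x i)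
  apply-coordinate zero    (false Vec.∷ x) = apply-null x
  apply-coordinate zero    (true Vec.∷ x)  = trans (+-congˡ (apply-null x)) (+-identityʳ 1#)
  apply-coordinate (suc i) (false Vec.∷ x) = apply-coordinate i x
  apply-coordinate (suc i) (true Vec.∷ x)  = trans (+-identityˡ _) (apply-coordinate i x)

  eval-product : ∀ {t} (L : Vector (LinearForm n) t) x →
    eval (Vector.foldr _*ᴾ_ (const 1#) (factors L)) (point x) ≈
    Vector.foldr _*_ 1# (λ i → 1# - apply (L i) x)
  eval-product {t = zero}  L x = eval-const 1# (point x)
  eval-product {t = suc t} L x = trans (eval-* (factors L zero) _ (point x))
    (*-cong (eval-factor (L zero) x) (eval-product (Vector.tail L) x))

  product-one : ∀ {t} (v : Vector Carrier t) → (∀ i → v i ≈ 1#) → Vector.foldr _*_ 1# v ≈ 1#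
  product-one {zero}  v e = refl
  product-one {suc t} v e = trans (*-cong (e zero) (product-one (Vector.tail v) (e ∘ suc))) (*-identityˡ 1#)

  product-zero : ∀ {t} (v : Vector Carrier t) i → v i ≈ 0# → Vector.foldr _*_ 1# v ≈ 0#
  product-zero v zero    e = trans (*-congʳ e) (zeroˡ _)
  product-zero v (suc i) e = trans (*-congˡ (product-zero (Vector.tail v) i e)) (zeroʳ _)

  all-coordinates-exact : ∀ (x : Vec Bool n) → eval (all-coordinates n) (point x) ≈ fromBool (OR n x)
  all-coordinates-exact {n} x = trans (eval-1- _ (point x)) (trans
    (+-congˡ (-‿cong (eval-product (coordinates n) x))) (by-cases (lem {P = ∃[ i ] lookup x i ≡ true})))
    where
    all-false : ∀ {n} (x : Vec Bool n) → ¬ (∃[ i ] lookup x i ≡ true) → x ≡ replicate n false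
    all-false Vec.[]          ∄ = ≡.refl
    all-false (false Vec.∷ x) ∄ = ≡.cong (false Vec.∷_) (all-false x λ (i , e) → ∄ (suc i , e))
    all-false (true Vec.∷ x)  ∄ = contradiction (zero , ≡.refl) ∄
    by-cases : Dec (∃[ i ] lookup x i ≡ true) →
      1# - Vector.foldr _*_ 1# (λ i → 1# - apply (coordinates n i) x) ≈ fromBool (OR n x)
    by-cases (yes (i , e)) rewrite OR-nonzero x (λ x≡0 → case ≡.trans (≡.sym e) (≡.trans (≡.cong (λ y → lookup y i) x≡0) (lookup-replicate i false)) of λ ()) =
      trans (+-congˡ (trans (-‿cong (product-zero _ i (trans (+-congˡ (-‿cong (trans (apply-coordinate i x)
        (reflexive (≡.cong fromBool e))))) (-‿inverseʳ 1#)))) -0#≈0#)) (+-identityʳ 1#)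
    by-cases (no ∄) with ≡.refl ← all-false x ∄ rewrite OR-zero n =
      trans (+-congˡ (-‿cong (product-one _ λ i → trans (+-congˡ (trans (-‿cong (trans (apply-coordinate i x)
        (reflexive (≡.cong fromBool (lookup-replicate i false))))) -0#≈0#)) (+-identityʳ 1#)))) (-‿inverseʳ 1#)

-- Yao's principle from the axioms of probability

module Yao (lem : ∀ {ℓ} → ExcludedMiddle ℓ) (ℝ : CompleteOrderedField) where

  open CompleteOrderedField ℝ
  open Polynomials ℝ
  open Probability ℝ
  open ProbabilisticDegree ℝ
  open Field lem ℝ
  open Cube lem using (⟦_⟧; ⟦⟧-true; ⟦⟧-false; ⟦⟧-mono)
  open Scale lem ℝ using (Uncovered)
  open Cover lem ℝ using (uncovered-error; all-coordinates; all-coordinates-exact; coordinates)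
  open import Algebra.Solver.Ring.NaturalCoefficients.Default commutativeSemiring
    using (solve; _:+_; _:*_; _:=_)
  open import Data.Bool.Base using (Bool)
  open import Data.Empty using (⊥-elim)
  open import Data.Fin.Base using (zero; suc; toℕ)
  open import Data.List.Base as List using (List; []; _∷_; length)
  open import Data.List.Properties using (length-tabulate)
  open import Data.Nat.Base as ℕ using (ℕ; zero; suc)
  import Data.Nat.Properties as ℕ
  open import Data.Product.Base using (∃-syntax; Σ-syntax; _×_; _,_; proj₁; proj₂)
  open import Data.Unit.Base using (⊤; tt)
  open import Data.Vec.Base using (Vec)
  open import Data.Vec.Functional as Vector using (Vector)
  open import Function.Base using (_∘_)
  open import Function.Bundles using (mk⇔; Equivalence)
  open import Level using (0ℓ)
  open import Relation.Binary.Bundles using (Setoid)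
  open import Relation.Binary.PropositionalEquality as ≡ using (_≡_)
  open import Relation.Nullary using (Dec; ¬_; yes; no; contradiction)

  -- If s and v differed, taking their distance for δ would separate the eventual value v from s.
  hasSum-unique : ∀ {a s v N} → HasSum a s → (∀ m → N ℕ.≤ m → sum {m} (λ i → a (toℕ i)) ≈ v) → s ≈ v
  hasSum-unique {a} {s} {v} {N} has eventually = antisym
    (≮⇒≥ λ v<s → <⇒≱ (proj₁ (near (s - v) (positive v<s))) (≤-reflexive (sym (cancel s v))))
    (≮⇒≥ λ s<v → <⇒≱ (proj₂ (near (v - s) (positive s<v))) (≤-reflexive (trans (+-comm s _) (restore v s))))
    where
    positive : ∀ {x y} → x < y → 0# < y - x
    positive {x} x<y = ≤-<-trans (≤-reflexive (sym (-‿inverseʳ x))) (+-monoˡ-< (- x) x<y)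
    cancel : ∀ x y → x - (x - y) ≈ y
    cancel x y = trans (+-congˡ (trans (sym (-‿+-comm x (- y))) (+-congˡ (-‿involutive y))))
      (trans (sym (+-assoc x _ _)) (trans (+-congʳ (-‿inverseʳ x)) (+-identityˡ y)))
    near : ∀ δ → 0# < δ → s - δ < v × v < s + δ
    near δ 0<δ with has δ 0<δ
    ... | N′ , close with close (N ℕ.⊔ N′) (ℕ.m≤n⊔m N N′) | eventually (N ℕ.⊔ N′) (ℕ.m≤m⊔n N N′)
    ...   | above , below | e = <-≤-trans above (≤-reflexive e) , ≤-<-trans (≤-reflexive (sym e)) below

  sum-zero : ∀ {k} (v : Vector Carrier k) → (∀ i → v i ≈ 0#) → sum v ≈ 0#
  sum-zero {zero}  v e = refl
  sum-zero {suc k} v e = trans (+-cong (e zero) (sum-zero (Vector.tail v) (e ∘ suc))) (+-identityˡ 0#)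

  totalWeight : ∀ {X : Set} → List (ℕ × X) → ℕ
  totalWeight []             = 0
  totalWeight ((w , _) ∷ xs) = w ℕ.+ totalWeight xs

  module Measure {Ω : Setoid 0ℓ 0ℓ} (D : Distribution Ω) where
    open Distribution D
    private module Ω = Setoid Ω

    ∅ : Event Ω
    ∅ = ∁ whole

    both : Event Ω → Event Ω → Event Ω
    both E F = record
      { holds    = λ x → holds E x × holds F x
      ; respects = λ x≈y (Ex , Fx) → respects E x≈y Ex , respects F x≈y Fx
      }

    -- Pads two events with empty ones, so that the countable axioms yield finite unions and finite
    -- additivity.
    pair : Event Ω → Event Ω → ℕ → Event Ω
    pair E F 0             = E
    pair E F 1             = F
    pair E F (suc (suc _)) = ∅

    measurable-∅ : Measurable ∅
    measurable-∅ = measurable-∁ measurable-whole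

    measurable-pair : ∀ {E F} → Measurable E → Measurable F → ∀ k → Measurable (pair E F k)
    measurable-pair mE mF 0             = mE
    measurable-pair mE mF 1             = mF
    measurable-pair mE mF (suc (suc _)) = measurable-∅

    measurable-both : ∀ {E F} → Measurable E → Measurable F → Measurable (both E F)
    measurable-both {E} {F} mE mF = measurable-resp
      (λ x → mk⇔ (λ ¬∪ → by-cases (holds E x) (λ ¬E → ¬∪ (0 , ¬E)) , by-cases (holds F x) (λ ¬F → ¬∪ (1 , ¬F)))
                 (λ { (Ex , Fx) (0 , ¬E) → ¬E Ex ; (Ex , Fx) (1 , ¬F) → ¬F Fx
                    ; _ (suc (suc _) , ¬⊤) → ¬⊤ tt }))
      (measurable-∁ (measurable-⋃ (measurable-pair (measurable-∁ mE) (measurable-∁ mF))))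
      where
      by-cases : (P : Set) → ¬ ¬ P → P
      by-cases P ¬¬P with lem {P = P}
      ... | yes p = p
      ... | no ¬p = contradiction ¬p ¬¬P

    -- The constant sequence ∅ is disjoint, and a constant series only converges at 0.
    Pr-∅ : Pr ∅ ≈ 0#
    Pr-∅ with lem {P = Pr ∅ ≈ 0#}
    ... | yes p = p
    ... | no p≉0 = ⊥-elim (<⇒≱ (proj₂ (close (2 ℕ.+ N) (ℕ.m≤n+m N 2)))
                      (≤-trans (≤-respˡ-≈ (+-identityʳ _) (+-monoʳ-≤ (p + p) (sum-nonNeg N)))
                               (≤-reflexive (+-assoc p p _))))
      where
      p : Carrier
      p = Pr ∅
      0≤p : 0# ≤ p
      0≤p = Pr-nonNeg measurable-∅
      series : HasSum (λ _ → p) (Pr (⋃ (λ _ → ∅)))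
      series = Pr-additive (λ _ → measurable-∅) (λ _ _ ¬⊤ _ → ¬⊤ tt)
      ⋃∅≐∅ : ⋃ (λ _ → ∅) ≐ ∅
      ⋃∅≐∅ x = mk⇔ (λ (_ , ¬⊤) → ¬⊤) (λ ¬⊤ → 0 , ¬⊤)
      limit : Pr (⋃ (λ _ → ∅)) ≈ p
      limit = Pr-resp (measurable-⋃ (λ _ → measurable-∅)) ⋃∅≐∅
      N : ℕ
      N = proj₁ (series p (0≤p , p≉0 ∘ sym))
      close : ∀ m → N ℕ.≤ m → _ × sum {m} (λ _ → p) < p + p
      close m N≤m with proj₂ (series p (0≤p , p≉0 ∘ sym)) m N≤m
      ... | above , below = above , <-≤-trans below (≤-reflexive (+-congʳ limit))
      sum-nonNeg : ∀ k → 0# ≤ sum {k} (λ _ → p)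
      sum-nonNeg zero    = ≤-refl
      sum-nonNeg (suc k) = ≤-trans 0≤p (x≤x+y p (sum-nonNeg k))

    -- Countable additivity for the padded pair: `Pr-∅` makes the partial sums constant from index 2
    -- on.
    Pr-split : ∀ {E F} → Measurable E → Measurable F → Pr E ≈ Pr (both E F) + Pr (both E (∁ F))
    Pr-split {E} {F} mE mF = trans (sym (Pr-resp (measurable-⋃ measurable) ⋃≐E))
      (hasSum-unique {a = λ k → Pr (parts k)} {N = 2} (Pr-additive measurable disjoint) λ
        { (suc (suc m)) (ℕ.s≤s (ℕ.s≤s _)) →
          +-congˡ (trans (+-congˡ (sum-zero {m} _ (λ _ → Pr-∅))) (+-identityʳ _)) })
      where
      parts : ℕ → Event Ω
      parts = pair (both E F) (both E (∁ F))
      measurable : ∀ k → Measurable (parts k)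
      measurable = measurable-pair (measurable-both mE mF) (measurable-both mE (measurable-∁ mF))
      ⋃≐E : ⋃ parts ≐ E
      ⋃≐E x = mk⇔ (λ { (0 , Ex , _) → Ex ; (1 , Ex , _) → Ex ; (suc (suc _) , ¬⊤) → contradiction tt ¬⊤ })
                   (λ Ex → decide Ex (lem {P = holds F x}))
        where
        decide : holds E x → Dec (holds F x) → ∃[ k ] holds (parts k) x
        decide Ex (yes Fx) = 0 , Ex , Fx
        decide Ex (no ¬Fx) = 1 , Ex , ¬Fx
      disjoint : Disjoint parts
      disjoint {0} {0} i≢j = contradiction ≡.refl i≢j
      disjoint {0} {1} i≢j x (_ , Fx) (_ , ¬Fx) = ¬Fx Fx
      disjoint {1} {0} i≢j x (_ , ¬Fx) (_ , Fx) = ¬Fx Fx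
      disjoint {1} {1} i≢j = contradiction ≡.refl i≢j
      disjoint {suc (suc _)} i≢j x ¬⊤ = contradiction tt ¬⊤
      disjoint {0} {suc (suc _)} i≢j x _ ¬⊤ = ¬⊤ tt
      disjoint {1} {suc (suc _)} i≢j x _ ¬⊤ = ¬⊤ tt

    Pr-both-≤ : ∀ {E F} → Measurable E → Measurable F → Pr (both E F) ≤ Pr F
    Pr-both-≤ {E} {F} mE mF = ≤-trans
      (≤-reflexive (Pr-resp (measurable-both mE mF) λ x → mk⇔ (λ (e , f) → f , e) (λ (f , e) → e , f)))
      (≤-trans (x≤x+y _ (Pr-nonNeg (measurable-both mF (measurable-∁ mE))))
               (≤-reflexive (sym (Pr-split mF mE))))

    module _ {X : Set} (event : X → Event Ω) (measurable : ∀ x → Measurable (event x)) where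

      countᴺ : List (ℕ × X) → Ω.Carrier → ℕ
      countᴺ []             ω = 0
      countᴺ ((w , x) ∷ xs) ω = w ℕ.* ⟦ holds (event x) ω ⟧ ℕ.+ countᴺ xs ω

      -- Stands for the integral of `countᴺ` over `F`, written out by linearity so that no
      -- integration is involved.
      weightedPr : List (ℕ × X) → Event Ω → Carrier
      weightedPr []             F = 0#
      weightedPr ((w , x) ∷ xs) F = fromℕ w * Pr (both F (event x)) + weightedPr xs F

      weightedPr-split : ∀ xs {E F} → Measurable E → Measurable F →
        weightedPr xs E ≈ weightedPr xs (both E F) + weightedPr xs (both E (∁ F))
      weightedPr-split []             mE mF = sym (+-identityˡ 0#)
      weightedPr-split ((w , x) ∷ xs) {E} {F} mE mF = trans
        (+-cong (*-congˡ (trans (Pr-split (measurable-both mE (measurable x)) mF)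
          (+-cong (Pr-resp (measurable-both (measurable-both mE (measurable x)) mF) (swap F))
                  (Pr-resp (measurable-both (measurable-both mE (measurable x)) (measurable-∁ mF)) (swap (∁ F))))))
          (weightedPr-split xs mE mF))
        (solve 5 (λ w a b c d → w :* (a :+ b) :+ (c :+ d) := (w :* a :+ c) :+ (w :* b :+ d)) refl _ _ _ _ _)
        where
        swap : ∀ G → both (both E (event x)) G ≐ both (both E G) (event x)
        swap G y = mk⇔ (λ ((a , b) , c) → (a , c) , b) (λ ((a , c) , b) → (a , b) , c)

      -- Splitting F along the first event reduces to the remaining ones.
      expectation : ∀ xs {F} → Measurable F → ∀ s → (∀ ω → holds F ω → s ℕ.≤ countᴺ xs ω) →
                    fromℕ s * Pr F ≤ weightedPr xs F
      expectation [] {F} mF zero    _ = ≤-reflexive (zeroˡ _)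
      expectation [] {F} mF (suc s) s≤ = ≤-reflexive (trans (*-congˡ (trans
        (Pr-resp mF (λ ω → mk⇔ (λ Fω _ → contradiction (s≤ ω Fω) λ ()) (λ ¬⊤ → contradiction tt ¬⊤))) Pr-∅))
        (zeroʳ _))
      expectation ((w , x) ∷ xs) {F} mF s s≤ = begin
        fromℕ s * Pr F
          ≈⟨ trans (*-congˡ (Pr-split mF mE)) (distribˡ _ _ _) ⟩
        fromℕ s * Pr F₁ + fromℕ s * Pr F₀
          -- On F₁ the first event already contributes w. The bound s ≤ w + (s ∸ w) also covers w >
          -- s, where the difference truncates to 0.
          ≤⟨ +-monoˡ-≤ _ (*-monoˡ-≤ (Pr-nonNeg m₁) (≤-trans
               (fromℕ-mono-≤ (ℕ.m≤n+m∸n s w)) (≤-reflexive (fromℕ-+ w (s ℕ.∸ w))))) ⟩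
        (fromℕ w + fromℕ (s ℕ.∸ w)) * Pr F₁ + fromℕ s * Pr F₀
          ≈⟨ solve 5 (λ w s t p q → (w :+ s) :* p :+ t :* q := w :* p :+ (s :* p :+ t :* q)) refl _ _ _ _ _ ⟩
        fromℕ w * Pr F₁ + (fromℕ (s ℕ.∸ w) * Pr F₁ + fromℕ s * Pr F₀)
          ≤⟨ +-monoʳ-≤ _ (+-mono-≤
               (expectation xs m₁ (s ℕ.∸ w) λ ω (Fω , Eω) → ℕ.m≤n+o⇒m∸n≤o s w (ℕ.≤-trans (s≤ ω Fω)
                 (ℕ.+-monoˡ-≤ _ (ℕ.≤-reflexive (≡.trans (≡.cong (w ℕ.*_) (⟦⟧-true Eω)) (ℕ.*-identityʳ w))))))
               (expectation xs m₀ s λ ω (Fω , ¬Eω) → ℕ.≤-trans (s≤ ω Fω)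
                 (ℕ.≤-reflexive (≡.cong (ℕ._+ countᴺ xs ω) (≡.trans (≡.cong (w ℕ.*_) (⟦⟧-false ¬Eω)) (ℕ.*-zeroʳ w)))))) ⟩
        fromℕ w * Pr F₁ + (weightedPr xs F₁ + weightedPr xs F₀)
          ≈⟨ +-congˡ (sym (weightedPr-split xs mF mE)) ⟩
        fromℕ w * Pr F₁ + weightedPr xs F ∎
        where
        open ≤-Reasoning
        mE : Measurable (event x)
        mE = measurable x
        F₁ F₀ : Event Ω
        F₁ = both F (event x)
        F₀ = both F (∁ (event x))
        m₁ : Measurable F₁
        m₁ = measurable-both mF mE
        m₀ : Measurable F₀
        m₀ = measurable-both mF (measurable-∁ mE)

      weightedPr-≤ : ∀ {ε} → (∀ x → Pr (event x) ≤ ε) → ∀ xs {F} → Measurable F →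
                     weightedPr xs F ≤ fromℕ (totalWeight xs) * ε
      weightedPr-≤ Pr≤ε []             mF = ≤-reflexive (sym (zeroˡ _))
      weightedPr-≤ Pr≤ε ((w , x) ∷ xs) mF = ≤-trans
        (+-mono-≤ (*-monoʳ-≤ (0≤fromℕ w) (≤-trans (Pr-both-≤ mF (measurable x)) (Pr≤ε x))) (weightedPr-≤ Pr≤ε xs mF))
        (≤-reflexive (trans (sym (distribʳ _ _ _)) (*-congʳ (sym (fromℕ-+ w _)))))

  Sample : ℕ → Set
  Sample n = List (ℕ × Vec Bool n)

  weigh : ∀ {n} → Sample n → (Vec Bool n → ℕ) → ℕ
  weigh []             g = 0
  weigh ((w , x) ∷ xs) g = w ℕ.* g x ℕ.+ weigh xs g

  module _ {n : ℕ} where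

    -- `K` is a lower estimate of 1 / ε, and T is the total weight. If every list of forms failed,
    -- each polynomial of the support would have K times its error weight at least T + 1, whereas
    -- the mean of this quantity is at most K T ε ≤ T. Integrality provides the gap.
    yao : ∀ {ε d} → HasHcPDegreeAtMost ε (OR n) d → ∀ K → fromℕ K * ε ≤ 1# → (xs : Sample n) →
      Σ[ l ∈ List (LinearForm n) ] length l ℕ.≤ d ×
        K ℕ.* weigh xs (λ x → ⟦ Uncovered l x ⟧) ℕ.≤ weigh xs (λ _ → 1)
    yao {ε} {d} (D , error≤ε , S , mS , PrS , covering) K Kε≤1 xs
      with lem {P = Σ[ l ∈ List (LinearForm n) ] length l ℕ.≤ d ×
                      K ℕ.* weigh xs (λ x → ⟦ Uncovered l x ⟧) ℕ.≤ weigh xs (λ _ → 1)}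
    ... | yes found = found
    ... | no none   = contradiction (fromℕ-cancel-≤ contra) (ℕ.<⇒≱ (ℕ.n<1+n T))
      where
      open Distribution D
      open Measure D
      T : ℕ
      T = weigh xs (λ _ → 1)
      event : Vec Bool n → Event (polySetoid n)
      event = errorAt (OR n)
      measurable : ∀ x → Measurable (event x)
      measurable x = proj₁ (error≤ε x)
      scaled : Sample n
      scaled = List.map (λ (w , x) → K ℕ.* w , x) xs
      scaled-total : ∀ (xs : Sample n) → totalWeight (List.map (λ (w , x) → K ℕ.* w , x) xs) ≡ K ℕ.* weigh xs (λ _ → 1)
      scaled-total []             = ≡.sym (ℕ.*-zeroʳ K)
      scaled-total ((w , x) ∷ xs) = ≡.trans (≡.cong (K ℕ.* w ℕ.+_) (scaled-total xs))
        (≡.trans (≡.sym (ℕ.*-distribˡ-+ K w _)) (≡.cong (λ z → K ℕ.* (z ℕ.+ _)) (≡.sym (ℕ.*-identityʳ w))))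
      lower : ∀ (xs : Sample n) P l → (∀ x → Uncovered l x → holds (event x) P) →
        K ℕ.* weigh xs (λ x → ⟦ Uncovered l x ⟧) ℕ.≤
        countᴺ event measurable (List.map (λ (w , x) → K ℕ.* w , x) xs) P
      lower []             P l err = ℕ.≤-reflexive (ℕ.*-zeroʳ K)
      lower ((w , x) ∷ xs) P l err = ℕ.≤-trans
        (ℕ.≤-reflexive (≡.trans (ℕ.*-distribˡ-+ K _ _) (≡.cong (ℕ._+ K ℕ.* weigh xs (λ x → ⟦ Uncovered l x ⟧)) (≡.sym (ℕ.*-assoc K w _)))))
        (ℕ.+-mono-≤ (ℕ.*-monoʳ-≤ (K ℕ.* w) (⟦⟧-mono (err x))) (lower xs P l err))
      often : ∀ P → holds S P → suc T ℕ.≤ countᴺ event measurable scaled P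
      often P SP with covering P SP
      ... | t , t≤d , cover@(L , _) = ℕ.≤-trans
        (ℕ.≰⇒> λ good → none (List.tabulate L , ℕ.≤-trans (ℕ.≤-reflexive (length-tabulate L)) t≤d , good))
        (lower xs P (List.tabulate L) (uncovered-error P cover))
      open ≤-Reasoning
      contra : fromℕ (suc T) ≤ fromℕ T
      contra = begin
        fromℕ (suc T)                 ≈⟨ trans (*-congˡ PrS) (*-identityʳ _) ⟨
        fromℕ (suc T) * Pr S          ≤⟨ expectation event measurable scaled mS (suc T) often ⟩
        weightedPr event measurable scaled S
          ≤⟨ weightedPr-≤ event measurable (λ x → proj₂ (error≤ε x)) scaled mS ⟩
        fromℕ (totalWeight scaled) * ε
          ≈⟨ *-congʳ (trans (reflexive (≡.cong fromℕ (scaled-total xs))) (fromℕ-* K T)) ⟩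
        fromℕ K * fromℕ T * ε         ≈⟨ solve 3 (λ k t e → k :* t :* e := t :* (k :* e)) refl _ _ _ ⟩
        fromℕ T * (fromℕ K * ε)       ≤⟨ *-monoʳ-≤ (0≤fromℕ T) Kε≤1 ⟩
        fromℕ T * 1#                  ≈⟨ *-identityʳ _ ⟩
        fromℕ T                       ∎

  module _ {Ω : Setoid 0ℓ 0ℓ} where
    private module Ω = Setoid Ω

    mass : Ω.Carrier → Event Ω → Carrier
    mass ω E = fromℕ ⟦ holds E ω ⟧

    -- Excluded middle decides each event at ω, so all events are measurable; a disjoint sequence
    -- has at most one term of mass 1.
    dirac : Ω.Carrier → Distribution Ω
    dirac ω = record
      { Measurable       = λ _ → ⊤
      ; measurable-resp  = _
      ; measurable-whole = _
      ; measurable-∁     = _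
      ; measurable-⋃     = _
      ; Pr               = mass ω
      ; Pr-resp          = λ _ E≐F → reflexive (≡.cong fromℕ (ℕ.≤-antisym
          (⟦⟧-mono (Equivalence.to (E≐F ω))) (⟦⟧-mono (Equivalence.from (E≐F ω)))))
      ; Pr-nonNeg        = λ {E} _ → 0≤fromℕ ⟦ holds E ω ⟧
      ; Pr-whole         = trans (reflexive (≡.cong fromℕ (⟦⟧-true {P = ⊤} tt))) fromℕ-1
      ; Pr-additive      = λ {E} _ disjoint δ 0<δ → hasSum E disjoint δ 0<δ (lem {P = ∃[ k ] holds (E k) ω})
      }
      where
      at-most-one : ∀ (E : ℕ → Event Ω) k₀ → holds (E k₀) ω → Disjoint E → ∀ m → k₀ ℕ.< m →
                    sum {m} (λ i → mass ω (E (toℕ i))) ≈ fromℕ 1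
      at-most-one E zero     h disjoint (suc m) _ = trans (+-cong (reflexive (≡.cong fromℕ (⟦⟧-true h)))
        (sum-zero {m} _ λ i → reflexive (≡.cong fromℕ (⟦⟧-false (disjoint {0} {suc (toℕ i)} (λ ()) ω h)))))
        (+-identityʳ _)
      at-most-one E (suc k₀) h disjoint (suc m) (ℕ.s≤s k₀<m) = trans
        (+-cong (reflexive (≡.cong fromℕ (⟦⟧-false (λ E₀ → disjoint {0} {suc k₀} (λ ()) ω E₀ h))))
          (at-most-one (E ∘ suc) k₀ h (λ i≢j → disjoint (i≢j ∘ ℕ.suc-injective)) m k₀<m))
        (+-identityˡ _)
      close : ∀ {p s δ} → 0# < δ → p ≈ s → s - δ < p × p < s + δ
      close {p} {s} {δ} 0<δ p≈s =
        <-≤-trans (<-≤-trans (x<x+y (s - δ) 0<δ) (≤-reflexive (restore s δ))) (≤-reflexive (sym p≈s)) ,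
        ≤-<-trans (≤-reflexive p≈s) (x<x+y s 0<δ)
      hasSum : (E : ℕ → Event Ω) → Disjoint E → ∀ δ → 0# < δ → Dec (∃[ k ] holds (E k) ω) →
               ∃[ N ] ∀ m → N ℕ.≤ m → mass ω (⋃ E) - δ < sum {m} (λ i → mass ω (E (toℕ i))) ×
                                      sum {m} (λ i → mass ω (E (toℕ i))) < mass ω (⋃ E) + δ
      hasSum E disjoint δ 0<δ (yes (k₀ , h)) = suc k₀ , λ m k₀<m → close 0<δ
        (trans (at-most-one E k₀ h disjoint m k₀<m) (reflexive (≡.cong fromℕ (≡.sym (⟦⟧-true (k₀ , h))))))
      hasSum E disjoint δ 0<δ (no none) = 0 , λ m _ → close 0<δ
        (trans (sum-zero {m} _ λ i → reflexive (≡.cong fromℕ (⟦⟧-false λ h → none (toℕ i , h))))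
          (reflexive (≡.cong fromℕ (≡.sym (⟦⟧-false none)))))

  -- Ensures that the minimum defining `hcP-deg` exists, so that `least` does not return its default
  -- 0.
  degree-≤-n : ∀ n {ε} → 0# < ε → HasHcPDegreeAtMost ε (OR n) n
  degree-≤-n n 0<ε = dirac (all-coordinates n) ,
    (λ x → tt , ≤-trans (≤-reflexive (reflexive (≡.cong fromℕ (⟦⟧-false λ err → err (all-coordinates-exact x))))) (proj₁ 0<ε)) ,
    record { holds = λ P → all-coordinates n ≈ᴾ P ; respects = λ P≈Q p≈P → λ m → trans (p≈P m) (P≈Q m) } ,
    tt ,
    trans (reflexive (≡.cong fromℕ (⟦⟧-true (λ _ → refl)))) fromℕ-1 ,
    λ P p≈P → n , ℕ.≤-refl , coordinates n , λ m → sym (p≈P m)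

-- Averaging over the scales, and the counting bound

module Multi (lem : ∀ {ℓ} → ExcludedMiddle ℓ) (ℝ : CompleteOrderedField) where

  open Polynomials ℝ using (LinearForm)
  open ProbabilisticDegree ℝ using (HasHcPDegreeAtMost)
  open Cube lem
  open Degree lem ℝ using (deg-count)
  open Hits lem ℝ using (module ℝ; support)
  open Scale lem ℝ
  open Yao lem ℝ using (Sample; weigh; yao)

  open import Data.Bool.Base using (Bool; false; true)
  open import Data.Fin.Subset using (∣_∣)
  open import Data.List.Base using (List; []; _∷_; _++_; length; map)
  open import Data.Nat.Base
  open import Data.Nat.Properties
  open import Data.Nat.Tactic.RingSolver using (solve-∀)
  open import Data.Product.Base using (∃-syntax; _×_; _,_; proj₂)
  open import Data.Unit.Base using (⊤; tt)
  open import Data.Vec.Base using (Vec; []; _∷_; replicate)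
  open import Function.Base using (_∘_)
  open import Relation.Binary.PropositionalEquality hiding ([_])
  open import Relation.Nullary using (Dec; ¬_; yes; no; contradiction)

  private
    variable
      n : ℕ

  weigh-++ : ∀ (xs ys : Sample n) g → weigh (xs ++ ys) g ≡ weigh xs g + weigh ys g
  weigh-++ []             ys g = refl
  weigh-++ ((w , x) ∷ xs) ys g = trans (cong (w * g x +_) (weigh-++ xs ys g)) (sym (+-assoc (w * g x) _ _))

  weigh-map : ∀ {m} c (f : Vec Bool m → Vec Bool n) xs g →
              weigh (map (λ (w , x) → c * w , f x) xs) g ≡ c * weigh xs (g ∘ f)
  weigh-map c f []             g = sym (*-zeroʳ c)
  weigh-map c f ((w , x) ∷ xs) g = trans (cong₂ _+_ (*-assoc c w (g (f x))) (weigh-map c f xs g))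
    (sym (*-distribˡ-+ c (w * g (f x)) _))

  -- The biased measure as an explicit list for `yao`: a point weighs b to the number of its `false`
  -- bits.
  cube : ∀ {n} → ℕ → Sample n
  cube {zero}  b = (1 , []) ∷ []
  cube {suc n} b = map (λ (w , x) → b * w , false ∷ x) (cube b) ++ map (λ (w , x) → 1 * w , true ∷ x) (cube b)

  weigh-cube : ∀ b (g : Vec Bool n → ℕ) → weigh (cube b) g ≡ 𝕎 b g
  weigh-cube {zero}  b g = trans (+-identityʳ _) (*-identityˡ _)
  weigh-cube {suc n} b g = trans (weigh-++ (map (λ (w , x) → b * w , false ∷ x) (cube b)) _ g) (cong₂ _+_
    (trans (weigh-map b (false ∷_) (cube b) g) (cong (b *_) (weigh-cube b (g ∘ (false ∷_)))))
    (trans (weigh-map 1 (true ∷_) (cube b) g) (trans (*-identityˡ _) (weigh-cube b (g ∘ (true ∷_))))))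

  ratio>0 : ∀ d → 0 < ratio d
  ratio>0 d = <⇒≤ (2≤ratio d)

  -- 4096 (d + 1)⁴ ≤ 2^(12 + 4ℓ), and ℓ ≥ 1 absorbs the constant into 16ℓ.
  ratio≤ : ∀ d ℓ → 1 ≤ ℓ → suc d ≤ 2 ^ ℓ → ratio d ≤ 2 ^ (16 * ℓ)
  ratio≤ d ℓ 1≤ℓ 1+d≤ = ≤-trans (≤-reflexive (ratio-≡ d))
    (≤-trans (power≤ 4096 12 refl) (≤-reflexive (cong (2 ^_) (regroup ℓ))))
    where
    open ≤-Reasoning
    regroup : ∀ l → 12 * l + l * 4 ≡ 16 * l
    regroup = solve-∀
    power≤ : ∀ c h → c ≡ 2 ^ h → c * suc d ^ 4 ≤ 2 ^ (h * ℓ + ℓ * 4)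
    power≤ c h c≡ = begin
      c * suc d ^ 4             ≤⟨ *-monoʳ-≤ c (^-monoˡ-≤ 4 1+d≤) ⟩
      c * (2 ^ ℓ) ^ 4           ≡⟨ cong₂ _*_ c≡ (^-*-assoc 2 ℓ 4) ⟩
      2 ^ h * 2 ^ (ℓ * 4)       ≡⟨ ^-distribˡ-+-* 2 h (ℓ * 4) ⟨
      2 ^ (h + ℓ * 4)           ≤⟨ ^-monoʳ-≤ 2 (+-monoˡ-≤ (ℓ * 4)
                                     (≤-trans (≤-reflexive (sym (*-identityʳ h))) (*-monoʳ-≤ h 1≤ℓ))) ⟩
      2 ^ (h * ℓ + ℓ * 4)       ∎

  module _ (d : ℕ) where

    -- At s = Rʲ this is the `suc b` of `one-scale`: masks have density 1 / width j, and the true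
    -- bits of the point half of that.
    width : ℕ → ℕ
    width j = 8 * (suc d * ratio d ^ j)

    width>0 : ∀ j → 0 < width j
    width>0 j = *-mono-≤ {1} {8} (s≤s z≤n) (*-mono-≤ {1} {suc d} (s≤s z≤n)
      (m^n>0 (ratio d) {{>-nonZero (ratio>0 d)}} j))

    bias : ℕ → ℕ
    bias j = pred (width j)

    suc-bias : ∀ j → suc (bias j) ≡ width j
    suc-bias j = suc-pred (width j) {{>-nonZero (width>0 j)}}

    volume : ℕ → ℕ → ℕ
    volume n j = (2 + (bias j + bias j)) ^ n

    volume-suc : ∀ n j → ratio d ^ n * volume n j ≡ volume n (suc j)
    volume-suc n j = begin-equality
      ratio d ^ n * volume n j                        ≡⟨ ^-distrib-* n (ratio d) _ ⟨
      (ratio d * (2 + (bias j + bias j))) ^ n         ≡⟨ cong (λ z → (ratio d * z) ^ n) (double (bias j)) ⟩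
      (ratio d * (2 * suc (bias j))) ^ n              ≡⟨ cong (λ z → (ratio d * (2 * z)) ^ n) (suc-bias j) ⟩
      (ratio d * (2 * width j)) ^ n                   ≡⟨ cong (_^ n) (regroup (ratio d) 8 (suc d) (ratio d ^ j)) ⟩
      (2 * width (suc j)) ^ n                         ≡⟨ cong (λ z → (2 * z) ^ n) (suc-bias (suc j)) ⟨
      (2 * suc (bias (suc j))) ^ n                    ≡⟨ cong (_^ n) (double (bias (suc j))) ⟨
      volume n (suc j)                                ∎
      where
      open ≤-Reasoning
      double : ∀ b → 2 + (b + b) ≡ 2 * suc b
      double = solve-∀
      regroup : ∀ r e u p → r * (2 * (e * (u * p))) ≡ 2 * (e * (u * (r * p)))
      regroup = solve-∀

    -- The biased cubes at all scales, rescaled to the same total weight.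
    scales : ℕ → Sample n
    scales         zero    = []
    scales {n = n} (suc j) = map (λ (w , x) → ratio d ^ n * w , x) (scales j) ++ cube (suc (bias j + bias j))

    weigh-scales : ∀ j (g : Vec Bool n → ℕ) →
      weigh (scales (suc j)) g ≡ ratio d ^ n * weigh (scales j) g + 𝕎 (suc (bias j + bias j)) g
    weigh-scales {n} j g = trans (weigh-++ (map _ (scales j)) _ g)
      (cong₂ _+_ (weigh-map (ratio d ^ n) (λ x → x) (scales j) g) (weigh-cube (suc (bias j + bias j)) g))

    -- `scales j` is normalised to its last scale j - 1. The factor on the left lifts it to scale j,
    -- so that no predecessor appears.
    scales-total : ∀ n j → ratio d ^ n * weigh {n} (scales j) (λ _ → 1) ≡ j * volume n j
    scales-total n zero    = *-zeroʳ (ratio d ^ n)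
    scales-total n (suc j) = begin-equality
      ρ * weigh {n} (scales (suc j)) (λ _ → 1)          ≡⟨ cong (ρ *_) (weigh-scales j (λ _ → 1)) ⟩
      ρ * (ρ * weigh {n} (scales j) (λ _ → 1) + 𝕎 {n} (suc (bias j + bias j)) (λ _ → 1))
        ≡⟨ cong (ρ *_) (cong₂ _+_ (scales-total n j)
             (trans (𝕎-const n (suc (bias j + bias j)) 1) (*-identityʳ _))) ⟩
      ρ * (j * volume n j + volume n j)                 ≡⟨ regroup ρ j (volume n j) ⟩
      suc j * (ρ * volume n j)                          ≡⟨ cong (suc j *_) (volume-suc n j) ⟩
      suc j * volume n (suc j)                          ∎
      where
      open ≤-Reasoning
      ρ : ℕ
      ρ = ratio d ^ n
      regroup : ∀ r j v → r * (j * v + v) ≡ suc j * (r * v)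
      regroup = solve-∀

    mediums : ℕ → List (LinearForm n) → ℕ
    mediums zero    l = 0
    mediums (suc j) l = mediums j l + howMany (Medium d (ratio d ^ j)) l

    mediums-∷ : ∀ j (a : LinearForm n) l → mediums j (a ∷ l) ≡ mediums j (a ∷ []) + mediums j l
    mediums-∷ zero    a l = refl
    mediums-∷ (suc j) a l rewrite mediums-∷ j a l =
      regroup (mediums j (a ∷ [])) (mediums j l) ⟦ Medium d (ratio d ^ j) a ⟧ (howMany (Medium d (ratio d ^ j)) l)
      where
      regroup : ∀ p q r s → p + q + (r + s) ≡ p + (r + 0) + (q + s)
      regroup = solve-∀

    -- The windows (Rʲ, Rʲ⁺¹] are disjoint.
    mediums-single : ∀ j (a : LinearForm n) → mediums j (a ∷ []) ≤ ⟦ ∣ support a ∣ ≤ ratio d ^ j ⟧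
    mediums-single zero    a = z≤n
    mediums-single (suc j) a = ≤-trans (+-monoˡ-≤ _ (mediums-single j a)) (by-cases (∣ support a ∣ ≤? ratio d ^ j))
      where
      grow : ratio d ^ j ≤ ratio d ^ suc j
      grow = ≤-trans (≤-reflexive (sym (*-identityˡ (ratio d ^ j)))) (*-monoˡ-≤ (ratio d ^ j) (ratio>0 d))
      by-cases : Dec (∣ support a ∣ ≤ ratio d ^ j) →
        ⟦ ∣ support a ∣ ≤ ratio d ^ j ⟧ + (⟦ Medium d (ratio d ^ j) a ⟧ + 0) ≤ ⟦ ∣ support a ∣ ≤ ratio d ^ suc j ⟧
      by-cases (yes small)
        rewrite ⟦⟧-true small | ⟦⟧-true (≤-trans small grow)
              | ⟦⟧-false {P = Medium d (ratio d ^ j) a} (λ (big , _) → <⇒≱ big small) = ≤-refl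
      by-cases (no large)
        rewrite ⟦⟧-false large | +-identityʳ ⟦ Medium d (ratio d ^ j) a ⟧ = ⟦⟧-mono proj₂

    mediums≤ : ∀ j (l : List (LinearForm n)) → mediums j l ≤ length l
    mediums≤ j [] = ≤-reflexive (none j)
      where
      none : ∀ j → mediums j [] ≡ 0
      none zero    = refl
      none (suc j) = trans (+-identityʳ _) (none j)
    mediums≤ j (a ∷ l) = ≤-trans (≤-reflexive (mediums-∷ j a l)) (+-mono-≤
      (≤-trans (mediums-single j a) (⟦⟧-≤1 _)) (mediums≤ j l))

  1+n≤2^n : ∀ n → suc n ≤ 2 ^ n
  1+n≤2^n zero    = ≤-refl
  1+n≤2^n (suc n) = ≤-trans (s≤s (≤-trans (1+n≤2^n n) (≤-reflexive (sym (+-identityʳ _)))))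
    (+-monoˡ-≤ _ (m^n>0 2 n))

  log-floor : ∀ R → 2 ≤ R → ∀ m → 1 ≤ m → ∃[ j ] R ^ j ≤ m × m < R ^ suc j
  log-floor R 2≤R m 1≤m = search m (≤-trans (1+n≤2^n m) (^-monoˡ-≤ m 2≤R))
    where
    search : ∀ i → m < R ^ i → ∃[ j ] R ^ j ≤ m × m < R ^ suc j
    search zero    m<1   = contradiction 1≤m (<⇒≱ m<1)
    search (suc i) m<R^i with m <? R ^ i
    ... | yes smaller = search i smaller
    ... | no larger   = i , ≮⇒≥ larger , m<R^i

  -- 2⁻ᵐ is convex in m, hence at least 2⁻ᵏ (1 + k - m).
  tangent : ∀ k m A W → 3 * A ≤ 4 * 2 ^ m * W → 3 * (suc k * A) ≤ 4 * (2 ^ k * W) + 3 * (m * A)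
  tangent k m A W h with m ≤? k
  ... | no m≰k  = ≤-trans (*-monoʳ-≤ 3 (*-monoˡ-≤ A (≰⇒> m≰k))) (m≤n+m (3 * (m * A)) (4 * (2 ^ k * W)))
  ... | yes m≤k with e , refl ← m≤n⇒∃[o]m+o≡n m≤k = begin
    3 * (suc (m + e) * A)                     ≡⟨ r₁ m e A ⟩
    -- Here e = k - m, and convexity enters as e + 1 ≤ 2ᵉ.
    3 * A * suc e + 3 * (m * A)               ≤⟨ +-monoˡ-≤ _ (*-mono-≤ h (1+n≤2^n e)) ⟩
    4 * 2 ^ m * W * 2 ^ e + 3 * (m * A)       ≡⟨ cong (_+ 3 * (m * A)) (r₂ (2 ^ m) (2 ^ e) W) ⟩
    4 * (2 ^ m * 2 ^ e * W) + 3 * (m * A)     ≡⟨ cong (λ z → 4 * (z * W) + 3 * (m * A)) (^-distribˡ-+-* 2 m e) ⟨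
    4 * (2 ^ (m + e) * W) + 3 * (m * A)       ∎
    where
    open ≤-Reasoning
    r₁ : ∀ m e A → 3 * (suc (m + e) * A) ≡ 3 * A * suc e + 3 * (m * A)
    r₁ = solve-∀
    r₂ : ∀ p q W → 4 * p * W * q ≡ 4 * (p * q * W)
    r₂ = solve-∀

  -- The sum of `tangent` over the scales. Its linearity in the number of forms in a window is what
  -- lets the windows enter only through their total `mediums`.
  scales-bound : ∀ d k j (l : List (LinearForm n)) → length l ≤ d → ratio d ^ j ≤ n →
    3 * (j * (suc k * volume d n j)) ≤
    4 * (2 ^ k * (ratio d ^ n * weigh (scales d j) (λ x → ⟦ Uncovered l x ⟧))) + 3 * (mediums d j l * volume d n j)
  scales-bound d k zero l l≤d room = z≤n
  scales-bound {n} d k (suc j) l l≤d room = begin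
    3 * (suc j * (suc k * volume d n (suc j)))   ≡⟨ cong (λ z → 3 * (suc j * (suc k * z))) (volume-suc d n j) ⟨
    3 * (suc j * (suc k * (ρ * A)))              ≡⟨ r₁ j k ρ A ⟩
    ρ * (3 * (suc k * A) + 3 * (j * (suc k * A))) ≤⟨ *-monoʳ-≤ ρ (+-mono-≤
      (tangent k m A W (one-scale d (ratio d ^ j) (bias d j) l l≤d (suc-bias d j) room))
      (scales-bound d k j l l≤d (≤-trans grow room))) ⟩
    ρ * (4 * (2 ^ k * W) + 3 * (m * A) + (4 * (2 ^ k * (ρ * V)) + 3 * (mediums d j l * A)))
                                                 ≡⟨ r₂ ρ (2 ^ k) W m A V (mediums d j l) ⟩
    4 * (2 ^ k * (ρ * (ρ * V + W))) + 3 * ((mediums d j l + m) * (ρ * A))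
      ≡⟨ cong₂ (λ y z → 4 * (2 ^ k * (ρ * y)) + 3 * (mediums d (suc j) l * z))
           (sym (weigh-scales d j (λ x → ⟦ Uncovered l x ⟧))) (volume-suc d n j) ⟩
    4 * (2 ^ k * (ρ * weigh (scales d (suc j)) (λ x → ⟦ Uncovered l x ⟧))) +
      3 * (mediums d (suc j) l * volume d n (suc j)) ∎
    where
    open ≤-Reasoning
    ρ A m W V : ℕ
    ρ = ratio d ^ n
    A = volume d n j
    m = howMany (Medium d (ratio d ^ j)) l
    W = 𝕎 (suc (bias d j + bias d j)) (λ x → ⟦ Uncovered l x ⟧)
    V = weigh (scales d j) (λ x → ⟦ Uncovered l x ⟧)
    grow : ratio d ^ j ≤ ratio d ^ suc j
    grow = ≤-trans (≤-reflexive (sym (*-identityˡ (ratio d ^ j)))) (*-monoˡ-≤ (ratio d ^ j) (ratio>0 d))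
    r₁ : ∀ j k r A → 3 * (suc j * (suc k * (r * A))) ≡ r * (3 * (suc k * A) + 3 * (j * (suc k * A)))
    r₁ = solve-∀
    r₂ : ∀ r t W m A V q → r * (4 * (t * W) + 3 * (m * A) + (4 * (t * (r * V)) + 3 * (q * A))) ≡
                           4 * (t * (r * (r * V + W))) + 3 * ((q + m) * (r * A))
    r₂ = solve-∀

  module _ {ε d} (deg : HasHcPDegreeAtMost ε (OR n) d) (k : ℕ)
           (2^kε≤1 : ℝ.fromℕ (2 ^ k) ℝ.* ε ℝ.≤ ℝ.1#) where

    -- Disjointness of the windows gives mediums ≤ d, so Yao's bound turns `scales-bound` into 3j(k
    -- + 1) ≤ 4j + 3d; the excess j is at most jk.
    scales≤degree : 1 ≤ k → ∀ j → ratio d ^ j ≤ n → 2 * (j * k) ≤ 3 * d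
    scales≤degree 1≤k j room with l , l≤d , good ← yao deg (2 ^ k) 2^kε≤1 (scales d j) =
      +-cancelʳ-≤ (j * k) _ _ (begin
        2 * (j * k) + j * k   ≡⟨ r₀ (j * k) ⟩
        3 * (j * k)           ≤⟨ +-cancelʳ-≤ (3 * j) _ _ (*-cancelʳ-≤ _ _ A {{>-nonZero A>0}} main) ⟩
        3 * d + j             ≤⟨ +-monoʳ-≤ (3 * d) (≤-trans (≤-reflexive (sym (*-identityʳ j))) (*-monoʳ-≤ j 1≤k)) ⟩
        3 * d + j * k         ∎)
      where
      open ≤-Reasoning
      A ρ V : ℕ
      A = volume d n j
      ρ = ratio d ^ n
      V = weigh (scales d j) (λ x → ⟦ Uncovered l x ⟧)
      A>0 : 0 < A
      A>0 = m^n>0 (2 + (bias d j + bias d j)) n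
      main : (3 * (j * k) + 3 * j) * A ≤ (3 * d + j + 3 * j) * A
      main = begin
        (3 * (j * k) + 3 * j) * A                          ≡⟨ r₁ j k A ⟩
        3 * (j * (suc k * A))                              ≤⟨ scales-bound d k j l l≤d room ⟩
        4 * (2 ^ k * (ρ * V)) + 3 * (mediums d j l * A)    ≡⟨ cong (_+ 3 * (mediums d j l * A)) (r₂ (2 ^ k) ρ V) ⟩
        4 * (ρ * (2 ^ k * V)) + 3 * (mediums d j l * A)
          ≤⟨ +-mono-≤ (*-monoʳ-≤ 4 (*-monoʳ-≤ ρ good)) (*-monoʳ-≤ 3 (*-monoˡ-≤ A (≤-trans (mediums≤ d j l) l≤d))) ⟩
        4 * (ρ * weigh {n} (scales d j) (λ _ → 1)) + 3 * (d * A)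
          ≡⟨ cong (λ z → 4 * z + 3 * (d * A)) (scales-total d n j) ⟩
        4 * (j * A) + 3 * (d * A)                          ≡⟨ r₃ j d A ⟩
        (3 * d + j + 3 * j) * A                            ∎
        where
        r₁ : ∀ j k A → (3 * (j * k) + 3 * j) * A ≡ 3 * (j * (suc k * A))
        r₁ = solve-∀
        r₂ : ∀ t r V → 4 * (t * (r * V)) ≡ 4 * (r * (t * V))
        r₂ = solve-∀
        r₃ : ∀ j d A → 4 * (j * A) + 3 * (d * A) ≡ (3 * d + j + 3 * j) * A
        r₃ = solve-∀
      r₀ : ∀ x → 2 * x + x ≡ 3 * x
      r₀ = solve-∀

    𝕎-zero≤1 : ∀ n → 𝕎 {n} 1 (λ x → ⟦ x ≡ replicate n false ⟧) ≤ 1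
    𝕎-zero≤1 zero    = ⟦⟧-≤1 _
    𝕎-zero≤1 (suc n) = begin
      1 * 𝕎 {n} 1 (λ x → ⟦ false ∷ x ≡ replicate (suc n) false ⟧) + 𝕎 {n} 1 (λ x → ⟦ true ∷ x ≡ replicate (suc n) false ⟧)
        ≤⟨ +-mono-≤ (≤-trans (≤-reflexive (*-identityˡ _)) (𝕎-mono {n} 1 λ x → ⟦⟧-mono (λ { refl → refl })))
                    (𝕎-mono {n} 1 {g = λ _ → 0} λ x → ≤-reflexive (⟦⟧-false λ ())) ⟩
      𝕎 {n} 1 (λ x → ⟦ x ≡ replicate n false ⟧) + 𝕎 {n} 1 (λ _ → 0)
        ≡⟨ cong (𝕎 {n} 1 (λ x → ⟦ x ≡ replicate n false ⟧) +_) (trans (𝕎-const n 1 0) (*-zeroʳ (2 ^ n))) ⟩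
      𝕎 {n} 1 (λ x → ⟦ x ≡ replicate n false ⟧) + 0
        ≤⟨ ≤-trans (≤-reflexive (+-identityʳ _)) (𝕎-zero≤1 n) ⟩
      1 ∎
      where open ≤-Reasoning

    -- The product of all factors is nonzero at 2ⁿ⁻ᵈ points or more. All of them but the zero point
    -- are uncovered, and Yao's principle allows at most 2ⁿ⁻ᵏ uncovered points.
    uniform : 2 ^ k * 2 ^ n ≤ 2 ^ d * (2 ^ n + 2 ^ k)
    uniform with l , l≤d , good ← yao deg (2 ^ k) 2^kε≤1 (cube 1)
      with g , degree , g0≉0 , misses ← product-of {n = n} (λ _ → ⊤) l = begin
      2 ^ k * 2 ^ n                               ≤⟨ *-monoʳ-≤ (2 ^ k) (deg-count (howMany (λ _ → ⊤) l) g degree (_ , g0≉0)) ⟩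
      2 ^ k * (2 ^ howMany (λ _ → ⊤) l * 𝕎 1 (λ x → ⟦ ¬ g x ℝ.≈ ℝ.0# ⟧))
        ≤⟨ *-monoʳ-≤ (2 ^ k) (*-mono-≤ (^-monoʳ-≤ 2 (≤-trans (howMany≤ l) l≤d)) (𝕎-mono 1 pointwise)) ⟩
      2 ^ k * (2 ^ d * 𝕎 1 (λ x → ⟦ Uncovered l x ⟧ + ⟦ x ≡ replicate n false ⟧))
        ≡⟨ cong (λ z → 2 ^ k * (2 ^ d * z)) (𝕎-+ {n} 1 (λ x → ⟦ Uncovered l x ⟧) (λ x → ⟦ x ≡ replicate n false ⟧)) ⟩
      2 ^ k * (2 ^ d * (G + 𝕎 1 (λ x → ⟦ x ≡ replicate n false ⟧)))
        ≤⟨ *-monoʳ-≤ (2 ^ k) (*-monoʳ-≤ (2 ^ d) (+-monoʳ-≤ G (𝕎-zero≤1 n))) ⟩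
      2 ^ k * (2 ^ d * (G + 1))                   ≡⟨ regroup (2 ^ k) (2 ^ d) G ⟩
      2 ^ d * (2 ^ k * G + 2 ^ k)                 ≤⟨ *-monoʳ-≤ (2 ^ d) (+-monoˡ-≤ (2 ^ k) few) ⟩
      2 ^ d * (2 ^ n + 2 ^ k)                     ∎
      where
      open ≤-Reasoning
      G : ℕ
      G = 𝕎 1 (λ x → ⟦ Uncovered l x ⟧)
      regroup : ∀ t s G → t * (s * (G + 1)) ≡ s * (t * G + t)
      regroup = solve-∀
      few : 2 ^ k * G ≤ 2 ^ n
      few = ≤-trans (≤-reflexive (cong (2 ^ k *_) (sym (weigh-cube 1 (λ x → ⟦ Uncovered l x ⟧)))))
        (≤-trans good (≤-reflexive (trans (weigh-cube {n} 1 (λ _ → 1)) (trans (𝕎-const n 1 1) (*-identityʳ _)))))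
      howMany≤ : ∀ l → howMany {n} (λ _ → ⊤) l ≤ length l
      howMany≤ []      = z≤n
      howMany≤ (a ∷ l) = +-mono-≤ (⟦⟧-≤1 ⊤) (howMany≤ l)
      pointwise : ∀ x → ⟦ ¬ g x ℝ.≈ ℝ.0# ⟧ ≤ ⟦ Uncovered l x ⟧ + ⟦ x ≡ replicate n false ⟧
      pointwise x = ⟦⟧-≤ λ gx≉0 → by-cases gx≉0 (lem {P = x ≡ replicate n false})
        where
        by-cases : ¬ g x ℝ.≈ ℝ.0# → Dec (x ≡ replicate n false) →
                   1 ≤ ⟦ Uncovered l x ⟧ + ⟦ x ≡ replicate n false ⟧
        by-cases gx≉0 (yes x≡0) = ≤-trans (≤-reflexive (sym (⟦⟧-true x≡0))) (m≤n+m _ _)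
        by-cases gx≉0 (no x≢0)  = ≤-trans
          (≤-reflexive (sym (⟦⟧-true ((λ a a∈l → misses x gx≉0 a∈l tt) , x≢0)))) (m≤m+n _ _)

    -- For k ≤ n the zero point costs at most a factor 2 in `uniform`.
    k≤1+d : k ≤ n → k ≤ suc d
    k≤1+d k≤n = ≮⇒≥ λ 1+d<k → <⇒≱ (^-monoʳ-< 2 (s≤s (s≤s z≤n)) 1+d<k)
      (*-cancelʳ-≤ (2 ^ k) (2 ^ suc d) (2 ^ n) {{m^n≢0 2 n}} (begin
        2 ^ k * 2 ^ n             ≤⟨ uniform ⟩
        2 ^ d * (2 ^ n + 2 ^ k)   ≤⟨ *-monoʳ-≤ (2 ^ d) (+-monoʳ-≤ (2 ^ n) (^-monoʳ-≤ 2 k≤n)) ⟩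
        2 ^ d * (2 ^ n + 2 ^ n)   ≡⟨ regroup (2 ^ d) (2 ^ n) ⟩
        2 ^ suc d * 2 ^ n         ∎))
      where
      open ≤-Reasoning
      regroup : ∀ s t → s * (t + t) ≡ 2 * s * t
      regroup = solve-∀

    -- `k≤1+d` is void at k = 1. But d = 0 would turn `uniform` into pq ≤ q + p with p = 2ᵏ ≥ 2 and
    -- q = 2ⁿ ≥ 4.
    1≤d : 2 ≤ n → 1 ≤ k → 1 ≤ d
    1≤d 2≤n 1≤k = n≢0⇒n>0 λ d≡0 → <⇒≱ (large (^-monoʳ-≤ 2 1≤k) (^-monoʳ-≤ 2 2≤n))
      (≤-trans uniform (≤-reflexive (trans (cong (λ z → 2 ^ z * (2 ^ n + 2 ^ k)) d≡0) (*-identityˡ _))))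
      where
      open ≤-Reasoning
      large : ∀ {p q} → 2 ≤ p → 4 ≤ q → q + p < p * q
      large {p} {q} 2≤p 4≤q with e , refl ← m≤n⇒∃[o]m+o≡n 2≤p | f , refl ← m≤n⇒∃[o]m+o≡n 4≤q = begin-strict
        4 + f + (2 + e)                             <⟨ m≤m+n _ (1 + f + 3 * e + e * f) ⟩
        suc (4 + f + (2 + e)) + (1 + f + 3 * e + e * f) ≡⟨ regroup e f ⟩
        (2 + e) * (4 + f)                           ∎
        where
        regroup : ∀ e f → suc (4 + f + (2 + e)) + (1 + f + 3 * e + e * f) ≡ (2 + e) * (4 + f)
        regroup = solve-∀

    -- Take j maximal with Rʲ ≤ n, so that n + 1 ≤ Rʲ⁺¹. The scales pay jk ≤ 3d / 2, the uniform
    -- bound pays the last k ≤ d + 1 ≤ 2d, together (j + 1)k ≤ 4d; and R ≤ 2^(16ℓ).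
    suc-n^k≤ : 2 ≤ n → 1 ≤ k → k ≤ n → ∀ ℓ → suc d ≤ 2 ^ ℓ → suc n ^ k ≤ 2 ^ (64 * (d * ℓ))
    suc-n^k≤ 2≤n 1≤k k≤n ℓ 1+d≤2^ℓ = bound ℓ 1≤ℓ 1+d≤2^ℓ (log-floor (ratio d) (2≤ratio d) n (≤-trans (n≤1+n 1) 2≤n))
      where
      open ≤-Reasoning
      1≤ℓ : 1 ≤ ℓ
      1≤ℓ = n≢0⇒n>0 λ { refl → <⇒≱ 1+d≤2^ℓ (1≤d 2≤n 1≤k) }
      exponent : ∀ j → ratio d ^ j ≤ n → suc j * k ≤ 4 * d
      exponent j room = *-cancelˡ-≤ 2 (begin
        2 * (suc j * k)           ≡⟨ r₂ j k ⟩
        2 * (j * k) + 2 * k       ≤⟨ +-mono-≤ (scales≤degree 1≤k j room) (*-monoʳ-≤ 2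
                                       (≤-trans (k≤1+d k≤n) (+-monoˡ-≤ d (1≤d 2≤n 1≤k)))) ⟩
        3 * d + 2 * (d + d)       ≤⟨ m≤m+n _ d ⟩
        3 * d + 2 * (d + d) + d   ≡⟨ r₃ d ⟩
        2 * (4 * d)               ∎)
        where
        r₂ : ∀ j k → 2 * (suc j * k) ≡ 2 * (j * k) + 2 * k
        r₂ = solve-∀
        r₃ : ∀ d → 3 * d + 2 * (d + d) + d ≡ 2 * (4 * d)
        r₃ = solve-∀
      bound : ∀ ℓ → 1 ≤ ℓ → suc d ≤ 2 ^ ℓ → ∃[ j ] ratio d ^ j ≤ n × n < ratio d ^ suc j →
              suc n ^ k ≤ 2 ^ (64 * (d * ℓ))
      bound ℓ 1≤ℓ 1+d≤ (j , R^j≤n , n<R^1+j) = begin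
        suc n ^ k                        ≤⟨ ^-monoˡ-≤ k n<R^1+j ⟩
        (ratio d ^ suc j) ^ k            ≡⟨ ^-*-assoc (ratio d) (suc j) k ⟩
        ratio d ^ (suc j * k)            ≤⟨ ^-monoʳ-≤ (ratio d) {{>-nonZero (ratio>0 d)}} (exponent j R^j≤n) ⟩
        ratio d ^ (4 * d)                ≤⟨ ^-monoˡ-≤ (4 * d) (ratio≤ d ℓ 1≤ℓ 1+d≤) ⟩
        (2 ^ (16 * ℓ)) ^ (4 * d)         ≡⟨ ^-*-assoc 2 (16 * ℓ) (4 * d) ⟩
        2 ^ (16 * ℓ * (4 * d))           ≡⟨ cong (2 ^_) (r₁ ℓ d) ⟩
        2 ^ (64 * (d * ℓ))               ∎
        where
        r₁ : ∀ l d → 16 * l * (4 * d) ≡ 64 * (d * l)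
        r₁ = solve-∀

-- Binary logarithms as suprema, and binomial sums

module Log (lem : ∀ {ℓ} → ExcludedMiddle ℓ) (ℝ : CompleteOrderedField) where

  open CompleteOrderedField ℝ
  open Classical lem ℝ
  open Field lem ℝ
  open import Algebra.Solver.Ring.NaturalCoefficients.Default commutativeSemiring
    using (solve; _:+_; _:*_; _:=_; con)
  open import Data.Nat.Base as ℕ using (ℕ; zero; suc)
  open import Data.Nat.Combinatorics using (_C_; nC1≡n; nCk+nC[k+1]≡[n+1]C[k+1])
  open import Data.Nat.Induction using (<-rec)
  import Data.Nat.Properties as ℕ
  open import Data.Nat.Tactic.RingSolver using (solve-∀)
  open import Data.Bool.Base using (if_then_else_)
  open import Data.Fin.Base using (Fin; zero; suc; toℕ)
  open import Data.Fin.Properties using (toℕ<n)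
  open import Data.Product.Base using (∃; ∃-syntax; _×_; _,_; proj₁; proj₂)
  open import Data.Vec.Functional as Vector using (Vector)
  open import Function.Base using (_∘_)
  open import Level using (0ℓ) renaming (suc to lsuc)
  open import Relation.Binary.PropositionalEquality as ≡ using (_≡_)
  open import Relation.Nullary using (¬_; yes; no; does; contradiction)
  open import Relation.Unary using (Pred)

  sup-isSup : ∀ S → ∃ (IsSup S) → IsSup S (sup S)
  sup-isSup S exists with lem {P = ∃ (IsSup S)}
  ... | yes (_ , isSup) = isSup
  ... | no none         = contradiction exists none

  least-holds : ∀ {Q : ℕ → Set (lsuc 0ℓ)} d → Q d → Q (least Q)
  least-holds {Q} d Qd with lem {P = ∃[ d ] Q d × (∀ e → Q e → d ℕ.≤ e)}
  ... | yes (_ , Qm , _) = Qm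
  ... | no none          = contradiction Qd (<-rec (λ d → ¬ Q d) step d)
    where
    step : ∀ d → (∀ {e} → e ℕ.< d → ¬ Q e) → ¬ Q d
    step d below Qd = none (d , Qd , λ e Qe → ℕ.≮⇒≥ λ e<d → below e<d Qe)

  LogBelow : Carrier → Pred Carrier 0ℓ
  LogBelow y r = ∃[ a ] ∃[ b ] ∃[ q ]
    (0 ℕ.< q × r ≈ (fromℕ a - fromℕ b) / fromℕ q × fromℕ 2 ^ a ≤ y ^ q * fromℕ 2 ^ b)

  2^-cancel-≤ : ∀ a b → fromℕ 2 ^ a ≤ fromℕ 2 ^ b → a ℕ.≤ b
  2^-cancel-≤ a b p = ℕ.≮⇒≥ λ b<a → ℕ.<⇒≱ (ℕ.^-monoʳ-< 2 (ℕ.s≤s (ℕ.s≤s ℕ.z≤n)) b<a)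
    (fromℕ-cancel-≤ (≤-respˡ-≈ (sym (fromℕ-^ 2 a)) (≤-respʳ-≈ (sym (fromℕ-^ 2 b)) p)))

  0≤x^n : ∀ {x} → 0# ≤ x → ∀ n → 0# ≤ x ^ n
  0≤x^n 0≤x zero    = 0≤1
  0≤x^n 0≤x (suc n) = *-nonNeg 0≤x (0≤x^n 0≤x n)

  0≤2^ : ∀ n → 0# ≤ fromℕ 2 ^ n
  0≤2^ = 0≤x^n (0≤fromℕ 2)

  diff-≤ : ∀ {x y z} → x ≤ z + y → x - y ≤ z
  diff-≤ {x} {y} p = +-cancelʳ-≤ y (≤-respˡ-≈ (sym (restore x y)) p)

  module _ {y : Carrier} (1≤y : 1# ≤ y) where

    0≤y : 0# ≤ y
    0≤y = ≤-trans 0≤1 1≤y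

    log-upper : ∀ E → y ≤ fromℕ 2 ^ E → UpperBound (LogBelow y) (fromℕ E)
    log-upper E y≤2^E (a , b , q , 0<q , r≈ , 2^a≤) = ≤-respˡ-≈ (sym r≈)
      (/-≤ (0<fromℕ 0<q) (diff-≤ (≤-respʳ-≈ (trans (fromℕ-+ (E ℕ.* q) b) (+-congʳ (fromℕ-* E q)))
        (fromℕ-mono-≤ {a} {E ℕ.* q ℕ.+ b} (2^-cancel-≤ a (E ℕ.* q ℕ.+ b) (begin
          fromℕ 2 ^ a                         ≤⟨ 2^a≤ ⟩
          y ^ q * fromℕ 2 ^ b                 ≤⟨ *-monoˡ-≤ (0≤2^ b) (^-mono-≤ 0≤y y≤2^E q) ⟩
          (fromℕ 2 ^ E) ^ q * fromℕ 2 ^ b     ≈⟨ *-congʳ (^-assocʳ (fromℕ 2) E q) ⟩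
          fromℕ 2 ^ (E ℕ.* q) * fromℕ 2 ^ b   ≈⟨ ^-homo-* (fromℕ 2) (E ℕ.* q) b ⟨
          fromℕ 2 ^ (E ℕ.* q ℕ.+ b)           ∎))))))
      where open ≤-Reasoning

    -- 1 ≤ y puts 0 into the set, and y < E ≤ 2^E for some natural E bounds it, so `sup` does not
    -- fall back on its default.
    log-isSup : IsSup (LogBelow y) (log₂ y)
    log-isSup with E , y<E ← archimedean y = sup-isSup (LogBelow y) (complete (LogBelow y)
      (_ , 0 , 0 , 1 , ℕ.s≤s ℕ.z≤n , refl , ≤-trans 1≤y (≤-reflexive (sym (trans (*-identityʳ _) (*-identityʳ y)))))
      (fromℕ E , log-upper E (≤-trans (proj₁ y<E) (≤-trans (fromℕ-mono-≤ (n≤2^n E)) (≤-reflexive (fromℕ-^ 2 E))))))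
      where
      n≤2^n : ∀ n → n ℕ.≤ 2 ℕ.^ n
      n≤2^n zero    = ℕ.z≤n
      n≤2^n (suc n) = ℕ.≤-trans (ℕ.+-mono-≤ (ℕ.m^n>0 2 n) (n≤2^n n))
        (ℕ.≤-reflexive (≡.cong (2 ℕ.^ n ℕ.+_) (≡.sym (ℕ.+-identityʳ _))))

    log-≤ : ∀ E → y ≤ fromℕ 2 ^ E → log₂ y ≤ fromℕ E
    log-≤ E y≤2^E = proj₂ log-isSup (log-upper E y≤2^E)

    ≤-log : ∀ a q → 0 ℕ.< q → fromℕ 2 ^ a ≤ y ^ q → fromℕ a ≤ log₂ y * fromℕ q
    ≤-log a q 0<q 2^a≤ = begin
      fromℕ a                                ≈⟨ x/y*y (fromℕ a) (<⇒≉0 (0<fromℕ 0<q)) ⟨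
      fromℕ a / fromℕ q * fromℕ q            ≤⟨ *-monoˡ-≤ (0≤fromℕ q) (proj₁ log-isSup (a , 0 , q , 0<q ,
        *-congʳ (sym (trans (+-congˡ -0#≈0#) (+-identityʳ _))) , ≤-trans 2^a≤ (≤-reflexive (sym (*-identityʳ _))))) ⟩
      log₂ y * fromℕ q                       ∎
      where open ≤-Reasoning

    -- Bernoulli's inequality 1 + qδ/y ≤ (1 + δ/y)^q, multiplied by y^(q + 1).
    bernoulli : ∀ {δ} → 0# ≤ δ → ∀ q → y ^ q * (y + fromℕ q * δ) ≤ y * (y + δ) ^ q
    bernoulli {δ} 0≤δ zero = ≤-reflexive
      (trans (*-identityˡ _) (trans (+-congˡ (zeroˡ δ)) (trans (+-identityʳ y) (sym (*-identityʳ y)))))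
    bernoulli {δ} 0≤δ (suc q) = begin
      y * y ^ q * (y + (1# + fromℕ q) * δ)
        ≈⟨ solve 4 (λ y p d q → y :* p :* (y :+ (con 1 :+ q) :* d) := y :* (p :* (y :+ q :* d)) :+ y :* (d :* p))
             refl y (y ^ q) δ (fromℕ q) ⟩
      y * (y ^ q * (y + fromℕ q * δ)) + y * (δ * y ^ q)
        ≤⟨ +-mono-≤ (*-monoʳ-≤ 0≤y (bernoulli 0≤δ q))
                    (*-monoʳ-≤ 0≤y (*-monoʳ-≤ 0≤δ (^-mono-≤ 0≤y (x≤x+y y 0≤δ) q))) ⟩
      y * (y * (y + δ) ^ q) + y * (δ * (y + δ) ^ q)
        ≈⟨ solve 3 (λ y d p → y :* (y :* p) :+ y :* (d :* p) := y :* ((y :+ d) :* p)) refl y δ ((y + δ) ^ q) ⟩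
      y * ((y + δ) * (y + δ) ^ q) ∎
      where open ≤-Reasoning

    -- If y < 2ᵏ then 2 y^q ≤ 2^(kq) for some q, so log₂ y ≤ k - 1/q.
    2^-≤ : ∀ k → fromℕ k ≤ log₂ y → fromℕ 2 ^ k ≤ y
    2^-≤ k k≤log = ≮⇒≥ λ y<2^k → below y<2^k (archimedean (y / (fromℕ 2 ^ k - y)))
      where
      open ≤-Reasoning
      below : y < fromℕ 2 ^ k → ¬ (∃[ q ] y / (fromℕ 2 ^ k - y) < fromℕ q)
      below y<2^k (q , y/δ<q) = <⇒≱ u<k (≤-trans k≤log (proj₂ log-isSup upper))
        where
        δ : Carrier
        δ = fromℕ 2 ^ k - y
        0<δ : 0# < δ
        0<δ = ≤-<-trans (≤-reflexive (sym (-‿inverseʳ y))) (+-monoˡ-< (- y) y<2^k)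
        y+δ : y + δ ≈ fromℕ 2 ^ k
        y+δ = trans (+-comm y δ) (restore _ y)
        0<y : 0# < y
        0<y = <-≤-trans 0<1 1≤y
        0<q : 0 ℕ.< q
        0<q = ℕ.n≢0⇒n>0 λ { ≡.refl → <⇒≱ y/δ<q (*-nonNeg 0≤y (proj₁ (0<x⁻¹ 0<δ))) }
        y≤qδ : y ≤ fromℕ q * δ
        y≤qδ = ≤-respˡ-≈ (x/y*y y (<⇒≉0 0<δ)) (*-monoˡ-≤ (proj₁ 0<δ) (proj₁ y/δ<q))
        -- Since qδ ≥ y, Bernoulli bounds (y + δ)^q = 2^(kq) from below by 2 y^q.
        doubled : fromℕ 2 * y ^ q ≤ fromℕ 2 ^ (k ℕ.* q)
        doubled = *-cancelˡ-≤ 0<y (begin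
          y * (fromℕ 2 * y ^ q)           ≈⟨ solve 2 (λ y p → y :* ((con 1 :+ (con 1 :+ con 0)) :* p) := p :* (y :+ y)) refl y (y ^ q) ⟩
          y ^ q * (y + y)                 ≤⟨ *-monoʳ-≤ (0≤x^n 0≤y q) (+-monoʳ-≤ y y≤qδ) ⟩
          y ^ q * (y + fromℕ q * δ)       ≤⟨ bernoulli (proj₁ 0<δ) q ⟩
          y * (y + δ) ^ q                 ≈⟨ *-congˡ (trans (^-congˡ q y+δ) (^-assocʳ (fromℕ 2) k q)) ⟩
          y * fromℕ 2 ^ (k ℕ.* q)         ∎)
        Q u : Carrier
        Q = fromℕ q
        u = (fromℕ k * Q - 1#) / Q
        uQ+1 : u * Q + 1# ≈ fromℕ k * Q
        uQ+1 = trans (+-congʳ (x/y*y _ (<⇒≉0 (0<fromℕ 0<q)))) (restore _ 1#)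
        u<k : u < fromℕ k
        u<k = ≰⇒> λ k≤u → <⇒≱ (x<x+y (u * Q) 0<1) (≤-trans (≤-reflexive uQ+1) (*-monoˡ-≤ (0≤fromℕ q) k≤u))
        -- Raise 2^a ≤ y^q′ 2^b to the power q and multiply by 2^q′. By `doubled` the result is at
        -- most 2^(kqq′ + bq), and comparing exponents gives (a - b) / q′ ≤ k - 1/q = u.
        upper : UpperBound (LogBelow y) u
        upper (a , b , q′ , 0<q′ , r≈ , 2^a≤) = ≤-respˡ-≈ (sym r≈) (/-≤ (0<fromℕ 0<q′) (diff-≤
          (*-cancelˡ-≤ (0<fromℕ 0<q) (+-cancelʳ-≤ (fromℕ q′) (begin
            Q * fromℕ a + fromℕ q′                     ≈⟨ trans (fromℕ-+ (q ℕ.* a) q′) (+-congʳ (fromℕ-* q a)) ⟨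
            fromℕ (q ℕ.* a ℕ.+ q′)                     ≤⟨ fromℕ-mono-≤ {q ℕ.* a ℕ.+ q′} (2^-cancel-≤ (q ℕ.* a ℕ.+ q′) (k ℕ.* q ℕ.* q′ ℕ.+ b ℕ.* q) powers) ⟩
            fromℕ (k ℕ.* q ℕ.* q′ ℕ.+ b ℕ.* q)         ≈⟨ trans (fromℕ-+ (k ℕ.* q ℕ.* q′) _)
              (+-cong (trans (fromℕ-* (k ℕ.* q) q′) (*-congʳ (fromℕ-* k q))) (fromℕ-* b q)) ⟩
            fromℕ k * Q * fromℕ q′ + fromℕ b * Q       ≈⟨ +-congʳ (*-congʳ uQ+1) ⟨
            (u * Q + 1#) * fromℕ q′ + fromℕ b * Q
              ≈⟨ solve 4 (λ u Q p b → (u :* Q :+ con 1) :* p :+ b :* Q := Q :* (u :* p :+ b) :+ p) refl u Q (fromℕ q′) (fromℕ b) ⟩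
            Q * (u * fromℕ q′ + fromℕ b) + fromℕ q′    ∎)))))
          where
          powers : fromℕ 2 ^ (q ℕ.* a ℕ.+ q′) ≤ fromℕ 2 ^ (k ℕ.* q ℕ.* q′ ℕ.+ b ℕ.* q)
          powers = begin
            fromℕ 2 ^ (q ℕ.* a ℕ.+ q′)                        ≈⟨ ^-homo-* (fromℕ 2) (q ℕ.* a) q′ ⟩
            fromℕ 2 ^ (q ℕ.* a) * fromℕ 2 ^ q′                ≈⟨ *-congʳ (trans (^-congʳ (fromℕ 2) (ℕ.*-comm q a)) (sym (^-assocʳ (fromℕ 2) a q))) ⟩
            (fromℕ 2 ^ a) ^ q * fromℕ 2 ^ q′                  ≤⟨ *-monoˡ-≤ (0≤2^ q′) (^-mono-≤ (0≤2^ a) 2^a≤ q) ⟩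
            (y ^ q′ * fromℕ 2 ^ b) ^ q * fromℕ 2 ^ q′         ≈⟨ *-congʳ (^-distrib-* (y ^ q′) (fromℕ 2 ^ b) q) ⟩
            (y ^ q′) ^ q * (fromℕ 2 ^ b) ^ q * fromℕ 2 ^ q′   ≈⟨ *-congʳ (*-cong
              (trans (^-assocʳ y q′ q) (trans (^-congʳ y (ℕ.*-comm q′ q)) (sym (^-assocʳ y q q′))))
              (^-assocʳ (fromℕ 2) b q)) ⟩
            (y ^ q) ^ q′ * fromℕ 2 ^ (b ℕ.* q) * fromℕ 2 ^ q′
              ≈⟨ solve 3 (λ p r s → p :* r :* s := s :* p :* r) refl _ _ _ ⟩
            fromℕ 2 ^ q′ * (y ^ q) ^ q′ * fromℕ 2 ^ (b ℕ.* q) ≈⟨ *-congʳ (^-distrib-* (fromℕ 2) (y ^ q) q′) ⟨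
            (fromℕ 2 * y ^ q) ^ q′ * fromℕ 2 ^ (b ℕ.* q)
              ≤⟨ *-monoˡ-≤ (0≤2^ (b ℕ.* q)) (^-mono-≤ (*-nonNeg (0≤fromℕ 2) (0≤x^n 0≤y q)) doubled q′) ⟩
            (fromℕ 2 ^ (k ℕ.* q)) ^ q′ * fromℕ 2 ^ (b ℕ.* q)  ≈⟨ *-congʳ (^-assocʳ (fromℕ 2) (k ℕ.* q) q′) ⟩
            fromℕ 2 ^ (k ℕ.* q ℕ.* q′) * fromℕ 2 ^ (b ℕ.* q)  ≈⟨ ^-homo-* (fromℕ 2) (k ℕ.* q ℕ.* q′) (b ℕ.* q) ⟨
            fromℕ 2 ^ (k ℕ.* q ℕ.* q′ ℕ.+ b ℕ.* q)            ∎

  nCk≤n^k : ∀ n k → n C k ℕ.≤ n ℕ.^ k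
  nCk≤n^k n       zero    = ℕ.≤-refl
  nCk≤n^k zero    (suc k) = ℕ.z≤n
  nCk≤n^k (suc n) (suc k) = begin
    suc n C suc k                 ≡⟨ nCk+nC[k+1]≡[n+1]C[k+1] n k ⟨
    n C k ℕ.+ n C suc k           ≤⟨ ℕ.+-mono-≤ (nCk≤n^k n k) (nCk≤n^k n (suc k)) ⟩
    suc n ℕ.* n ℕ.^ k             ≤⟨ ℕ.*-monoʳ-≤ (suc n) (ℕ.^-monoˡ-≤ k (ℕ.n≤1+n n)) ⟩
    suc n ℕ.^ suc k               ∎
    where open ℕ.≤-Reasoning

  sumᴺ : ∀ {m} → Vector ℕ m → ℕ
  sumᴺ = Vector.foldr ℕ._+_ 0

  -- Split off the first term and move the factor `n` of the others into `A`; then A + A n (n + 1)^k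
  -- ≤ A (n + 1)^(k + 1) closes the induction.
  sum-geometric : ∀ m n A k (f : Vector ℕ m) → (∀ i → f i ℕ.≤ A ℕ.* n ℕ.^ toℕ i) →
                  (∀ i → k ℕ.< toℕ i → f i ≡ 0) → sumᴺ f ℕ.≤ A ℕ.* suc n ℕ.^ k
  sum-geometric zero    n A k       f f≤ tail = ℕ.z≤n
  sum-geometric (suc m) n A zero    f f≤ tail = ℕ.≤-trans (ℕ.+-mono-≤ (f≤ zero)
    (ℕ.≤-reflexive (sum-zeroᴺ m (f ∘ suc) λ i → tail (suc i) (ℕ.s≤s ℕ.z≤n)))) (ℕ.≤-reflexive (ℕ.+-identityʳ _))
    where
    sum-zeroᴺ : ∀ m (f : Vector ℕ m) → (∀ i → f i ≡ 0) → sumᴺ f ≡ 0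
    sum-zeroᴺ zero    f e = ≡.refl
    sum-zeroᴺ (suc m) f e = ≡.cong₂ ℕ._+_ (e zero) (sum-zeroᴺ m (f ∘ suc) (e ∘ suc))
  sum-geometric (suc m) n A (suc k) f f≤ tail = begin
    f zero ℕ.+ sumᴺ (f ∘ suc)                          ≤⟨ ℕ.+-mono-≤ (f≤ zero) (sum-geometric m n (A ℕ.* n) k (f ∘ suc)
      (λ i → ℕ.≤-trans (f≤ (suc i)) (ℕ.≤-reflexive (≡.sym (ℕ.*-assoc A n _)))) (λ i k<i → tail (suc i) (ℕ.s≤s k<i))) ⟩
    A ℕ.* 1 ℕ.+ A ℕ.* n ℕ.* suc n ℕ.^ k                ≤⟨ ℕ.+-monoˡ-≤ _ (ℕ.*-monoʳ-≤ A (ℕ.m^n>0 (suc n) k)) ⟩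
    A ℕ.* suc n ℕ.^ k ℕ.+ A ℕ.* n ℕ.* suc n ℕ.^ k      ≡⟨ regroup A n (suc n ℕ.^ k) ⟩
    A ℕ.* suc n ℕ.^ suc k                              ∎
    where
    open ℕ.≤-Reasoning
    regroup : ∀ A n p → A ℕ.* p ℕ.+ A ℕ.* n ℕ.* p ≡ A ℕ.* (suc n ℕ.* p)
    regroup = solve-∀

  binom≤-upper : ∀ n {α} k → (∀ i → i ℕ.≤ n → fromℕ i ≤ α → i ℕ.≤ k) → binom≤ n α ℕ.≤ suc n ℕ.^ k
  binom≤-upper n {α} k maximal = ℕ.≤-trans (sum-geometric (suc n) n 1 k _ term≤ beyond) (ℕ.≤-reflexive (ℕ.*-identityˡ _))
    where
    term : Fin (suc n) → ℕ
    term i = if does (lem {P = fromℕ (toℕ i) ≤ α}) then n C toℕ i else 0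
    term≤ : ∀ i → term i ℕ.≤ 1 ℕ.* n ℕ.^ toℕ i
    term≤ i with lem {P = fromℕ (toℕ i) ≤ α}
    ... | yes _ = ℕ.≤-trans (nCk≤n^k n (toℕ i)) (ℕ.≤-reflexive (≡.sym (ℕ.*-identityˡ _)))
    ... | no _  = ℕ.z≤n
    beyond : ∀ i → k ℕ.< toℕ i → term i ≡ 0
    beyond i k<i with lem {P = fromℕ (toℕ i) ≤ α}
    ... | yes i≤α = contradiction (maximal (toℕ i) (ℕ.s≤s⁻¹ (toℕ<n i)) i≤α) (ℕ.<⇒≱ k<i)
    ... | no _    = ≡.refl

  binom≤-lower : ∀ n {α} → 1 ℕ.≤ n → 1# ≤ α → suc n ℕ.≤ binom≤ n α
  binom≤-lower (suc n) {α} _ 1≤α with lem {P = fromℕ 0 ≤ α} | lem {P = fromℕ 1 ≤ α}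
  ... | no 0≰α | _       = contradiction (≤-trans 0≤1 1≤α) 0≰α
  ... | yes _  | no 1≰α  = contradiction (≤-trans (≤-reflexive fromℕ-1) 1≤α) 1≰α
  ... | yes _  | yes _   = ℕ.s≤s (ℕ.≤-trans (ℕ.≤-reflexive (≡.sym (nC1≡n (suc n)))) (ℕ.m≤m+n _ _))

  -- The integer part of min(n, α): the binomial sum stops at `n`, and k ≤ n is what `k≤1+d` asks
  -- for.
  floor : ∀ n {α} → 1 ℕ.≤ n → 1# ≤ α →
    ∃[ k ] 1 ℕ.≤ k × k ℕ.≤ n × fromℕ k ≤ α × (∀ i → i ℕ.≤ n → fromℕ i ≤ α → i ℕ.≤ k)
  floor (suc zero)      _ 1≤α =
    1 , ℕ.≤-refl , ℕ.≤-refl , ≤-trans (≤-reflexive fromℕ-1) 1≤α , λ _ i≤1 _ → i≤1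
  floor (suc n@(suc m)) {α} _ 1≤α with lem {P = fromℕ (suc n) ≤ α} | floor n {α} (ℕ.s≤s ℕ.z≤n) 1≤α
  ... | yes k≤α | _ = suc n , ℕ.s≤s ℕ.z≤n , ℕ.≤-refl , k≤α , λ _ i≤n _ → i≤n
  ... | no k≰α  | k , 1≤k , k≤n , k≤α , maximal =
    k , 1≤k , ℕ.m≤n⇒m≤1+n k≤n , k≤α , λ i i≤ i≤α →
      maximal i (ℕ.s≤s⁻¹ (ℕ.≤∧≢⇒< i≤ λ { ≡.refl → k≰α i≤α })) i≤α

-- From the counting bound to the logarithmic bound

module Main (lem : ∀ {ℓ} → ExcludedMiddle ℓ) (ℝ : CompleteOrderedField) where

  open CompleteOrderedField ℝ
  open ProbabilisticDegree ℝ using (HasHcPDegreeAtMost)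
  open Classical lem ℝ
  open Field lem ℝ
  open Log lem ℝ
  open Yao lem ℝ using (degree-≤-n)
  open Multi lem ℝ using (log-floor; 1≤d; suc-n^k≤)
  open import Algebra.Solver.Ring.NaturalCoefficients.Default commutativeSemiring
    using (solve; _:*_; _:=_; con)
  open import Data.Nat.Base using (zero; suc; z≤n; s≤s)
  import Data.Nat.Properties as ℕ
  open import Data.Nat.Tactic.RingSolver using (solve-∀)
  open import Data.Product.Base using (proj₁)
  open import Data.Sum.Base using (inj₁; inj₂)
  open import Relation.Binary.PropositionalEquality as ≡ using (_≡_)

  1≤fromℕ : ∀ {k} → 1 ℕ.≤ k → 1# ≤ fromℕ k
  1≤fromℕ 1≤k = ≤-trans (≤-reflexive (sym fromℕ-1)) (fromℕ-mono-≤ 1≤k)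

  -- With μ = log Λ the conclusion is Λ ≤ 256 d μ²: this is clear when Λ ≤ d, and
  -- otherwise 2ᵉ ≤ d gives μ ≥ max (1/2, e), which absorbs the factor e + 1.
  trade-off : ∀ {Λ} d e → 1# ≤ Λ → fromℕ 3 ≤ Λ * fromℕ 2 → 2 ℕ.^ e ℕ.≤ d →
              Λ ≤ fromℕ (64 ℕ.* (d ℕ.* suc e)) →
              Λ ≤ fromℕ 256 * fromℕ d * log₂ Λ ^ 2 × 0# < log₂ Λ
  trade-off {Λ} d e 1≤Λ 3≤2Λ 2^e≤d Λ≤ = conclusion , <-≤-trans 0<1/2 1/2≤μ
    where
    open ≤-Reasoning
    μ : Carrier
    μ = log₂ Λ
    Δ : Carrier
    Δ = fromℕ d
    -- Λ ≥ 3/2 gives Λ² ≥ 9/4 ≥ 2, hence μ ≥ 1/2; in particular the denominator μ² is positive.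
    1≤2μ : fromℕ 1 ≤ μ * fromℕ 2
    1≤2μ = ≤-log 1≤Λ 1 2 (s≤s z≤n) (*-cancelˡ-≤ (0<fromℕ {4} (s≤s z≤n)) (begin
      fromℕ 4 * fromℕ 2 ^ 1             ≈⟨ *-congˡ (fromℕ-^ 2 1) ⟨
      fromℕ 4 * fromℕ 2                 ≈⟨ fromℕ-* 4 2 ⟨
      fromℕ 8                           ≤⟨ fromℕ-mono-≤ (ℕ.n≤1+n 8) ⟩
      fromℕ 9                           ≈⟨ fromℕ-* 3 3 ⟩
      fromℕ 3 * fromℕ 3                 ≤⟨ *-mono-≤ (≤-trans (0≤fromℕ 3) 3≤2Λ) (0≤fromℕ 3) 3≤2Λ 3≤2Λ ⟩
      Λ * fromℕ 2 * (Λ * fromℕ 2)       ≈⟨ solve 2 (λ l t → l :* t :* (l :* t) := t :* t :* (l :* (l :* con 1))) refl Λ (fromℕ 2) ⟩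
      fromℕ 2 * fromℕ 2 * Λ ^ 2         ≈⟨ *-congʳ (fromℕ-* 2 2) ⟨
      fromℕ 4 * Λ ^ 2                   ∎))
    1/2≤μ : 1# / fromℕ 2 ≤ μ
    1/2≤μ = /-≤ (0<fromℕ {2} (s≤s z≤n)) (≤-trans (≤-reflexive (sym fromℕ-1)) 1≤2μ)
    0<1/2 : 0# < 1# / fromℕ 2
    0<1/2 = 0<x*y 0<1 (0<x⁻¹ (0<fromℕ {2} (s≤s z≤n)))
    1≤4μ² : 1# ≤ fromℕ 4 * μ ^ 2
    1≤4μ² = begin
      1#                                ≈⟨ *-identityˡ 1# ⟨
      1# * 1#                           ≤⟨ *-mono-≤ (≤-trans 0≤1 1≤2μ′) 0≤1 1≤2μ′ 1≤2μ′ ⟩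
      μ * fromℕ 2 * (μ * fromℕ 2)       ≈⟨ solve 2 (λ l t → l :* t :* (l :* t) := t :* t :* (l :* (l :* con 1))) refl μ (fromℕ 2) ⟩
      fromℕ 2 * fromℕ 2 * μ ^ 2         ≈⟨ *-congʳ (fromℕ-* 2 2) ⟨
      fromℕ 4 * μ ^ 2                   ∎
      where
      1≤2μ′ : 1# ≤ μ * fromℕ 2
      1≤2μ′ = ≤-trans (≤-reflexive (sym fromℕ-1)) 1≤2μ
    -- For e ≥ 1 this is e + 1 ≤ 4e² ≤ 4μ², while e = 0 rests on μ ≥ 1/2.
    absorb-e : ∀ e → fromℕ e ≤ μ → fromℕ (suc e) ≤ fromℕ 4 * μ ^ 2
    absorb-e zero    _   = ≤-trans (≤-reflexive fromℕ-1) 1≤4μ²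
    absorb-e (suc e) e≤μ = begin
      fromℕ (2 ℕ.+ e)                           ≤⟨ fromℕ-mono-≤ (ℕ.≤-trans (ℕ.m≤m+n (2 ℕ.+ e) (2 ℕ.+ 7 ℕ.* e ℕ.+ 4 ℕ.* (e ℕ.* e))) (ℕ.≤-reflexive (square e))) ⟩
      fromℕ (4 ℕ.* (suc e ℕ.* (suc e ℕ.* 1)))   ≈⟨ trans (fromℕ-* 4 (suc e ℕ.* (suc e ℕ.* 1))) (*-congˡ (fromℕ-^ (suc e) 2)) ⟩
      fromℕ 4 * fromℕ (suc e) ^ 2               ≤⟨ *-monoʳ-≤ (0≤fromℕ 4) (^-mono-≤ (0≤fromℕ (suc e)) e≤μ 2) ⟩
      fromℕ 4 * μ ^ 2                           ∎
      where
      square : ∀ e → 2 ℕ.+ e ℕ.+ (2 ℕ.+ 7 ℕ.* e ℕ.+ 4 ℕ.* (e ℕ.* e)) ≡ 4 ℕ.* (suc e ℕ.* (suc e ℕ.* 1))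
      square = solve-∀
    regroup : fromℕ 64 * (Δ * (fromℕ 4 * μ ^ 2)) ≈ fromℕ 256 * Δ * μ ^ 2
    regroup = trans (solve 4 (λ s d f m → s :* (d :* (f :* m)) := s :* f :* d :* m) refl _ _ _ _)
      (*-congʳ (*-congʳ (sym (fromℕ-* 64 4))))
    conclusion : Λ ≤ fromℕ 256 * Δ * μ ^ 2
    conclusion with total Λ Δ
    ... | inj₁ Λ≤d = begin
      Λ                                         ≤⟨ Λ≤d ⟩
      Δ                                         ≈⟨ trans (*-identityˡ _) (*-identityʳ Δ) ⟨
      1# * (Δ * 1#)                             ≤⟨ *-mono-≤ (0≤fromℕ 64) (*-nonNeg (0≤fromℕ d) 0≤1)
                                                     (1≤fromℕ {64} (s≤s z≤n)) (*-monoʳ-≤ (0≤fromℕ d) 1≤4μ²) ⟩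
      fromℕ 64 * (Δ * (fromℕ 4 * μ ^ 2))        ≈⟨ regroup ⟩
      fromℕ 256 * Δ * μ ^ 2                     ∎
    ... | inj₂ d≤Λ = begin
      Λ                                         ≤⟨ Λ≤ ⟩
      fromℕ (64 ℕ.* (d ℕ.* suc e))              ≈⟨ trans (fromℕ-* 64 (d ℕ.* suc e)) (*-congˡ (fromℕ-* d (suc e))) ⟩
      fromℕ 64 * (Δ * fromℕ (suc e))            ≤⟨ *-monoʳ-≤ (0≤fromℕ 64) (*-monoʳ-≤ (0≤fromℕ d) (absorb-e e e≤μ)) ⟩
      fromℕ 64 * (Δ * (fromℕ 4 * μ ^ 2))        ≈⟨ regroup ⟩
      fromℕ 256 * Δ * μ ^ 2                     ∎
      where
      e≤μ : fromℕ e ≤ μ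
      e≤μ = ≤-trans (≤-log 1≤Λ e 1 (s≤s z≤n) (begin
        fromℕ 2 ^ e         ≈⟨ fromℕ-^ 2 e ⟨
        fromℕ (2 ℕ.^ e)     ≤⟨ fromℕ-mono-≤ 2^e≤d ⟩
        Δ                   ≤⟨ d≤Λ ⟩
        Λ                   ≈⟨ *-identityʳ Λ ⟨
        Λ ^ 1               ∎)) (≤-reflexive (trans (*-congˡ fromℕ-1) (*-identityʳ μ)))

  0<256 : 0# < fromℕ 256
  0<256 = 0<fromℕ {256} (s≤s z≤n)

  from-counting : ∀ {n ε d N} k → HasHcPDegreeAtMost ε (OR n) d → 2 ℕ.≤ n →
    fromℕ (2 ℕ.^ k) * ε ≤ 1# → 1 ℕ.≤ k → k ℕ.≤ n → 3 ℕ.≤ N → N ℕ.≤ suc n ℕ.^ k →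
    fromℕ 256 ⁻¹ * (log₂ (fromℕ N) / (log₂ (log₂ (fromℕ N)) ^ 2)) ≤ fromℕ d
  from-counting {n} {ε} {d} {N} k degree 2≤n 2^kε≤1 1≤k k≤n 3≤N N≤ =
    conclude (log-floor 2 ℕ.≤-refl d (1≤d degree k 2^kε≤1 2≤n 1≤k))
    where
    open ≤-Reasoning
    Λ : Carrier
    Λ = log₂ (fromℕ N)
    1≤N : 1# ≤ fromℕ N
    1≤N = 1≤fromℕ (ℕ.≤-trans (s≤s z≤n) 3≤N)
    -- N ≥ 3 gives N² ≥ 9 ≥ 2³; the bound 3/2 instead of 1 keeps log Λ away from 0.
    3≤2Λ : fromℕ 3 ≤ Λ * fromℕ 2
    3≤2Λ = ≤-log 1≤N 3 2 (s≤s z≤n) (begin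
      fromℕ 2 ^ 3           ≈⟨ fromℕ-^ 2 3 ⟨
      fromℕ 8               ≤⟨ fromℕ-mono-≤ (ℕ.≤-trans (ℕ.n≤1+n 8) (ℕ.^-monoˡ-≤ 2 3≤N)) ⟩
      fromℕ (N ℕ.^ 2)       ≈⟨ fromℕ-^ N 2 ⟩
      fromℕ N ^ 2           ∎)
    1≤Λ : 1# ≤ Λ
    1≤Λ = *-cancelˡ-≤ (0<fromℕ {2} (s≤s z≤n)) (begin
      fromℕ 2 * 1#      ≈⟨ *-identityʳ _ ⟩
      fromℕ 2           ≤⟨ fromℕ-mono-≤ (ℕ.n≤1+n 2) ⟩
      fromℕ 3           ≤⟨ 3≤2Λ ⟩
      Λ * fromℕ 2       ≈⟨ *-comm Λ _ ⟩
      fromℕ 2 * Λ       ∎)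
    Λ≤ : ∀ ℓ → suc d ℕ.≤ 2 ℕ.^ ℓ → Λ ≤ fromℕ (64 ℕ.* (d ℕ.* ℓ))
    Λ≤ ℓ 1+d≤ = log-≤ 1≤N (64 ℕ.* (d ℕ.* ℓ)) (≤-trans
      (fromℕ-mono-≤ (ℕ.≤-trans N≤ (suc-n^k≤ degree k 2^kε≤1 2≤n 1≤k k≤n ℓ 1+d≤)))
      (≤-reflexive (fromℕ-^ 2 (64 ℕ.* (d ℕ.* ℓ)))))
    divide : Λ ≤ fromℕ 256 * fromℕ d * log₂ Λ ^ 2 × 0# < log₂ Λ →
             fromℕ 256 ⁻¹ * (Λ / (log₂ Λ ^ 2)) ≤ fromℕ d
    divide (Λ≤256dμ² , 0<μ) = begin
      fromℕ 256 ⁻¹ * (Λ / (log₂ Λ ^ 2))      ≤⟨ *-monoʳ-≤ (proj₁ (0<x⁻¹ 0<256)) (/-≤ (0<x^n 0<μ 2) Λ≤256dμ²) ⟩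
      fromℕ 256 ⁻¹ * (fromℕ 256 * fromℕ d)   ≈⟨ x⁻¹*[x*y] (<⇒≉0 0<256) (fromℕ d) ⟩
      fromℕ d                                ∎
    conclude : ∃[ e ] 2 ℕ.^ e ℕ.≤ d × d ℕ.< 2 ℕ.^ suc e →
               fromℕ 256 ⁻¹ * (Λ / (log₂ Λ ^ 2)) ≤ fromℕ d
    -- The strict d < 2^(e + 1) is d + 1 ≤ 2^ℓ for ℓ = e + 1.
    conclude (e , 2^e≤d , d<2^1+e) = divide (trade-off d e 1≤Λ 3≤2Λ 2^e≤d (Λ≤ (suc e) d<2^1+e))

  lower-bound : ∀ n → 2 ℕ.≤ n → ∀ ε → 0# < ε → ε < 1# / fromℕ 3 →
    let B = fromℕ (binom≤ n (log₂ (1# / ε))) in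
    fromℕ 256 ⁻¹ * (log₂ B / (log₂ (log₂ B) ^ 2)) ≤ fromℕ (hcP-deg ε (OR n))
  lower-bound n 2≤n ε 0<ε ε<1/3 = conclude (floor n 1≤n 1≤α)
    where
    open ≤-Reasoning
    y α : Carrier
    y = 1# / ε
    α = log₂ y
    1≤n : 1 ℕ.≤ n
    1≤n = ℕ.≤-trans (ℕ.n≤1+n 1) 2≤n
    3≤y : fromℕ 3 ≤ y
    3≤y = ≤-/ 0<ε (≤-trans (*-monoʳ-≤ (0≤fromℕ 3) (proj₁ ε<1/3)) (≤-reflexive
      (trans (*-comm _ _) (x/y*y 1# (<⇒≉0 (0<fromℕ {3} (s≤s z≤n)))))))
    1≤y : 1# ≤ y
    1≤y = ≤-trans (1≤fromℕ {3} (s≤s z≤n)) 3≤y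
    1≤α : 1# ≤ α
    1≤α = begin
      1#                ≈⟨ fromℕ-1 ⟨
      fromℕ 1           ≤⟨ ≤-log 1≤y 1 1 (s≤s z≤n) (begin
        fromℕ 2 ^ 1     ≈⟨ *-identityʳ _ ⟩
        fromℕ 2         ≤⟨ fromℕ-mono-≤ (ℕ.n≤1+n 2) ⟩
        fromℕ 3         ≤⟨ 3≤y ⟩
        y               ≈⟨ *-identityʳ y ⟨
        y ^ 1           ∎) ⟩
      α * fromℕ 1       ≈⟨ trans (*-congˡ fromℕ-1) (*-identityʳ α) ⟩
      α                 ∎
    conclude : ∃[ k ] 1 ℕ.≤ k × k ℕ.≤ n × fromℕ k ≤ α × (∀ i → i ℕ.≤ n → fromℕ i ≤ α → i ℕ.≤ k) →
      let B = fromℕ (binom≤ n α) in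
      fromℕ 256 ⁻¹ * (log₂ B / (log₂ (log₂ B) ^ 2)) ≤ fromℕ (hcP-deg ε (OR n))
    -- `k` serves both sides: k ≤ log(1/ε) gives 2ᵏ ε ≤ 1 for Yao's principle, and its maximality
    -- bounds the binomial sum by (n + 1)ᵏ.
    conclude (k , 1≤k , k≤n , k≤α , maximal) = from-counting {d = hcP-deg ε (OR n)} k (least-holds {HasHcPDegreeAtMost ε (OR n)} n (degree-≤-n n 0<ε)) 2≤n
      (≤-trans (*-monoˡ-≤ (proj₁ 0<ε) (≤-trans (≤-reflexive (fromℕ-^ 2 k)) (2^-≤ 1≤y k k≤α)))
        (≤-reflexive (x/y*y 1# (<⇒≉0 0<ε))))
      1≤k k≤n (ℕ.≤-trans (s≤s 2≤n) (binom≤-lower n 1≤n 1≤α)) (binom≤-upper n k maximal)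

theorem1p3 : (lem : ∀ {ℓ} → ExcludedMiddle ℓ) (ℝ : CompleteOrderedField) →
    let open CompleteOrderedField ℝ
        open Classical lem ℝ
    in ∃[ c ] 0# < c ×
       (∀ (n : ℕ) → 2 ℕ.≤ n →
        ∀ (ε : Carrier) → 0# < ε → ε < 1# / fromℕ 3 →
        let B = fromℕ (binom≤ n (log₂ (1# / ε))) in
        c * (log₂ B / (log₂ (log₂ B) ^ 2)) ≤ fromℕ (hcP-deg ε (OR n)))
theorem1p3 lem ℝ = _ , 0<x⁻¹ 0<256 , lower-bound
  where
  open Field lem ℝ
  open Main lem ℝ
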